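{- Let $p>3$ be a prime and let $C_k=\binom{2k}k/(k+1)$. Then, modulo $p$, $$\sum_{k=0}^{p-1}\frac{k\binom{4k}{2k}\binom{2k}k}{72^k}\equiv\frac32\sum_{k=0}^{p-1}\frac{\binom{4k}{2k}C_k}{72^k}\equiv\begin{cases}\left(\frac 6p\right)x\pmod p&\text{if}\ p=x^2+y^2\ \text{with}\ x,y\in\mathbb Z,\ 4\mid x-1,\ 2\mid y,\\[2pt] \frac 34\left(\frac 6p\right)\binom{(p+1)/2}{(p+1)/4}\pmod p&\text{if}\ p\equiv3\pmod4.\end{cases}$$
   Context: $\left(\frac{\cdot}{p}\right)$ is the Legendre symbol. For rational numbers $a,b$ whose denominators are not divisible by $p$, $a\equiv b\pmod{p}$ means $(a-b)/p$ has denominator not divisible by $p$. -}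

module Defs where

open import Data.Nat as ℕ using (ℕ; zero; suc)
open import Data.Nat.Divisibility using (_∣?_; _∣_)
open import Data.Nat.Primality using (Prime; prime⇒nonZero)
open import Data.Integer as ℤ using (ℤ; +_; ∣_∣)
open import Data.Rational as ℚ using (ℚ; 0ℚ; _+_; _-_; _*_)
open ℚ.ℚ using (denominatorℕ)
open import Data.Fin using (Fin; toℕ)
open import Data.Fin.Properties using (any?)
open import Data.Nat.Combinatorics using (_C_)
import Data.Nat.Properties
open import Relation.Nullary using (¬_; yes; no)

sumℚ : ℕ → (ℕ → ℚ) → ℚ
sumℚ zero    f = 0ℚ
sumℚ (suc n) f = sumℚ n f + f n

ℕ→ℚ : ℕ → ℚ
ℕ→ℚ n = (+ n) ℚ./ 1

ℤ→ℚ : ℤ → ℚ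
ℤ→ℚ z = z ℚ./ 1

divByPrime : ℚ → (p : ℕ) → Prime p → ℚ
divByPrime q p pp = q * ((+ 1) ℚ./ p)
  where instance _ = prime⇒nonZero pp

-- a ≡ b (mod p) for rationals: (a - b)/p has denominator not divisible by p
-- (ℚ is kept in lowest terms, so denominatorℕ is the reduced denominator)
CongQ : (p : ℕ) → Prime p → ℚ → ℚ → Set
CongQ p pp a b = ¬ (p ∣ denominatorℕ (divByPrime (a - b) p pp))

legendre : ℤ → ℕ → ℤ
legendre a p with p ∣? ∣ a ∣
... | yes _ = + 0
... | no  _ with any? {n = p} (λ (x : Fin p) → p ∣? ∣ (+ toℕ x) ℤ.* (+ toℕ x) ℤ.- a ∣)
...   | yes _ = + 1
...   | no  _ = ℤ.-[1+ 0 ]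

catalan : ℕ → ℚ
catalan k = (+ ((2 ℕ.* k) C k)) ℚ./ suc k

inv72^ : ℕ → ℚ
inv72^ k = (+ 1) ℚ./ (72 ℕ.^ k)
  where instance _ = Data.Nat.Properties.m^n≢0 72 k

term1 : ℕ → ℚ
term1 k = ℕ→ℚ (k ℕ.* ((4 ℕ.* k) C (2 ℕ.* k)) ℕ.* ((2 ℕ.* k) C k)) * inv72^ k

term2 : ℕ → ℚ
term2 k = ℕ→ℚ ((4 ℕ.* k) C (2 ℕ.* k)) * catalan k * inv72^ k

{-# OPTIONS --safe #-}
-- Write p = 2m + 1 and A_k = C(4k,2k) C(2k,k).  The terms satisfy the exact telescoping relation
--   term1 k - (3/2) term2 k = T_k - T_{k+1},  T_k = 9 k A_k / 72^k,
-- and T_p ≡ 0, so only the first sum S has to be evaluated.  Since m ≡ -1/2, A_k ≡ 16^k C(m,k) C(m-k,k),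
-- which makes S, up to a factor, the coefficient of t^m in (t² + t + 2/9)^(m-1).  Coefficients of t^(p-1)
-- are sums over all residues, as Σ_t t^e is -1 or 0 according to whether e = p - 1 or not (e < 2(p-1)).
-- Because t² + t + 2/9 = (t + 1/3)(t + 2/3), the substitution t = (s-1)/3 gives
--   S ≡ 3^m (Σ_s s^m (s²-1)^(m-1) - Σ_s s^(m-1) (s²-1)^(m-1)),
-- a single binomial coefficient.  The powers 2^m and 6^m come from C(2k,k) ≡ (-4)^k C(m,k) and Euler's
-- criterion.  For p ≡ 1 (mod 4) there remains Gauss's congruence C(2n,n) ≡ 2x with p = 4n + 1: a quartic
-- character χ with values in ℤ[i], reducing to t ↦ t^n modulo x + iy, has the Jacobi sum
-- J = Σ_r χ(r) χ(2-r) of norm p; J is divisible by x + iy, congruent to -1 modulo 2 + 2i, and its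
-- conjugate reduces to -C(3n,n), so that J = ±(x + iy) with a known sign.
module Submission where

open import Defs
open import Algebra.Bundles using (CommutativeRing)
import Algebra.Properties.CommutativeMonoid.Sum
import Algebra.Properties.CommutativeSemigroup
import Algebra.Solver.CommutativeMonoid
open import Data.Empty using (⊥; ⊥-elim)
open import Data.Fin using (Fin; zero; suc; toℕ; fromℕ<)
open import Data.Fin.Permutation using (Permutation′; _⟨$⟩ʳ_; permutation)
import Data.Fin.Properties as Fin
open import Data.Integer as ℤ using (ℤ; +_; +[1+_]; -[1+_]; ∣_∣; 0ℤ; 1ℤ)
open import Data.Integer.DivMod using (_%ℕ_; _/ℕ_; n%ℕd<d; a≡a%ℕn+[a/ℕn]*n)
open import Data.Integer.Divisibility as ℤD using ()
open import Data.Integer.Divisibility.Signed using (divides; ∣ᵤ⇒∣; ∣⇒∣ᵤ)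
import Data.Integer.GCD as ℤ
import Data.Integer.Properties as ℤ
open import Data.Integer.Tactic.RingSolver using (solve-∀)
open import Data.Nat as ℕ using (ℕ; zero; suc; _<_; _≤_; s≤s; z≤n; _∸_; _%_; _/_)
open import Data.Nat.Combinatorics using (_C_; nCn≡1; nC1≡n; nCk≡nC[n∸k]; nCk+nC[k+1]≡[n+1]C[k+1]; k>n⇒nCk≡0)
import Data.Nat.Coprimality as Coprimality
import Data.Nat.DivMod as ℕ
import Data.Nat.Divisibility as ℕ
open import Data.Nat.Primality using (Prime; prime⇒nonZero; prime⇒nonTrivial; prime⇒irreducible; euclidsLemma)
import Data.Nat.Properties as ℕ
import Data.Nat.Tactic.RingSolver as ℕ-Solver
open import Data.Product using (_,_; _×_; ∃; proj₁; proj₂)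
open import Data.Rational as ℚ using (ℚ; mkℚ; ↥_; ↧_; ↧ₙ_)
import Data.Rational.Properties as ℚ
open import Data.Sum using (_⊎_; inj₁; inj₂)
import Data.Sum as Sum
open import Function using (_∘_; id)
open import Level using (0ℓ)
open import Relation.Binary.Definitions using (tri<; tri≈; tri>)
import Relation.Binary.PropositionalEquality as ≡
open import Relation.Binary.PropositionalEquality using (_≡_; _≢_)
import Relation.Binary.Reasoning.Setoid
open import Relation.Nullary using (¬_; Dec; yes; no)
import Relation.Nullary.Decidable as Dec
open import Relation.Nullary.Decidable using (from-yes; _×-dec_; _⊎-dec_; ¬?; decidable-stable)

-- Finite sums and binomial coefficients

-- The constant 72 is special: 16/72 = 2/9 gives t² + t + 2/9 the square discriminant 1/9, and its
-- roots form an arithmetic progression with 0, so the cubic t (t + 1/3) (t + 2/3) is, once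
-- recentred, a multiple of s³ - s. In s^e (s² - 1)^(m-1) only exponents of the parity of e occur
-- while p - 1 is even, so exactly one of the two sums survives: e = m for p ≡ 1 and e = m - 1 for p
-- ≡ 3 modulo 4. This is the origin of the two cases. Working modulo p alone cannot tie C(2n,n) to
-- the integer x. The character is therefore lifted to ℤ[i], where norm and divisibility give exact
-- equations. Gauss sums live outside ℤ[i], so the norm of J is obtained by rearranging a double
-- sum. Taking 2 - r instead of 1 - r centres J at 1 and turns its terms into powers of 1 - t², to
-- which the binomial sums of the series apply again. The telescoping is carried out in ℚ because
-- the Catalan factor at k = p - 1 is written with denominator p, so that the second series is not
-- reduced term by term.

module Summation {c ℓ} (R : CommutativeRing c ℓ) where
  open CommutativeRing R
  open Relation.Binary.Reasoning.Setoid setoid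
  open Algebra.Properties.CommutativeSemigroup +-commutativeSemigroup using (interchange)
  private module FinSum = Algebra.Properties.CommutativeMonoid.Sum +-commutativeMonoid

  Σ : ℕ → (ℕ → Carrier) → Carrier
  Σ zero    f = 0#
  Σ (suc n) f = Σ n f + f n

  Σ-cong : ∀ n {f g} → (∀ k → k < n → f k ≈ g k) → Σ n f ≈ Σ n g
  Σ-cong zero    eq = refl
  Σ-cong (suc n) eq =
    +-cong (Σ-cong n (λ k k<n → eq k (ℕ.m<n⇒m<1+n k<n))) (eq n (ℕ.n<1+n n))

  Σ-ext : ∀ n {f g} → (∀ k → f k ≈ g k) → Σ n f ≈ Σ n g
  Σ-ext n eq = Σ-cong n (λ k _ → eq k)

  Σ-zero : ∀ n {f} → (∀ k → k < n → f k ≈ 0#) → Σ n f ≈ 0#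
  Σ-zero zero    eq = refl
  Σ-zero (suc n) eq = trans
    (+-cong (Σ-zero n (λ k k<n → eq k (ℕ.m<n⇒m<1+n k<n))) (eq n (ℕ.n<1+n n)))
    (+-identityˡ 0#)

  Σ-distrib-+ : ∀ n f g → Σ n (λ k → f k + g k) ≈ Σ n f + Σ n g
  Σ-distrib-+ zero    f g = sym (+-identityˡ 0#)
  Σ-distrib-+ (suc n) f g = trans (+-congʳ (Σ-distrib-+ n f g)) (interchange _ _ _ _)

  *-distribˡ-Σ : ∀ n a f → a * Σ n f ≈ Σ n (λ k → a * f k)
  *-distribˡ-Σ zero    a f = zeroʳ a
  *-distribˡ-Σ (suc n) a f = trans (distribˡ a _ _) (+-congʳ (*-distribˡ-Σ n a f))

  *-distribʳ-Σ : ∀ n a f → Σ n f * a ≈ Σ n (λ k → f k * a)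
  *-distribʳ-Σ zero    a f = zeroˡ a
  *-distribʳ-Σ (suc n) a f = trans (distribʳ a _ _) (+-congʳ (*-distribʳ-Σ n a f))

  Σ-comm : ∀ m n (f : ℕ → ℕ → Carrier) →
           Σ m (λ i → Σ n (f i)) ≈ Σ n (λ j → Σ m (λ i → f i j))
  Σ-comm zero    n f = sym (Σ-zero n (λ _ _ → refl))
  Σ-comm (suc m) n f = trans (+-congʳ (Σ-comm m n f)) (sym (Σ-distrib-+ n _ _))

  Σ-split : ∀ m n f → Σ (n ℕ.+ m) f ≈ Σ m f + Σ n (λ k → f (k ℕ.+ m))
  Σ-split m zero    f = sym (+-identityʳ _)
  Σ-split m (suc n) f = trans (+-congʳ (Σ-split m n f)) (+-assoc _ _ _)

  Σ-head : ∀ n f → Σ (suc n) f ≈ f 0 + Σ n (f ∘ suc)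
  Σ-head zero    f = +-comm _ _
  Σ-head (suc n) f = trans (+-congʳ (Σ-head n f)) (+-assoc _ _ _)

  Σ-sum : ∀ n f → Σ n f ≈ FinSum.sum {n} (f ∘ toℕ)
  Σ-sum zero    f = refl
  Σ-sum (suc n) f = trans (Σ-head n f) (+-congˡ (Σ-sum n (f ∘ suc)))

  Σ-permute : ∀ n (f : ℕ → Carrier) (π : Permutation′ n) {g : ℕ → Carrier} →
              (∀ (i : Fin n) → g (toℕ i) ≈ f (toℕ (π ⟨$⟩ʳ i))) → Σ n f ≈ Σ n g
  Σ-permute n f π {g} eq = begin
    Σ n f                             ≈⟨ Σ-sum n f ⟩
    FinSum.sum {n} (f ∘ toℕ)          ≈⟨ FinSum.sum-permute {n} {n} (f ∘ toℕ) π ⟩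
    FinSum.sum {n} (λ i → f (toℕ (π ⟨$⟩ʳ i))) ≈⟨ FinSum.sum-cong-≋ {n} (λ i → sym (eq i)) ⟩
    FinSum.sum {n} (g ∘ toℕ)          ≈⟨ Σ-sum n g ⟨
    Σ n g                             ∎

  Σ-reverse : ∀ n f → Σ n f ≈ Σ n (λ k → f (n ∸ suc k))
  Σ-reverse zero    f = refl
  Σ-reverse (suc n) f = begin
    Σ n f + f n                           ≈⟨ +-comm _ _ ⟩
    f n + Σ n f                           ≈⟨ +-congˡ (Σ-reverse n f) ⟩
    f n + Σ n (λ k → f (n ∸ suc k))       ≈⟨ Σ-head n (λ k → f (n ∸ k)) ⟨
    Σ (suc n) (λ k → f (n ∸ k))           ∎

2k≡k+k : ∀ k → 2 ℕ.* k ≡ k ℕ.+ k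
2k≡k+k k = ≡.cong (k ℕ.+_) (ℕ.+-identityʳ k)

[1+k]*[1+n]C[1+k]≡[1+n]*nCk : ∀ n k → suc k ℕ.* (suc n C suc k) ≡ suc n ℕ.* (n C k)
[1+k]*[1+n]C[1+k]≡[1+n]*nCk n zero = begin
  1 ℕ.* (suc n C 1) ≡⟨ ℕ.*-identityˡ (suc n C 1) ⟩
  suc n C 1 ≡⟨ nC1≡n (suc n) ⟩
  suc n ≡⟨ ℕ.*-identityʳ (suc n) ⟨
  suc n ℕ.* (n C 0) ∎
  where open ≡.≡-Reasoning
[1+k]*[1+n]C[1+k]≡[1+n]*nCk zero (suc k) = begin
  suc (suc k) ℕ.* (1 C suc (suc k)) ≡⟨ ≡.cong (suc (suc k) ℕ.*_) (k>n⇒nCk≡0 {1} {suc (suc k)} (s≤s (s≤s z≤n))) ⟩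
  suc (suc k) ℕ.* 0 ≡⟨ ℕ.*-zeroʳ k ⟩
  0 ≡⟨ ≡.cong (1 ℕ.*_) (k>n⇒nCk≡0 {0} {suc k} (s≤s z≤n)) ⟨
  1 ℕ.* (0 C suc k) ∎
  where open ≡.≡-Reasoning
[1+k]*[1+n]C[1+k]≡[1+n]*nCk (suc n) (suc k) = begin
  suc (suc k) ℕ.* (suc (suc n) C suc (suc k))
    ≡⟨ ≡.cong (suc (suc k) ℕ.*_) (nCk+nC[k+1]≡[n+1]C[k+1] (suc n) (suc k)) ⟨
  suc (suc k) ℕ.* (a ℕ.+ (suc n C suc (suc k)))
    ≡⟨ split k a _ ⟩
  a ℕ.+ suc k ℕ.* a ℕ.+ suc (suc k) ℕ.* (suc n C suc (suc k))
    ≡⟨ ≡.cong₂ (λ x y → a ℕ.+ x ℕ.+ y) ([1+k]*[1+n]C[1+k]≡[1+n]*nCk n k) ([1+k]*[1+n]C[1+k]≡[1+n]*nCk n (suc k)) ⟩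
  a ℕ.+ suc n ℕ.* (n C k) ℕ.+ suc n ℕ.* (n C suc k)
    ≡⟨ merge n a _ _ ⟩
  a ℕ.+ suc n ℕ.* ((n C k) ℕ.+ (n C suc k))
    ≡⟨ ≡.cong (λ x → a ℕ.+ suc n ℕ.* x) (nCk+nC[k+1]≡[n+1]C[k+1] n k) ⟩
  suc (suc n) ℕ.* a ∎
  where
  open ≡.≡-Reasoning
  a = suc n C suc k
  split : ∀ k a b → suc (suc k) ℕ.* (a ℕ.+ b) ≡ a ℕ.+ suc k ℕ.* a ℕ.+ suc (suc k) ℕ.* b
  split = ℕ-Solver.solve-∀
  merge : ∀ n a b c → a ℕ.+ suc n ℕ.* b ℕ.+ suc n ℕ.* c ≡ a ℕ.+ suc n ℕ.* (b ℕ.+ c)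
  merge = ℕ-Solver.solve-∀

[1+k]*nC[1+k]+k*nCk≡n*nCk : ∀ n k → suc k ℕ.* (n C suc k) ℕ.+ k ℕ.* (n C k) ≡ n ℕ.* (n C k)
[1+k]*nC[1+k]+k*nCk≡n*nCk n k = ℕ.+-cancelˡ-≡ (n C k) _ _ (begin
  (n C k) ℕ.+ (suc k ℕ.* (n C suc k) ℕ.+ k ℕ.* (n C k)) ≡⟨ regroup k (n C k) (n C suc k) ⟩
  suc k ℕ.* ((n C k) ℕ.+ (n C suc k))           ≡⟨ ≡.cong (suc k ℕ.*_) (nCk+nC[k+1]≡[n+1]C[k+1] n k) ⟩
  suc k ℕ.* (suc n C suc k)                     ≡⟨ [1+k]*[1+n]C[1+k]≡[1+n]*nCk n k ⟩
  suc n ℕ.* (n C k)                             ∎)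
  where
  open ≡.≡-Reasoning
  regroup : ∀ k a b → a ℕ.+ (suc k ℕ.* b ℕ.+ k ℕ.* a) ≡ suc k ℕ.* (a ℕ.+ b)
  regroup = ℕ-Solver.solve-∀

[1+2k]C[k]≡[1+2k]C[1+k] : ∀ k → suc (k ℕ.+ k) C k ≡ suc (k ℕ.+ k) C suc k
[1+2k]C[k]≡[1+2k]C[1+k] k = ≡.trans (nCk≡nC[n∸k] (ℕ.m≤n⇒m≤1+n (ℕ.m≤m+n k k)))
  (≡.cong (suc (k ℕ.+ k) C_) (ℕ.m+n∸n≡m (suc k) k))

[1+k]*[1+2k]Ck≡[1+2k]*[2k]Ck : ∀ k → suc k ℕ.* (suc (k ℕ.+ k) C k) ≡ suc (k ℕ.+ k) ℕ.* ((k ℕ.+ k) C k)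
[1+k]*[1+2k]Ck≡[1+2k]*[2k]Ck k = ≡.trans (≡.cong (suc k ℕ.*_) ([1+2k]C[k]≡[1+2k]C[1+k] k))
  ([1+k]*[1+n]C[1+k]≡[1+n]*nCk (k ℕ.+ k) k)

[2+2k]C[1+k]≡2*[1+2k]Ck : ∀ k → suc (suc (k ℕ.+ k)) C suc k ≡ 2 ℕ.* (suc (k ℕ.+ k) C k)
[2+2k]C[1+k]≡2*[1+2k]Ck k = begin
  suc (suc (k ℕ.+ k)) C suc k                  ≡⟨ nCk+nC[k+1]≡[n+1]C[k+1] (suc (k ℕ.+ k)) k ⟨
  a ℕ.+ (suc (k ℕ.+ k) C suc k)                ≡⟨ ≡.cong (a ℕ.+_) ([1+2k]C[k]≡[1+2k]C[1+k] k) ⟨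
  a ℕ.+ a                                      ≡⟨ 2k≡k+k a ⟨
  2 ℕ.* a                                      ∎
  where
  open ≡.≡-Reasoning
  a = suc (k ℕ.+ k) C k

central-step : ∀ k → suc k ℕ.* (suc (suc (k ℕ.+ k)) C suc k) ≡ 2 ℕ.* suc (k ℕ.+ k) ℕ.* ((k ℕ.+ k) C k)
central-step k = begin
  suc k ℕ.* (suc (suc (k ℕ.+ k)) C suc k)  ≡⟨ ≡.cong (suc k ℕ.*_) ([2+2k]C[1+k]≡2*[1+2k]Ck k) ⟩
  suc k ℕ.* (2 ℕ.* a)                      ≡⟨ swap (suc k) a ⟩
  2 ℕ.* (suc k ℕ.* a)                      ≡⟨ ≡.cong (2 ℕ.*_) ([1+k]*[1+2k]Ck≡[1+2k]*[2k]Ck k) ⟩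
  2 ℕ.* (suc (k ℕ.+ k) ℕ.* ((k ℕ.+ k) C k)) ≡⟨ ℕ.*-assoc 2 (suc (k ℕ.+ k)) _ ⟨
  2 ℕ.* suc (k ℕ.+ k) ℕ.* ((k ℕ.+ k) C k)  ∎
  where
  open ≡.≡-Reasoning
  a = suc (k ℕ.+ k) C k
  swap : ∀ x y → x ℕ.* (2 ℕ.* y) ≡ 2 ℕ.* (x ℕ.* y)
  swap = ℕ-Solver.solve-∀

module ModularArithmetic where

  open import Data.Integer using (_+_; _*_; -_; _-_; _^_)

  -- Congruences of integers

  ^-distribʳ-* : ∀ a b n → (a * b) ^ n ≡ a ^ n * b ^ n
  ^-distribʳ-* a b zero    = ≡.refl
  ^-distribʳ-* a b (suc n) = ≡.trans (≡.cong (a * b *_) (^-distribʳ-* a b n)) (swap a b (a ^ n) (b ^ n))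
    where
    swap : ∀ a b x y → a * b * (x * y) ≡ a * x * (b * y)
    swap = solve-∀

  pos-suc : ∀ n → + suc n ≡ + n + 1ℤ
  pos-suc n = ≡.cong +_ (ℕ.+-comm 1 n)

  module Congruence (p : ℕ) where

    infix 4 _≋_ _≋?_

    -- The quotient is kept as data so that a congruence can be read back as an exact equation, as
    -- in `reJ≡`.
    record _≋_ (a b : ℤ) : Set where
      constructor quot
      field
        quotient : ℤ
        equality : a ≡ b + quotient * + p

    ≋-reflexive : ∀ {a b} → a ≡ b → a ≋ b
    ≋-reflexive {a} ≡.refl = quot 0ℤ (lem a (+ p))
      where
      lem : ∀ a q → a ≡ a + 0ℤ * q
      lem = solve-∀

    ≋-refl : ∀ {a} → a ≋ a
    ≋-refl = ≋-reflexive ≡.refl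

    -- A certificate with one generator: the cofactor `c` exhibits u - v as a multiple of x - y.
    -- Many congruences below consist of a choice of `c` and a polynomial identity.
    linear : ∀ c {x y u v} → x ≋ y → u - v ≡ c * (x - y) → u ≋ v
    linear c {x} {y} {u} {v} (quot q eq) h = quot (c * q) (begin
      u                            ≡⟨ back u v ⟩
      v + (u - v)                  ≡⟨ ≡.cong (λ z → v + z) h ⟩
      v + c * (x - y)              ≡⟨ ≡.cong (λ z → v + c * (z - y)) eq ⟩
      v + c * (y + q * + p - y)    ≡⟨ lem v c y q (+ p) ⟩
      v + c * q * + p              ∎)
      where
      open ≡.≡-Reasoning
      back : ∀ u v → u ≡ v + (u - v)
      back = solve-∀
      lem : ∀ v c y q P → v + c * (y + q * P - y) ≡ v + c * q * P
      lem = solve-∀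

    ≋-sym : ∀ {a b} → a ≋ b → b ≋ a
    ≋-sym {a} {b} h = linear (- 1ℤ) h (lem a b)
      where
      lem : ∀ a b → b - a ≡ - 1ℤ * (a - b)
      lem = solve-∀

    ≋-trans : ∀ {a b c} → a ≋ b → b ≋ c → a ≋ c
    ≋-trans {c = c} (quot q ≡.refl) (quot r ≡.refl) = quot (r + q) (lem c r q (+ p))
      where
      lem : ∀ c r q P → c + r * P + q * P ≡ c + (r + q) * P
      lem = solve-∀

    +-cong : ∀ {a b c d} → a ≋ b → c ≋ d → a + c ≋ b + d
    +-cong {b = b} {d = d} (quot q ≡.refl) (quot r ≡.refl) = quot (q + r) (lem b d q r (+ p))
      where
      lem : ∀ b d q r P → b + q * P + (d + r * P) ≡ b + d + (q + r) * P
      lem = solve-∀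

    *-cong : ∀ {a b c d} → a ≋ b → c ≋ d → a * c ≋ b * d
    *-cong {b = b} {d = d} (quot q ≡.refl) (quot r ≡.refl) =
      quot (q * d + b * r + q * r * + p) (lem b d q r (+ p))
      where
      lem : ∀ b d q r P → (b + q * P) * (d + r * P) ≡ b * d + (q * d + b * r + q * r * P) * P
      lem = solve-∀

    neg-cong : ∀ {a b} → a ≋ b → - a ≋ - b
    neg-cong {a} {b} h = linear (- 1ℤ) h (lem a b)
      where
      lem : ∀ a b → - a - - b ≡ - 1ℤ * (a - b)
      lem = solve-∀

    sub-cong : ∀ {a b c d} → a ≋ b → c ≋ d → a - c ≋ b - d
    sub-cong h k = +-cong h (neg-cong k)

    ^-cong : ∀ {a b} n → a ≋ b → a ^ n ≋ b ^ n
    ^-cong zero    h = ≋-refl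
    ^-cong (suc n) h = *-cong h (^-cong n h)

    ℤ/p : CommutativeRing 0ℓ 0ℓ
    ℤ/p = record
      { Carrier = ℤ ; _≈_ = _≋_ ; _+_ = _+_ ; _*_ = _*_ ; -_ = -_ ; 0# = 0ℤ ; 1# = 1ℤ
      ; isCommutativeRing = record
        { isRing = record
          { +-isAbelianGroup = record
            { isGroup = record
              { isMonoid = record
                { isSemigroup = record
                  { isMagma = record
                    { isEquivalence = record { refl = ≋-refl ; sym = ≋-sym ; trans = ≋-trans }
                    ; ∙-cong = +-cong }
                  ; assoc = λ a b c → ≋-reflexive (ℤ.+-assoc a b c) }
                ; identity = ≋-reflexive ∘ ℤ.+-identityˡ , ≋-reflexive ∘ ℤ.+-identityʳ }
              ; inverse = ≋-reflexive ∘ ℤ.+-inverseˡ , ≋-reflexive ∘ ℤ.+-inverseʳ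
              ; ⁻¹-cong = neg-cong }
            ; comm = λ a b → ≋-reflexive (ℤ.+-comm a b) }
          ; *-cong = *-cong
          ; *-assoc = λ a b c → ≋-reflexive (ℤ.*-assoc a b c)
          ; *-identity = ≋-reflexive ∘ ℤ.*-identityˡ , ≋-reflexive ∘ ℤ.*-identityʳ
          ; distrib = (λ a b c → ≋-reflexive (ℤ.*-distribˡ-+ a b c))
                    , (λ a b c → ≋-reflexive (ℤ.*-distribʳ-+ a b c)) }
        ; *-comm = λ a b → ≋-reflexive (ℤ.*-comm a b) } }

    open Summation ℤ/p public
    module ≋-Reasoning = Relation.Binary.Reasoning.Setoid (CommutativeRing.setoid ℤ/p)

    *-congˡ : ∀ {a b} c → a ≋ b → c * a ≋ c * b
    *-congˡ c = *-cong (≋-refl {c})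

    *-congʳ : ∀ {a b} c → a ≋ b → a * c ≋ b * c
    *-congʳ c h = *-cong h (≋-refl {c})

    binomial : ∀ N x y → (x + y) ^ N ≋ Σ (suc N) (λ j → + (N C j) * (x ^ j * y ^ (N ∸ j)))
    binomial zero    x y = ≋-refl
    binomial (suc N) x y = begin
      (x + y) * (x + y) ^ N
        ≈⟨ *-congˡ (x + y) (binomial N x y) ⟩
      (x + y) * Σ (suc N) b
        ≡⟨ ℤ.*-distribʳ-+ (Σ (suc N) b) x y ⟩
      x * Σ (suc N) b + y * Σ (suc N) b
        ≈⟨ +-cong (*-distribˡ-Σ (suc N) x b) (≋-trans (*-distribˡ-Σ (suc N) y b) extend) ⟩
      Σ (suc N) (λ j → x * b j) + (b′ 0 + Σ (suc N) (λ j → b′ (suc j)))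
        ≡⟨ swap (Σ (suc N) (λ j → x * b j)) (b′ 0) (Σ (suc N) (λ j → b′ (suc j))) ⟩
      b′ 0 + (Σ (suc N) (λ j → x * b j) + Σ (suc N) (λ j → b′ (suc j)))
        ≈⟨ +-cong (≋-refl {b′ 0}) (Σ-distrib-+ (suc N) (λ j → x * b j) (λ j → b′ (suc j))) ⟨
      b′ 0 + Σ (suc N) (λ j → x * b j + b′ (suc j))
        ≈⟨ +-cong (≋-refl {b′ 0}) (Σ-ext (suc N) (≋-reflexive ∘ pascal)) ⟩
      B 0 + Σ (suc N) (B ∘ suc)
        ≈⟨ Σ-head (suc N) B ⟨
      Σ (suc (suc N)) B ∎
      where
      open ≋-Reasoning
      b b′ B : ℕ → ℤ
      b  j = + (N C j) * (x ^ j * y ^ (N ∸ j))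
      b′ j = + (N C j) * (x ^ j * y ^ (suc N ∸ j))
      B  j = + (suc N C j) * (x ^ j * y ^ (suc N ∸ j))

      pull : ∀ y a b c → y * (a * (b * c)) ≡ a * (b * (y * c))
      pull = solve-∀

      step : ∀ j → j < suc N → y * b j ≋ b′ j
      step j (s≤s j≤N) = ≋-reflexive (≡.trans (pull y (+ (N C j)) (x ^ j) (y ^ (N ∸ j)))
        (≡.cong (λ e → + (N C j) * (x ^ j * y ^ e)) (≡.sym (ℕ.+-∸-assoc 1 j≤N))))

      last-zero : b′ (suc N) ≡ 0ℤ
      last-zero = ≡.cong (λ c → + c * (x ^ suc N * y ^ (N ∸ N))) (k>n⇒nCk≡0 (ℕ.n<1+n N))

      -- The zero term at `suc N` is appended so that, once index 0 is split off, both halves of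
      -- Pascal's rule range over the same indices.
      extend : Σ (suc N) (λ j → y * b j) ≋ b′ 0 + Σ (suc N) (b′ ∘ suc)
      extend = begin
        Σ (suc N) (λ j → y * b j)     ≈⟨ Σ-cong (suc N) step ⟩
        Σ (suc N) b′                  ≡⟨ ℤ.+-identityʳ (Σ (suc N) b′) ⟨
        Σ (suc N) b′ + 0ℤ             ≡⟨ ≡.cong (λ z → Σ (suc N) b′ + z) last-zero ⟨
        Σ (suc (suc N)) b′            ≈⟨ Σ-head (suc N) b′ ⟩
        b′ 0 + Σ (suc N) (b′ ∘ suc)   ∎

      swap : ∀ a b c → a + (b + c) ≡ b + (a + c)
      swap = solve-∀

      collect : ∀ x a b c d → x * (a * (c * d)) + b * (x * c * d) ≡ (a + b) * (x * c * d)
      collect = solve-∀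

      pascal : ∀ j → x * b j + b′ (suc j) ≡ B (suc j)
      pascal j = ≡.trans (collect x (+ (N C j)) (+ (N C suc j)) (x ^ j) (y ^ (N ∸ j)))
        (≡.cong (λ c → + c * (x ^ suc j * y ^ (N ∸ j))) (nCk+nC[k+1]≡[n+1]C[k+1] N j))

    ∣⇒≋ : ∀ {a b} → p ℕ.∣ ∣ a - b ∣ → a ≋ b
    ∣⇒≋ {a} {b} h with ∣ᵤ⇒∣ {+ p} {a - b} h
    ... | divides q eq = quot q (≡.trans (back a b) (≡.cong (λ z → b + z) eq))
      where
      back : ∀ a b → a ≡ b + (a - b)
      back = solve-∀

    ≋⇒∣ : ∀ {a b} → a ≋ b → p ℕ.∣ ∣ a - b ∣
    ≋⇒∣ {a} {b} (quot q eq) = ∣⇒∣ᵤ (divides q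
      (≡.trans (≡.cong (_- b) eq) (lem b q (+ p))))
      where
      lem : ∀ b q P → b + q * P - b ≡ q * P
      lem = solve-∀

    ≋0⇒∣ : ∀ {a} → a ≋ 0ℤ → p ℕ.∣ ∣ a ∣
    ≋0⇒∣ {a} h = ≡.subst (λ z → p ℕ.∣ ∣ z ∣) (ℤ.+-identityʳ a) (≋⇒∣ h)

    ∣⇒≋0 : ∀ {a} → p ℕ.∣ ∣ a ∣ → a ≋ 0ℤ
    ∣⇒≋0 {a} h = ∣⇒≋ (≡.subst (λ z → p ℕ.∣ ∣ z ∣) (≡.sym (ℤ.+-identityʳ a)) h)

    _≋?_ : ∀ a b → Dec (a ≋ b)
    a ≋? b = Dec.map′ ∣⇒≋ ≋⇒∣ (p ℕ.∣? ∣ a - b ∣)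

    p≋0 : + p ≋ 0ℤ
    p≋0 = quot 1ℤ (lem (+ p))
      where
      lem : ∀ P → P ≡ 0ℤ + 1ℤ * P
      lem = solve-∀

    small≢0 : ∀ k → 0 < k → k < p → ¬ (+ k ≋ 0ℤ)
    small≢0 (suc k) _ k<p h = ℕ.<⇒≱ k<p (ℕ.∣⇒≤ (≋0⇒∣ h))

    ≋⇒-≋0 : ∀ {a b} → a ≋ b → a - b ≋ 0ℤ
    ≋⇒-≋0 {a} {b} h = linear 1ℤ h (lem a b)
      where
      lem : ∀ a b → a - b - 0ℤ ≡ 1ℤ * (a - b)
      lem = solve-∀

    -≋0⇒≋ : ∀ {a b} → a - b ≋ 0ℤ → a ≋ b
    -≋0⇒≋ {a} {b} h = linear 1ℤ h (lem a b)
      where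
      lem : ∀ a b → a - b ≡ 1ℤ * (a - b - 0ℤ)
      lem = solve-∀

    -- Arithmetic modulo a prime and Fermat's theorem

    module PrimeModulus (pp : Prime p) where

      private instance _ = prime⇒nonZero pp

      1≢0 : ¬ 1ℤ ≋ 0ℤ
      1≢0 h = ℕ.nonTrivial⇒≢1 {{prime⇒nonTrivial pp}} (ℕ.∣1⇒≡1 (≋0⇒∣ h))

      integral : ∀ a b → a * b ≋ 0ℤ → a ≋ 0ℤ ⊎ b ≋ 0ℤ
      integral a b h = Sum.map ∣⇒≋0 ∣⇒≋0
        (euclidsLemma ∣ a ∣ ∣ b ∣ pp (≡.subst (p ℕ.∣_) (ℤ.abs-* a b) (≋0⇒∣ h)))

      *-nonzero : ∀ {a b} → ¬ a ≋ 0ℤ → ¬ b ≋ 0ℤ → ¬ a * b ≋ 0ℤ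
      *-nonzero {a} {b} a≢0 b≢0 h = Sum.[ a≢0 , b≢0 ] (integral a b h)

      *-cancelˡ : ∀ {a b} c → ¬ c ≋ 0ℤ → c * a ≋ c * b → a ≋ b
      *-cancelˡ {a} {b} c c≢0 h with integral c (a - b) (linear 1ℤ h (lem a b c))
        where
        lem : ∀ a b c → c * (a - b) - 0ℤ ≡ 1ℤ * (c * a - c * b)
        lem = solve-∀
      ... | inj₁ c≋0   = ⊥-elim (c≢0 c≋0)
      ... | inj₂ a-b≋0 = -≋0⇒≋ a-b≋0

      residue : ℤ → ℕ
      residue a = a %ℕ p

      residue< : ∀ a → residue a < p
      residue< a = n%ℕd<d a p

      residue-≋ : ∀ a → + residue a ≋ a
      residue-≋ a = ≋-sym (quot (a /ℕ p) (a≡a%ℕn+[a/ℕn]*n a p))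

      ≋⇒≡-≤ : ∀ {j k} → j ≤ k → k < p → + k ≋ + j → k ≡ j
      ≋⇒≡-≤ {j} {k} j≤k k<p h with k ∸ j in eq
      ... | zero  = ℕ.≤-antisym (ℕ.m∸n≡0⇒m≤n eq) j≤k
      ... | suc d = ⊥-elim (small≢0 (suc d) (s≤s z≤n)
        (ℕ.≤-<-trans (ℕ.≤-trans (ℕ.≤-reflexive (≡.sym eq)) (ℕ.m∸n≤m k j)) k<p)
        (≋-trans (≋-reflexive (≡.trans (≡.cong +_ (≡.sym eq))
          (≡.sym (≡.trans (ℤ.m-n≡m⊖n k j) (ℤ.⊖-≥ j≤k))))) (≋⇒-≋0 h)))

      ≋⇒≡ : ∀ {j k} → j < p → k < p → + j ≋ + k → j ≡ k
      ≋⇒≡ {j} {k} j<p k<p h with ℕ.≤-total j k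
      ... | inj₁ j≤k = ≡.sym (≋⇒≡-≤ j≤k k<p (≋-sym h))
      ... | inj₂ k≤j = ≋⇒≡-≤ k≤j j<p h

      module Reindexing {c ℓ} (R : CommutativeRing c ℓ) where
        private module R = CommutativeRing R
        private module ΣR = Summation R

        -- Passing to canonical representatives turns `σ` and `τ`, inverse to each other only modulo
        -- p, into a permutation of `Fin p`. The values lie in an arbitrary ring because the same
        -- substitutions serve sums modulo p and character sums in ℤ[i].
        reindex : (f : ℤ → R.Carrier) → (∀ {a b} → a ≋ b → f a R.≈ f b) →
                  (σ τ : ℤ → ℤ) → (∀ {a b} → a ≋ b → σ a ≋ σ b) → (∀ {a b} → a ≋ b → τ a ≋ τ b) →
                  (∀ a → σ (τ a) ≋ a) → (∀ a → τ (σ a) ≋ a) →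
                  ΣR.Σ p (λ t → f (+ t)) R.≈ ΣR.Σ p (λ t → f (σ (+ t)))
        reindex f f-cong σ τ σ-cong τ-cong στ τσ =
          ΣR.Σ-permute p (λ t → f (+ t)) π (λ i → f-cong (≋-sym (class-≋ (σ (+ toℕ i)))))
          where
          class : ℤ → Fin p
          class a = fromℕ< (residue< a)

          class-≋ : ∀ a → + toℕ (class a) ≋ a
          class-≋ a = ≋-trans (≋-reflexive (≡.cong +_ (Fin.toℕ-fromℕ< (residue< a)))) (residue-≋ a)

          to from : Fin p → Fin p
          to   i = class (σ (+ toℕ i))
          from i = class (τ (+ toℕ i))

          unique : ∀ {i j : Fin p} → + toℕ i ≋ + toℕ j → i ≡ j
          unique {i} {j} h = Fin.toℕ-injective (≋⇒≡ (Fin.toℕ<n i) (Fin.toℕ<n j) h)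

          π : Permutation′ p
          π = permutation to from
            (λ i → unique (≋-trans (class-≋ _) (≋-trans (σ-cong (class-≋ _)) (στ _))))
            (λ i → unique (≋-trans (class-≋ _) (≋-trans (τ-cong (class-≋ _)) (τσ _))))

      open Reindexing ℤ/p public

      -- From (j + 1) C(p, j + 1) = p C(p - 1, j), where j + 1 is a unit.
      p∣pCj : ∀ j → suc j < p → + (p C suc j) ≋ 0ℤ
      p∣pCj j j<p = *-cancelˡ (+ suc j) (small≢0 (suc j) (s≤s z≤n) j<p)
        (≋-trans (≋-reflexive (≡.sym (ℤ.pos-* (suc j) (p C suc j)))) (lem p ≡.refl))
        where
        lem : ∀ q → q ≡ p → + (suc j ℕ.* (p C suc j)) ≋ + suc j * 0ℤ
        lem zero    ≡.refl = ⊥-elim (ℕ.n≮0 j<p)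
        lem (suc q) ≡.refl = begin
          + (suc j ℕ.* (suc q C suc j)) ≡⟨ ≡.cong +_ ([1+k]*[1+n]C[1+k]≡[1+n]*nCk q j) ⟩
          + (suc q ℕ.* (q C j))         ≡⟨ ℤ.pos-* (suc q) (q C j) ⟩
          + suc q * + (q C j)           ≈⟨ *-congʳ (+ (q C j)) p≋0 ⟩
          0ℤ                            ≡⟨ ℤ.*-zeroʳ (+ suc j) ⟨
          + suc j * 0ℤ ∎
          where open ≋-Reasoning

      -- Induction on t: in the expansion of (1 + t)^p only the two outer terms survive.
      fermat-ℕ : ∀ t → (+ t) ^ p ≋ + t
      fermat-ℕ zero    = lem p ≡.refl
        where
        lem : ∀ q → q ≡ p → 0ℤ ^ q ≋ 0ℤ
        lem zero    ≡.refl = ⊥-elim (ℕ.≢-nonZero⁻¹ p ≡.refl)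
        lem (suc q) _ = ≋-refl
      fermat-ℕ (suc t) = lem p ≡.refl
        where
        open ≋-Reasoning
        lem : ∀ q → q ≡ p → (+ suc t) ^ q ≋ + suc t
        lem zero    ≡.refl = ⊥-elim (ℕ.≢-nonZero⁻¹ p ≡.refl)
        lem (suc q) ≡.refl = begin
          (1ℤ + + t) ^ suc q
            ≈⟨ binomial (suc q) 1ℤ (+ t) ⟩
          Σ (suc (suc q)) b
            ≈⟨ Σ-head (suc q) b ⟩
          b 0 + (Σ q (b ∘ suc) + b (suc q))
            ≈⟨ +-cong (≋-reflexive (ℤ.*-identityˡ (1ℤ * (+ t) ^ suc q)))
                      (+-cong (Σ-zero q middle) (≋-reflexive last)) ⟩
          1ℤ * (+ t) ^ suc q + (0ℤ + 1ℤ)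
            ≡⟨ ≡.cong (_+ (0ℤ + 1ℤ)) (ℤ.*-identityˡ ((+ t) ^ suc q)) ⟩
          (+ t) ^ suc q + 1ℤ
            ≈⟨ +-cong (fermat-ℕ t) (≋-refl {1ℤ}) ⟩
          + t + 1ℤ
            ≡⟨ pos-suc t ⟨
          + suc t ∎
          where
          b : ℕ → ℤ
          b j = + (suc q C j) * (1ℤ ^ j * (+ t) ^ (suc q ∸ j))
          middle : ∀ k → k < q → b (suc k) ≋ 0ℤ
          middle k k<q = *-congʳ (1ℤ ^ suc k * (+ t) ^ (suc q ∸ suc k)) (p∣pCj k (s≤s k<q))
          last : b (suc q) ≡ 1ℤ
          last rewrite nCn≡1 (suc q) | ℕ.n∸n≡0 q | ℤ.^-zeroˡ q = ≡.refl

      fermat : ∀ a → a ^ p ≋ a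
      fermat a = ≋-trans (^-cong p (≋-sym (residue-≋ a)))
        (≋-trans (fermat-ℕ (residue a)) (residue-≋ a))

  -- Power sums and Euler's criterion

  legendre-cases : ∀ a p → ¬ p ℕ.∣ ∣ a ∣ →
    (∃ λ (x : Fin p) → p ℕ.∣ ∣ (+ toℕ x) * (+ toℕ x) - a ∣) × legendre a p ≡ 1ℤ ⊎
    ¬ (∃ λ (x : Fin p) → p ℕ.∣ ∣ (+ toℕ x) * (+ toℕ x) - a ∣) × legendre a p ≡ - 1ℤ
  legendre-cases a p p∤a with p ℕ.∣? ∣ a ∣
  ... | yes p∣a = ⊥-elim (p∤a p∣a)
  ... | no _ with Fin.any? {n = p} (λ (x : Fin p) → p ℕ.∣? ∣ (+ toℕ x) * (+ toℕ x) - a ∣)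
  ...   | yes root = inj₁ (root , ≡.refl)
  ...   | no none  = inj₂ (none , ≡.refl)

  module OddPrime (p : ℕ) (pp : Prime p) (m : ℕ) (p≡1+2m : p ≡ suc (m ℕ.+ m)) where

    open Congruence p public
    open PrimeModulus pp public

    0<m : 0 < m
    0<m = lem m p≡1+2m
      where
      lem : ∀ m → p ≡ suc (m ℕ.+ m) → 0 < m
      lem zero    eq = ⊥-elim (ℕ.nonTrivial⇒≢1 {{prime⇒nonTrivial pp}} eq)
      lem (suc m) _  = s≤s z≤n

    2m≋-1 : + (m ℕ.+ m) ≋ - 1ℤ
    2m≋-1 = linear 1ℤ p≋0 (≡.sym (≡.trans (≡.cong (λ q → 1ℤ * (+ q - 0ℤ)) p≡1+2m) (lem (+ (m ℕ.+ m)))))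
      where
      lem : ∀ x → 1ℤ * (1ℤ + x - 0ℤ) ≡ x - - 1ℤ
      lem = solve-∀

    fermat′ : ∀ {a} → ¬ a ≋ 0ℤ → a ^ (m ℕ.+ m) ≋ 1ℤ
    fermat′ {a} a≢0 = *-cancelˡ a a≢0 (begin
      a ^ suc (m ℕ.+ m) ≡⟨ ≡.cong (a ^_) p≡1+2m ⟨
      a ^ p             ≈⟨ fermat a ⟩
      a                 ≡⟨ ℤ.*-identityʳ a ⟨
      a * 1ℤ            ∎)
      where open ≋-Reasoning

    -- The power a^(p-2). It is defined everywhere and sends 0 to 0, so inversion permutes all
    -- residues and can be used in `reindex`.
    inverse : ℤ → ℤ
    inverse a = a ^ (m ℕ.+ m ∸ 1)

    *-inverse : ∀ {a} → ¬ a ≋ 0ℤ → a * inverse a ≋ 1ℤ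
    *-inverse {a} a≢0 = ≋-trans
      (≋-reflexive (≡.cong (a ^_) (ℕ.m+[n∸m]≡n (ℕ.≤-trans 0<m (ℕ.m≤m+n m m))))) (fermat′ a≢0)

    telescope : ∀ n (f : ℕ → ℤ) → Σ n (λ t → f (suc t) - f t) ≋ f n - f 0
    telescope zero    f = ≋-reflexive (≡.sym (ℤ.+-inverseʳ (f 0)))
    telescope (suc n) f = ≋-trans (+-cong (telescope n f) (≋-refl {f (suc n) - f n}))
      (≋-reflexive (lem (f 0) (f n) (f (suc n))))
      where
      lem : ∀ a b c → b - a + (c - b) ≡ c - a
      lem = solve-∀

    Σ-const : ∀ n a → Σ n (λ _ → a) ≋ + n * a
    Σ-const zero    a = ≋-refl
    Σ-const (suc n) a = ≋-trans (+-cong (Σ-const n a) (≋-refl {a}))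
      (≋-reflexive (≡.trans (lem (+ n) a) (≡.cong (_* a) (≡.sym (pos-suc n)))))
      where
      lem : ∀ n a → n * a + a ≡ (n + 1ℤ) * a
      lem = solve-∀

    powerSum : ℕ → ℤ
    powerSum e = Σ p (λ t → (+ t) ^ e)

    -- Summing (t+1)^(e+1) - t^(e+1) over all residues gives 0 and expresses (e+1) S_e through
    -- the lower power sums.
    powerSum-low : ∀ B e → e < B → B ≤ m ℕ.+ m → powerSum e ≋ 0ℤ
    -- `B` bounds a strong induction on `e`; keeping it at most 2m makes e + 1 smaller than p and
    -- hence cancellable.
    powerSum-low (suc B) e (s≤s e≤B) B<2m =
      *-cancelˡ (+ suc e) (small≢0 (suc e) (s≤s z≤n) 1+e<p) (begin
        + suc e * powerSum e
          ≡⟨ ℤ.+-identityˡ (+ suc e * powerSum e) ⟨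
        0ℤ + + suc e * powerSum e
          ≈⟨ +-cong (≋-sym lower) (*-distribˡ-Σ p (+ suc e) (λ t → (+ t) ^ e)) ⟩
        Σ p (λ t → Σ e (c t)) + Σ p (λ t → + suc e * (+ t) ^ e)
          ≈⟨ Σ-distrib-+ p (λ t → Σ e (c t)) (λ t → + suc e * (+ t) ^ e) ⟨
        Σ p (λ t → Σ e (c t) + + suc e * (+ t) ^ e)
          ≈⟨ Σ-ext p difference ⟨
        Σ p (λ t → (+ suc t) ^ suc e - (+ t) ^ suc e)
          ≈⟨ telescope p (λ t → (+ t) ^ suc e) ⟩
        (+ p) ^ suc e - 0ℤ
          ≈⟨ sub-cong (^-cong (suc e) p≋0) (≋-refl {0ℤ}) ⟩
        0ℤ
          ≡⟨ ℤ.*-zeroʳ (+ suc e) ⟨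
        + suc e * 0ℤ ∎)
      where
      open ≋-Reasoning
      1+e<p : suc e < p
      1+e<p = ℕ.≤-trans (s≤s (ℕ.≤-trans (s≤s e≤B) B<2m)) (ℕ.≤-reflexive (≡.sym p≡1+2m))

      c : ℕ → ℕ → ℤ
      c t j = + (suc e C j) * ((+ t) ^ j * 1ℤ ^ (suc e ∸ j))

      lower : Σ p (λ t → Σ e (c t)) ≋ 0ℤ
      lower = begin
        Σ p (λ t → Σ e (c t))          ≈⟨ Σ-comm p e c ⟩
        Σ e (λ j → Σ p (λ t → c t j))  ≈⟨ Σ-zero e column ⟩
        0ℤ                             ∎
        where
        column : ∀ j → j < e → Σ p (λ t → c t j) ≋ 0ℤ
        column j j<e = begin
          Σ p (λ t → c t j)
            ≈⟨ *-distribˡ-Σ p (+ (suc e C j)) _ ⟨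
          + (suc e C j) * Σ p (λ t → (+ t) ^ j * 1ℤ ^ (suc e ∸ j))
            ≈⟨ *-congˡ (+ (suc e C j)) (*-distribʳ-Σ p (1ℤ ^ (suc e ∸ j)) _) ⟨
          + (suc e C j) * (powerSum j * 1ℤ ^ (suc e ∸ j))
            ≈⟨ *-congˡ (+ (suc e C j)) (*-congʳ (1ℤ ^ (suc e ∸ j))
                 (powerSum-low B j (ℕ.<-≤-trans j<e e≤B) (ℕ.<⇒≤ B<2m))) ⟩
          + (suc e C j) * 0ℤ
            ≡⟨ ℤ.*-zeroʳ (+ (suc e C j)) ⟩
          0ℤ ∎

      [1+e]Ce≡1+e : suc e C e ≡ suc e
      [1+e]Ce≡1+e = ≡.trans (nCk≡nC[n∸k] (ℕ.n≤1+n e))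
        (≡.trans (≡.cong (suc e C_) (ℕ.m+n∸n≡m 1 e)) (nC1≡n (suc e)))

      simplify : ∀ s x y k → s + k * (x * 1ℤ) + 1ℤ * (y * 1ℤ) - y ≡ s + k * x
      simplify = solve-∀

      difference : ∀ t → (+ suc t) ^ suc e - (+ t) ^ suc e ≋ Σ e (c t) + + suc e * (+ t) ^ e
      difference t = begin
        (+ suc t) ^ suc e - (+ t) ^ suc e
          ≡⟨ ≡.cong (λ z → z ^ suc e - (+ t) ^ suc e) (pos-suc t) ⟩
        (+ t + 1ℤ) ^ suc e - (+ t) ^ suc e
          ≈⟨ sub-cong (binomial (suc e) (+ t) 1ℤ) (≋-refl {(+ t) ^ suc e}) ⟩
        Σ e (c t) + c t e + c t (suc e) - (+ t) ^ suc e
          ≡⟨ ≡.cong₂ (λ a b → Σ e (c t) + a + b - (+ t) ^ suc e)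
               (≡.cong₂ (λ k o → + k * ((+ t) ^ e * o)) [1+e]Ce≡1+e (ℤ.^-zeroˡ (suc e ∸ e)))
               (≡.cong₂ (λ k o → + k * ((+ t) ^ suc e * o)) (nCn≡1 (suc e)) (ℤ.^-zeroˡ (e ∸ e))) ⟩
        Σ e (c t) + + suc e * ((+ t) ^ e * 1ℤ) + 1ℤ * ((+ t) ^ suc e * 1ℤ) - (+ t) ^ suc e
          ≡⟨ simplify (Σ e (c t)) ((+ t) ^ e) ((+ t) ^ suc e) (+ suc e) ⟩
        Σ e (c t) + + suc e * (+ t) ^ e ∎

    powerSum-top : powerSum (m ℕ.+ m) ≋ - 1ℤ
    powerSum-top = begin
      Σ p f                                ≡⟨ ≡.cong (λ n → Σ n f) p≡1+2m ⟩
      Σ (suc (m ℕ.+ m)) f                  ≈⟨ Σ-head (m ℕ.+ m) f ⟩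
      f 0 + Σ (m ℕ.+ m) (f ∘ suc)          ≈⟨ +-cong (≋-reflexive (zero-power m 0<m)) (Σ-cong (m ℕ.+ m) one) ⟩
      0ℤ + Σ (m ℕ.+ m) (λ _ → 1ℤ)          ≈⟨ +-cong (≋-refl {0ℤ}) (Σ-const (m ℕ.+ m) 1ℤ) ⟩
      0ℤ + + (m ℕ.+ m) * 1ℤ                ≡⟨ lem (+ (m ℕ.+ m)) ⟩
      + (m ℕ.+ m)                          ≈⟨ 2m≋-1 ⟩
      - 1ℤ                                 ∎
      where
      open ≋-Reasoning
      f : ℕ → ℤ
      f t = (+ t) ^ (m ℕ.+ m)
      lem : ∀ x → 0ℤ + x * 1ℤ ≡ x
      lem = solve-∀
      zero-power : ∀ k → 0 < k → 0ℤ ^ (k ℕ.+ k) ≡ 0ℤ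
      zero-power (suc k) _ = ≡.refl
      one : ∀ k → k < m ℕ.+ m → f (suc k) ≋ 1ℤ
      one k k<2m = fermat′ (small≢0 (suc k) (s≤s z≤n)
        (ℕ.≤-trans (s≤s k<2m) (ℕ.≤-reflexive (≡.sym p≡1+2m))))

    -- For e > 2m, t^p ≡ t lowers the exponent by p - 1 = 2m without reaching 0, and e < 4m keeps
    -- the result below 2m.
    powerSum-zero : ∀ e → e < (m ℕ.+ m) ℕ.+ (m ℕ.+ m) → e ≢ m ℕ.+ m → powerSum e ≋ 0ℤ
    powerSum-zero e e<4m e≢2m with ℕ.<-cmp e (m ℕ.+ m)
    ... | tri< e<2m _ _ = powerSum-low (m ℕ.+ m) e e<2m ℕ.≤-refl
    ... | tri≈ _ e≡2m _ = ⊥-elim (e≢2m e≡2m)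
    ... | tri> _ _ e>2m = begin
      powerSum e                       ≡⟨ ≡.cong powerSum (ℕ.m+[n∸m]≡n e>2m) ⟨
      powerSum (suc (m ℕ.+ m) ℕ.+ e′)  ≈⟨ Σ-ext p reduce ⟩
      powerSum (suc e′)                ≈⟨ powerSum-low (m ℕ.+ m) (suc e′) 1+e′<2m ℕ.≤-refl ⟩
      0ℤ                               ∎
      where
      open ≋-Reasoning
      e′ : ℕ
      e′ = e ∸ suc (m ℕ.+ m)
      1+e′<2m : suc e′ < m ℕ.+ m
      1+e′<2m = ℕ.+-cancelˡ-< (m ℕ.+ m) (suc e′) (m ℕ.+ m)
        (≡.subst (_< (m ℕ.+ m) ℕ.+ (m ℕ.+ m))
          (≡.sym (≡.trans (ℕ.+-suc (m ℕ.+ m) e′) (ℕ.m+[n∸m]≡n e>2m))) e<4m)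
      reduce : ∀ t → (+ t) ^ (suc (m ℕ.+ m) ℕ.+ e′) ≋ (+ t) ^ suc e′
      reduce t = begin
        (+ t) ^ (suc (m ℕ.+ m) ℕ.+ e′)      ≡⟨ ℤ.^-distribˡ-+-* (+ t) (suc (m ℕ.+ m)) e′ ⟩
        (+ t) ^ suc (m ℕ.+ m) * (+ t) ^ e′  ≡⟨ ≡.cong (λ n → (+ t) ^ n * (+ t) ^ e′) p≡1+2m ⟨
        (+ t) ^ p * (+ t) ^ e′              ≈⟨ *-congʳ ((+ t) ^ e′) (fermat (+ t)) ⟩
        (+ t) ^ suc e′                      ∎

    -- Coefficients of t^(p-1) in t^e (t^d + c)^N

    module BinomialSum (d : ℕ) (0<d : 0 < d) (c : ℤ) where

      -- While the degree e + dN stays below 2(p - 1), this is minus the coefficient of t^(p-1) in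
      -- t^e (t^d + c)^N.
      W : ℕ → ℕ → ℤ
      W e N = Σ p (λ t → (+ t) ^ e * ((+ t) ^ d + c) ^ N)

      W-step : ∀ e N → W e (suc N) ≋ W (e ℕ.+ d) N + c * W e N
      W-step e N = begin
        W e (suc N)
          ≈⟨ Σ-ext p (λ t → ≋-reflexive (expand t)) ⟩
        Σ p (λ t → (+ t) ^ (e ℕ.+ d) * X t + c * ((+ t) ^ e * X t))
          ≈⟨ Σ-distrib-+ p _ _ ⟩
        W (e ℕ.+ d) N + Σ p (λ t → c * ((+ t) ^ e * X t))
          ≈⟨ +-cong (≋-refl {W (e ℕ.+ d) N}) (*-distribˡ-Σ p c _) ⟨
        W (e ℕ.+ d) N + c * W e N ∎
        where
        open ≋-Reasoning
        X : ℕ → ℤ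
        X t = ((+ t) ^ d + c) ^ N
        lem : ∀ a b c x → a * ((b + c) * x) ≡ a * b * x + c * (a * x)
        lem = solve-∀
        expand : ∀ t → (+ t) ^ e * ((+ t) ^ d + c) ^ suc N ≡ (+ t) ^ (e ℕ.+ d) * X t + c * ((+ t) ^ e * X t)
        expand t = ≡.trans (lem ((+ t) ^ e) ((+ t) ^ d) c (X t))
          (≡.cong (λ z → z * X t + c * ((+ t) ^ e * X t)) (≡.sym (ℤ.^-distribˡ-+-* (+ t) e d)))

      W-base : ∀ e → W e 0 ≋ powerSum e
      W-base e = Σ-ext p (λ t → ≋-reflexive (ℤ.*-identityʳ ((+ t) ^ e)))

      private
        shift : ∀ e N → e ℕ.+ d ℕ.* suc N ≡ e ℕ.+ d ℕ.+ d ℕ.* N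
        shift e N = lem e d N
          where
          lem : ∀ e d N → e ℕ.+ d ℕ.* suc N ≡ e ℕ.+ d ℕ.+ d ℕ.* N
          lem = ℕ-Solver.solve-∀

        bound₁ : ∀ e N {B} → e ℕ.+ d ℕ.* suc N < B → e ℕ.+ d ℕ.+ d ℕ.* N < B
        bound₁ e N {B} h = ≡.subst (_< B) (shift e N) h

        bound₂ : ∀ e N {B} → e ℕ.+ d ℕ.* suc N < B → e ℕ.+ d ℕ.* N < B
        bound₂ e N h = ℕ.≤-<-trans (ℕ.+-monoʳ-≤ e (ℕ.*-monoʳ-≤ d (ℕ.n≤1+n N))) h

        neg0 : ∀ c → 0ℤ + c * 0ℤ ≡ 0ℤ
        neg0 = solve-∀

      W-vanish : ∀ N e → e ℕ.+ d ℕ.* N < (m ℕ.+ m) ℕ.+ (m ℕ.+ m) →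
                 (∀ j → e ℕ.+ d ℕ.* j ≢ m ℕ.+ m) → W e N ≋ 0ℤ
      W-vanish zero e deg none = ≋-trans (W-base e) (powerSum-zero e
        (ℕ.≤-<-trans (ℕ.m≤m+n e (d ℕ.* 0)) deg)
        (λ e≡2m → none 0 (≡.trans (≡.cong (e ℕ.+_) (ℕ.*-zeroʳ d)) (≡.trans (ℕ.+-identityʳ e) e≡2m))))
      W-vanish (suc N) e deg none = ≋-trans (W-step e N) (≋-trans
        (+-cong (W-vanish N (e ℕ.+ d) (bound₁ e N deg) (λ j eq → none (suc j) (≡.trans (shift e j) eq)))
                (*-congˡ c (W-vanish N e (bound₂ e N deg) none)))
        (≋-reflexive (neg0 c)))

      W-coefficient : ∀ N e j → e ℕ.+ d ℕ.* N < (m ℕ.+ m) ℕ.+ (m ℕ.+ m) →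
                      e ℕ.+ d ℕ.* j ≡ m ℕ.+ m → W e N ≋ - (+ (N C j) * c ^ (N ∸ j))
      W-coefficient zero e zero deg eq = ≋-trans (W-base e)
        (≋-trans (≋-reflexive (≡.cong powerSum e≡2m)) powerSum-top)
        where
        e≡2m : e ≡ m ℕ.+ m
        e≡2m = ≡.trans (≡.sym (≡.trans (≡.cong (e ℕ.+_) (ℕ.*-zeroʳ d)) (ℕ.+-identityʳ e))) eq
      W-coefficient zero e (suc j) deg eq = ≋-trans (W-base e)
        (≋-trans (powerSum-zero e (ℕ.≤-<-trans (ℕ.m≤m+n e (d ℕ.* 0)) deg) e≢2m)
          (≋-reflexive (≡.sym (≡.cong (λ k → - (+ k * 1ℤ)) (k>n⇒nCk≡0 {0} {suc j} (s≤s z≤n))))))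
        where
        e≢2m : e ≢ m ℕ.+ m
        e≢2m e≡2m = ℕ.<⇒≢ (ℕ.<-≤-trans (ℕ.m<m+n e 0<d) (ℕ.≤-trans (ℕ.m≤m+n (e ℕ.+ d) (d ℕ.* j))
          (ℕ.≤-reflexive (≡.trans (≡.sym (shift e j)) eq)))) e≡2m
      W-coefficient (suc N) e zero deg eq = begin
        W e (suc N)                          ≈⟨ W-step e N ⟩
        W (e ℕ.+ d) N + c * W e N            ≈⟨ +-cong (W-vanish N (e ℕ.+ d) (bound₁ e N deg) beyond)
                                                       (*-congˡ c (W-coefficient N e 0 (bound₂ e N deg) eq)) ⟩
        0ℤ + c * - (+ (N C 0) * c ^ N)       ≡⟨ lem c (c ^ N) ⟩
        - (+ (suc N C 0) * c ^ suc N)        ∎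
        where
        open ≋-Reasoning
        lem : ∀ c x → 0ℤ + c * - (1ℤ * x) ≡ - (1ℤ * (c * x))
        lem = solve-∀
        beyond : ∀ j → e ℕ.+ d ℕ.+ d ℕ.* j ≢ m ℕ.+ m
        beyond j eq′ = ℕ.<⇒≢ (ℕ.<-≤-trans (ℕ.+-monoʳ-< e
            (≡.subst (_< d) (≡.sym (ℕ.*-zeroʳ d)) 0<d)) (ℕ.m≤m+n (e ℕ.+ d) (d ℕ.* j)))
          (≡.trans eq (≡.sym eq′))
      W-coefficient (suc N) e (suc j) deg eq = begin
        W e (suc N)
          ≈⟨ W-step e N ⟩
        W (e ℕ.+ d) N + c * W e N
          ≈⟨ +-cong (W-coefficient N (e ℕ.+ d) j (bound₁ e N deg) (≡.trans (≡.sym (shift e j)) eq))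
                    (*-congˡ c (W-coefficient N e (suc j) (bound₂ e N deg) eq)) ⟩
        - (+ (N C j) * c ^ (N ∸ j)) + c * - (+ (N C suc j) * c ^ (N ∸ suc j))
          ≡⟨ combine ⟩
        - (+ (suc N C suc j) * c ^ (N ∸ j)) ∎
        where
        open ≋-Reasoning
        lem₁ : ∀ a b c x → - (a * (c * x)) + c * - (b * x) ≡ - ((a + b) * (c * x))
        lem₁ = solve-∀
        lem₂ : ∀ a c x y → - (a * y) + c * - (0ℤ * x) ≡ - ((a + 0ℤ) * y)
        lem₂ = solve-∀
        pascal : (x : ℤ) → - ((+ (N C j) + + (N C suc j)) * x) ≡ - (+ (suc N C suc j) * x)
        pascal x = ≡.cong (λ k → - (+ k * x)) (nCk+nC[k+1]≡[n+1]C[k+1] N j)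
        combine : - (+ (N C j) * c ^ (N ∸ j)) + c * - (+ (N C suc j) * c ^ (N ∸ suc j))
                  ≡ - (+ (suc N C suc j) * c ^ (N ∸ j))
        -- The exponents N ∸ j and N ∸ (j + 1) differ by one only when j < N; otherwise C(N, j + 1)
        -- = 0 removes the second term.
        combine with ℕ.<-≤-connex j N
        ... | inj₁ j<N = ≡.trans
          (≡.cong (λ k → - (+ (N C j) * c ^ k) + c * - (+ (N C suc j) * c ^ (N ∸ suc j))) (≡.sym 1+[N∸1+j]≡N∸j))
          (≡.trans (lem₁ (+ (N C j)) (+ (N C suc j)) c (c ^ (N ∸ suc j)))
            (≡.trans (pascal (c ^ suc (N ∸ suc j))) (≡.cong (λ k → - (+ (suc N C suc j) * c ^ k)) 1+[N∸1+j]≡N∸j)))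
          where
          1+[N∸1+j]≡N∸j : suc (N ∸ suc j) ≡ N ∸ j
          1+[N∸1+j]≡N∸j = ≡.sym (ℕ.+-∸-assoc 1 j<N)
        ... | inj₂ N≤j = ≡.trans
          (≡.cong (λ k → - (+ (N C j) * c ^ (N ∸ j)) + c * - (+ k * c ^ (N ∸ suc j))) zero-C)
          (≡.trans (lem₂ (+ (N C j)) c (c ^ (N ∸ suc j)) (c ^ (N ∸ j)))
            (≡.trans (≡.cong (λ k → - ((+ (N C j) + + k) * c ^ (N ∸ j))) (≡.sym zero-C)) (pascal (c ^ (N ∸ j)))))
          where
          zero-C : N C suc j ≡ 0
          zero-C = k>n⇒nCk≡0 (s≤s N≤j)

    -- If a is not a square but a^m = 1, then Q = (t^2m - a^m) / (t^2 - a) vanishes at all t ≠ 0, so its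
    -- sum over all residues is a^(m-1); but that sum is 0 because deg Q < p - 1.
    module _ (a : ℤ) where

      private
        Q : ℕ → ℤ → ℤ
        Q zero    t = 0ℤ
        Q (suc k) t = a ^ k + (t * t) * Q k t

        Q-quotient : ∀ k t → (t * t - a) * Q k t ≡ (t * t) ^ k - a ^ k
        Q-quotient zero    t = ℤ.*-zeroʳ (t * t - a)
        Q-quotient (suc k) t = ≡.trans (lem₁ (t * t) a (a ^ k) (Q k t))
          (≡.trans (≡.cong (λ z → (t * t - a) * a ^ k + (t * t) * z) (Q-quotient k t))
            (lem₂ (t * t) a (a ^ k) ((t * t) ^ k)))
          where
          lem₁ : ∀ s a b q → (s - a) * (b + s * q) ≡ (s - a) * b + s * ((s - a) * q)
          lem₁ = solve-∀
          lem₂ : ∀ s a b x → (s - a) * b + s * (x - b) ≡ s * x - a * b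
          lem₂ = solve-∀

        Q-at-0 : ∀ k → 0 < k → a * Q k 0ℤ ≡ a ^ k
        Q-at-0 (suc k) _ = ≡.cong (a *_) (ℤ.+-identityʳ (a ^ k))

        -- The degree of t^e Q k is e + 2k - 2, so the bound keeps it below p - 1, where all power
        -- sums vanish. The factor t^e absorbs the t² produced by each unfolding of `Q`.
        ΣQ : ∀ k e → e ℕ.+ (k ℕ.+ k) < suc (suc (m ℕ.+ m)) → Σ p (λ t → (+ t) ^ e * Q k (+ t)) ≋ 0ℤ
        ΣQ zero    e _   = Σ-zero p (λ t _ → ≋-reflexive (ℤ.*-zeroʳ ((+ t) ^ e)))
        ΣQ (suc k) e deg = begin
          Σ p (λ t → (+ t) ^ e * Q (suc k) (+ t))
            ≈⟨ Σ-ext p (λ t → ≋-reflexive (lem ((+ t) ^ e) (a ^ k) (+ t) (Q k (+ t)))) ⟩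
          Σ p (λ t → a ^ k * (+ t) ^ e + (+ t) ^ suc (suc e) * Q k (+ t))
            ≈⟨ Σ-distrib-+ p _ _ ⟩
          Σ p (λ t → a ^ k * (+ t) ^ e) + Σ p (λ t → (+ t) ^ suc (suc e) * Q k (+ t))
            ≈⟨ +-cong (≋-sym (*-distribˡ-Σ p (a ^ k) _)) (ΣQ k (suc (suc e)) (≡.subst (_< suc (suc (m ℕ.+ m))) (regroup e k) deg)) ⟩
          a ^ k * powerSum e + 0ℤ
            ≈⟨ +-cong (*-congˡ (a ^ k) (powerSum-low (m ℕ.+ m) e e<2m ℕ.≤-refl)) (≋-refl {0ℤ}) ⟩
          a ^ k * 0ℤ + 0ℤ
            ≡⟨ ≡.cong (_+ 0ℤ) (ℤ.*-zeroʳ (a ^ k)) ⟩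
          0ℤ ∎
          where
          open ≋-Reasoning
          lem : ∀ x b t q → x * (b + t * t * q) ≡ b * x + t * (t * x) * q
          lem = solve-∀
          regroup : ∀ e k → e ℕ.+ (suc k ℕ.+ suc k) ≡ suc (suc e) ℕ.+ (k ℕ.+ k)
          regroup = ℕ-Solver.solve-∀
          e<2m : e < m ℕ.+ m
          e<2m = ℕ.≤-pred (ℕ.≤-pred (ℕ.≤-trans (s≤s (ℕ.≤-trans
            (ℕ.m≤m+n (suc (suc e)) (k ℕ.+ k)) (ℕ.≤-reflexive (≡.sym (regroup e k))))) deg))

        square^m : ∀ t → (t * t) ^ m ≡ t ^ (m ℕ.+ m)
        square^m t = ≡.trans (^-distribʳ-* t t m) (≡.sym (ℤ.^-distribˡ-+-* t m m))

      square⇒^m≋1 : ¬ a ≋ 0ℤ → ∀ t → t * t ≋ a → a ^ m ≋ 1ℤ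
      square⇒^m≋1 a≢0 t eq = ≋-trans (^-cong m (≋-sym eq))
        (≋-trans (≋-reflexive (square^m t)) (fermat′ t≢0))
        where
        t≢0 : ¬ t ≋ 0ℤ
        t≢0 t≋0 = a≢0 (≋-trans (≋-sym eq) (*-cong t≋0 t≋0))

      ^m≋±1 : ¬ a ≋ 0ℤ → a ^ m ≋ 1ℤ ⊎ a ^ m ≋ - 1ℤ
      ^m≋±1 a≢0 = Sum.map -≋0⇒≋ -≋0⇒≋ (integral (a ^ m - 1ℤ) (a ^ m + 1ℤ)
        (linear 1ℤ (≋-trans (≋-reflexive (≡.sym (ℤ.^-distribˡ-+-* a m m))) (fermat′ a≢0)) (lem (a ^ m))))
        where
        lem : ∀ x → (x - 1ℤ) * (x + 1ℤ) - 0ℤ ≡ 1ℤ * (x * x - 1ℤ)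
        lem = solve-∀

      nonsquare⇒^m≢1 : ¬ a ≋ 0ℤ → (∀ t → ¬ t * t ≋ a) → ¬ a ^ m ≋ 1ℤ
      nonsquare⇒^m≢1 a≢0 nonsquare a^m≋1 = 1≢0 (begin
        1ℤ          ≈⟨ a^m≋1 ⟨
        a ^ m       ≡⟨ Q-at-0 m 0<m ⟨
        a * Q m 0ℤ  ≈⟨ *-congˡ a value ⟩
        a * 0ℤ      ≡⟨ ℤ.*-zeroʳ a ⟩
        0ℤ          ∎)
        where
        open ≋-Reasoning
        Q≋0 : ∀ t → ¬ t ≋ 0ℤ → Q m t ≋ 0ℤ
        Q≋0 t t≢0 = Sum.fromInj₂ (λ h → ⊥-elim (nonsquare t (-≋0⇒≋ h))) (integral (t * t - a) (Q m t)
          (≋-trans (≋-reflexive (≡.trans (Q-quotient m t) (≡.cong (λ z → z - a ^ m) (square^m t))))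
            (sub-cong (fermat′ t≢0) a^m≋1)))

        -- Every residue t ≠ 0 contributes 0, so the vanishing sum over all residues equals its term
        -- at 0.
        value : Q m 0ℤ ≋ 0ℤ
        value = begin
          Q m 0ℤ
            ≡⟨ lem (Q m 0ℤ) ⟨
          1ℤ * Q m 0ℤ + 0ℤ
            ≈⟨ +-cong (≋-refl {1ℤ * Q m 0ℤ}) (Σ-zero (m ℕ.+ m) (λ t t<2m →
                 ≋-trans (≋-reflexive (ℤ.*-identityˡ (Q m (+ suc t))))
                   (Q≋0 (+ suc t) (small≢0 (suc t) (s≤s z≤n)
                     (ℕ.≤-trans (s≤s t<2m) (ℕ.≤-reflexive (≡.sym p≡1+2m))))))) ⟨
          1ℤ * Q m 0ℤ + Σ (m ℕ.+ m) (λ t → 1ℤ * Q m (+ suc t))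
            ≈⟨ Σ-head (m ℕ.+ m) (λ t → 1ℤ * Q m (+ t)) ⟨
          Σ (suc (m ℕ.+ m)) (λ t → 1ℤ * Q m (+ t))
            ≡⟨ ≡.cong (λ n → Σ n (λ t → 1ℤ * Q m (+ t))) p≡1+2m ⟨
          Σ p (λ t → (+ t) ^ 0 * Q m (+ t))
            ≈⟨ ΣQ m 0 (ℕ.m<n⇒m<1+n (ℕ.n<1+n (m ℕ.+ m))) ⟩
          0ℤ ∎
          where
          lem : ∀ x → 1ℤ * x + 0ℤ ≡ x
          lem = solve-∀

      euler : ¬ a ≋ 0ℤ → legendre a p ≋ a ^ m
      euler a≢0 = Sum.[_,_] residue-case nonresidue-case (legendre-cases a p (a≢0 ∘ ∣⇒≋0))
        where
        Root : Fin p → Set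
        Root x = p ℕ.∣ ∣ (+ toℕ x) * (+ toℕ x) - a ∣

        residue-case : ∃ Root × legendre a p ≡ 1ℤ → legendre a p ≋ a ^ m
        residue-case ((x , p∣x²-a) , eq) = ≋-trans (≋-reflexive eq)
          (≋-sym (square⇒^m≋1 a≢0 (+ toℕ x) (∣⇒≋ p∣x²-a)))

        nonresidue-case : ¬ ∃ Root × legendre a p ≡ - 1ℤ → legendre a p ≋ a ^ m
        nonresidue-case (none , eq) = ≋-trans (≋-reflexive eq)
          (≋-sym (Sum.fromInj₂ (λ h → ⊥-elim (nonsquare⇒^m≢1 a≢0 nonsquare h)) (^m≋±1 a≢0)))
          where
          nonsquare : ∀ t → ¬ t * t ≋ a
          nonsquare t eq = none (fromℕ< (residue< t) ,
            ≡.subst (λ r → p ℕ.∣ ∣ (+ r) * (+ r) - a ∣) (≡.sym (Fin.toℕ-fromℕ< (residue< t)))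
              (≋⇒∣ (≋-trans (*-cong (residue-≋ t) (residue-≋ t)) eq)))

  -- Recurrences for binomial coefficients

  A : ℕ → ℕ
  A k = ((4 ℕ.* k) C (2 ℕ.* k)) ℕ.* ((2 ℕ.* k) C k)

  B : ℕ → ℕ
  B k = (k ℕ.+ k) C k

  B-step : ∀ k → suc k ℕ.* B (suc k) ≡ 2 ℕ.* suc (k ℕ.+ k) ℕ.* B k
  B-step k = ≡.trans (≡.cong (λ n → suc k ℕ.* (n C suc k)) (lem k)) (central-step k)
    where
    lem : ∀ k → suc k ℕ.+ suc k ≡ suc (suc (k ℕ.+ k))
    lem = ℕ-Solver.solve-∀

  A≡B*B : ∀ k → A k ≡ B (k ℕ.+ k) ℕ.* B k
  A≡B*B k = ≡.cong₂ ℕ._*_ (≡.cong₂ _C_ (lem₄ k) (2k≡k+k k)) (≡.cong (_C k) (2k≡k+k k))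
    where
    lem₄ : ∀ k → 4 ℕ.* k ≡ (k ℕ.+ k) ℕ.+ (k ℕ.+ k)
    lem₄ = ℕ-Solver.solve-∀

  A-step : ∀ k → suc k ℕ.* suc k ℕ.* A (suc k) ≡
                 4 ℕ.* (suc (4 ℕ.* k) ℕ.* (3 ℕ.+ 4 ℕ.* k)) ℕ.* A k
  -- `B-step` is used at 2k + 1, 2k and k; the extra factor 2(2k + 1) makes its three left sides
  -- appear.
  A-step k = ℕ.*-cancelˡ-≡ _ _ (2 ℕ.* suc (k ℕ.+ k)) (begin
    2 ℕ.* suc 2k ℕ.* (suc k ℕ.* suc k ℕ.* A (suc k))
      ≡⟨ ≡.cong (λ z → 2 ℕ.* suc 2k ℕ.* (suc k ℕ.* suc k ℕ.* z))
           (≡.trans (A≡B*B (suc k)) (≡.cong (λ n → B n ℕ.* B (suc k)) (2+2k k))) ⟩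
    2 ℕ.* suc 2k ℕ.* (suc k ℕ.* suc k ℕ.* (B (suc (suc 2k)) ℕ.* B (suc k)))
      ≡⟨ regroup k (B (suc (suc 2k))) (B (suc k)) ⟩
    suc 2k ℕ.* (suc (suc 2k) ℕ.* B (suc (suc 2k))) ℕ.* (suc k ℕ.* B (suc k))
      ≡⟨ ≡.cong₂ (λ x y → suc 2k ℕ.* x ℕ.* y) (B-step (suc 2k)) (B-step k) ⟩
    suc 2k ℕ.* (2 ℕ.* suc (suc 2k ℕ.+ suc 2k) ℕ.* B (suc 2k)) ℕ.* (2 ℕ.* suc 2k ℕ.* B k)
      ≡⟨ regroup′ k (B (suc 2k)) (B k) ⟩
    2 ℕ.* (3 ℕ.+ 4 ℕ.* k) ℕ.* (suc 2k ℕ.* B (suc 2k)) ℕ.* (2 ℕ.* suc 2k ℕ.* B k)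
      ≡⟨ ≡.cong (λ x → 2 ℕ.* (3 ℕ.+ 4 ℕ.* k) ℕ.* x ℕ.* (2 ℕ.* suc 2k ℕ.* B k)) (B-step 2k) ⟩
    2 ℕ.* (3 ℕ.+ 4 ℕ.* k) ℕ.* (2 ℕ.* suc (2k ℕ.+ 2k) ℕ.* B 2k) ℕ.* (2 ℕ.* suc 2k ℕ.* B k)
      ≡⟨ regroup″ k (B 2k) (B k) ⟩
    2 ℕ.* suc 2k ℕ.* (4 ℕ.* (suc (4 ℕ.* k) ℕ.* (3 ℕ.+ 4 ℕ.* k)) ℕ.* (B 2k ℕ.* B k))
      ≡⟨ ≡.cong (λ z → 2 ℕ.* suc 2k ℕ.* (4 ℕ.* (suc (4 ℕ.* k) ℕ.* (3 ℕ.+ 4 ℕ.* k)) ℕ.* z)) (A≡B*B k) ⟨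
    2 ℕ.* suc 2k ℕ.* (4 ℕ.* (suc (4 ℕ.* k) ℕ.* (3 ℕ.+ 4 ℕ.* k)) ℕ.* A k) ∎)
    where
    open ≡.≡-Reasoning
    2k : ℕ
    2k = k ℕ.+ k
    2+2k : ∀ k → suc k ℕ.+ suc k ≡ suc (suc (k ℕ.+ k))
    2+2k = ℕ-Solver.solve-∀
    regroup : ∀ k x y → 2 ℕ.* suc (k ℕ.+ k) ℕ.* (suc k ℕ.* suc k ℕ.* (x ℕ.* y)) ≡
                        suc (k ℕ.+ k) ℕ.* (suc (suc (k ℕ.+ k)) ℕ.* x) ℕ.* (suc k ℕ.* y)
    regroup = ℕ-Solver.solve-∀
    regroup′ : ∀ k x y →
      suc (k ℕ.+ k) ℕ.* (2 ℕ.* suc (suc (k ℕ.+ k) ℕ.+ suc (k ℕ.+ k)) ℕ.* x) ℕ.* (2 ℕ.* suc (k ℕ.+ k) ℕ.* y) ≡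
      2 ℕ.* (3 ℕ.+ 4 ℕ.* k) ℕ.* (suc (k ℕ.+ k) ℕ.* x) ℕ.* (2 ℕ.* suc (k ℕ.+ k) ℕ.* y)
    regroup′ = ℕ-Solver.solve-∀
    regroup″ : ∀ k x y →
      2 ℕ.* (3 ℕ.+ 4 ℕ.* k) ℕ.* (2 ℕ.* suc ((k ℕ.+ k) ℕ.+ (k ℕ.+ k)) ℕ.* x) ℕ.* (2 ℕ.* suc (k ℕ.+ k) ℕ.* y) ≡
      2 ℕ.* suc (k ℕ.+ k) ℕ.* (4 ℕ.* (suc (4 ℕ.* k) ℕ.* (3 ℕ.+ 4 ℕ.* k)) ℕ.* (x ℕ.* y))
    regroup″ = ℕ-Solver.solve-∀

  A-stepℤ : ∀ k → + suc k * + suc k * + A (suc k) ≡ + 4 * ((1ℤ + + 4 * + k) * (+ 3 + + 4 * + k)) * + A k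
  A-stepℤ k = begin
    + suc k * + suc k * + A (suc k)
      ≡⟨ ≡.cong (_* + A (suc k)) (ℤ.pos-* (suc k) (suc k)) ⟨
    + (suc k ℕ.* suc k) * + A (suc k)
      ≡⟨ ℤ.pos-* (suc k ℕ.* suc k) (A (suc k)) ⟨
    + (suc k ℕ.* suc k ℕ.* A (suc k))
      ≡⟨ ≡.cong +_ (A-step k) ⟩
    + (4 ℕ.* (suc (4 ℕ.* k) ℕ.* (3 ℕ.+ 4 ℕ.* k)) ℕ.* A k)
      ≡⟨ ℤ.pos-* (4 ℕ.* (suc (4 ℕ.* k) ℕ.* (3 ℕ.+ 4 ℕ.* k))) (A k) ⟩
    + (4 ℕ.* (suc (4 ℕ.* k) ℕ.* (3 ℕ.+ 4 ℕ.* k))) * + A k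
      ≡⟨ ≡.cong (_* + A k) (ℤ.pos-* 4 (suc (4 ℕ.* k) ℕ.* (3 ℕ.+ 4 ℕ.* k))) ⟩
    + 4 * + (suc (4 ℕ.* k) ℕ.* (3 ℕ.+ 4 ℕ.* k)) * + A k
      ≡⟨ ≡.cong (λ z → + 4 * z * + A k) (ℤ.pos-* (suc (4 ℕ.* k)) (3 ℕ.+ 4 ℕ.* k)) ⟩
    + 4 * ((1ℤ + + (4 ℕ.* k)) * (+ 3 + + (4 ℕ.* k))) * + A k
      ≡⟨ ≡.cong (λ z → + 4 * ((1ℤ + z) * (+ 3 + z)) * + A k) (ℤ.pos-* 4 k) ⟩
    + 4 * ((1ℤ + + 4 * + k) * (+ 3 + + 4 * + k)) * + A k ∎
    where open ≡.≡-Reasoning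

  C-lower-step : ∀ n k → + suc k * + (n C suc k) ≡ (+ n - + k) * + (n C k)
  C-lower-step n k = begin
    + suc k * + (n C suc k)
      ≡⟨ lem (+ suc k * + (n C suc k)) (+ k * + (n C k)) ⟩
    + suc k * + (n C suc k) + + k * + (n C k) - + k * + (n C k)
      ≡⟨ ≡.cong (_- + k * + (n C k)) lift ⟩
    + n * + (n C k) - + k * + (n C k)
      ≡⟨ lem′ (+ n) (+ k) (+ (n C k)) ⟩
    (+ n - + k) * + (n C k) ∎
    where
    open ≡.≡-Reasoning
    lem : ∀ x y → x ≡ x + y - y
    lem = solve-∀
    lem′ : ∀ n k c → n * c - k * c ≡ (n - k) * c
    lem′ = solve-∀
    lift : + suc k * + (n C suc k) + + k * + (n C k) ≡ + n * + (n C k)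
    lift = ≡.trans (≡.cong₂ _+_ (≡.sym (ℤ.pos-* (suc k) (n C suc k))) (≡.sym (ℤ.pos-* k (n C k))))
      (≡.trans (≡.cong +_ ([1+k]*nC[1+k]+k*nCk≡n*nCk n k)) (ℤ.pos-* n (n C k)))

  C-upper-step : ∀ n k → (+ suc n - + k) * + (suc n C k) ≡ + suc n * + (n C k)
  C-upper-step n k = ≡.trans (≡.sym (C-lower-step (suc n) k))
    (≡.trans (≡.sym (ℤ.pos-* (suc k) (suc n C suc k)))
      (≡.trans (≡.cong +_ ([1+k]*[1+n]C[1+k]≡[1+n]*nCk n k)) (ℤ.pos-* (suc n) (n C k))))

  -- The multinomial coefficient m! / (k! k! (m - 2k)!), zero for 2k > m.
  trinomial : ℕ → ℕ → ℤ
  trinomial m k = + (m C k) * + ((m ∸ k) C k)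

  trinomial-step : ∀ m → 0 < m → ∀ k →
    + suc k * + suc k * trinomial m (suc k) ≡
    (+ m - + k - + k) * (+ m - + k - + k - 1ℤ) * trinomial m k
  trinomial-step m 0<m k with ℕ.<-≤-connex k m
  -- Both sides vanish: C(m, k + 1) = 0 on the left, and on the right m ∸ k = 0 while k ≥ m > 0.
  ... | inj₂ m≤k = ≡.trans
    (≡.cong (λ z → + suc k * + suc k * (+ z * + ((m ∸ suc k) C suc k))) (k>n⇒nCk≡0 (s≤s m≤k)))
    (≡.trans (lem (+ suc k) (+ ((m ∸ suc k) C suc k)) ((+ m - + k - + k) * (+ m - + k - + k - 1ℤ)) (+ (m C k)))
      (≡.cong (λ z → (+ m - + k - + k) * (+ m - + k - + k - 1ℤ) * (+ (m C k) * + z)) (≡.sym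
        (k>n⇒nCk≡0 (≡.subst (_< k) (≡.sym (ℕ.m≤n⇒m∸n≡0 m≤k)) (ℕ.<-≤-trans 0<m m≤k))))))
    where
    lem : ∀ k x y c → k * k * (0ℤ * x) ≡ y * (c * 0ℤ)
    lem = solve-∀
  ... | inj₁ k<m = begin
    + suc k * + suc k * (+ (m C suc k) * + (n C suc k))
      ≡⟨ regroup (+ suc k) (+ (m C suc k)) (+ (n C suc k)) ⟩
    (+ suc k * + (m C suc k)) * (+ suc k * + (n C suc k))
      ≡⟨ ≡.cong₂ _*_ (C-lower-step m k) (C-lower-step n k) ⟩
    ((+ m - + k) * + (m C k)) * ((+ n - + k) * + (n C k))
      ≡⟨ ≡.cong (λ z → (z - + k) * + (m C k) * ((+ n - + k) * + (n C k))) m≡1+n+k ⟩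
    (1ℤ + + n + + k - + k) * + (m C k) * ((+ n - + k) * + (n C k))
      ≡⟨ regroup′ (+ n) (+ k) (+ (m C k)) (+ (n C k)) ⟩
    + (m C k) * (+ n - + k) * (+ suc n * + (n C k))
      ≡⟨ ≡.cong (λ z → + (m C k) * (+ n - + k) * z) (C-upper-step n k) ⟨
    + (m C k) * (+ n - + k) * ((+ suc n - + k) * + (suc n C k))
      ≡⟨ regroup″ (+ n) (+ k) (+ (m C k)) (+ (suc n C k)) ⟩
    (1ℤ + + n + + k - + k - + k) * (1ℤ + + n + + k - + k - + k - 1ℤ) * (+ (m C k) * + (suc n C k))
      ≡⟨ ≡.cong₂ (λ z i → (z - + k - + k) * (z - + k - + k - 1ℤ) * (+ (m C k) * + (i C k))) m≡1+n+k (ℕ.+-∸-assoc 1 k<m) ⟨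
    (+ m - + k - + k) * (+ m - + k - + k - 1ℤ) * (+ (m C k) * + ((m ∸ k) C k)) ∎
    where
    open ≡.≡-Reasoning
    n : ℕ
    n = m ∸ suc k
    m≡1+n+k : + m ≡ 1ℤ + + n + + k
    m≡1+n+k = ≡.cong +_ (≡.trans (≡.sym (ℕ.m∸n+n≡m k<m)) (ℕ.+-suc n k))
    regroup : ∀ k x y → k * k * (x * y) ≡ (k * x) * (k * y)
    regroup = solve-∀
    regroup′ : ∀ n k x y → (1ℤ + n + k - k) * x * ((n - k) * y) ≡ x * (n - k) * ((1ℤ + n) * y)
    regroup′ = solve-∀
    regroup″ : ∀ n k x y → x * (n - k) * ((1ℤ + n - k) * y) ≡
                           (1ℤ + n + k - k - k) * (1ℤ + n + k - k - k - 1ℤ) * (x * y)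
    regroup″ = solve-∀

  -- The series as a sum over residues

  module Series (p : ℕ) (pp : Prime p) (m : ℕ) (p≡1+2m : p ≡ suc (m ℕ.+ m)) where

    open OddPrime p pp m p≡1+2m public

    2m+1≋0 : + m + + m + 1ℤ ≋ 0ℤ
    2m+1≋0 = linear 1ℤ 2m≋-1 (lem (+ m))
      where
      lem : ∀ x → x + x + 1ℤ - 0ℤ ≡ 1ℤ * (x + x - - 1ℤ)
      lem = solve-∀

    -- Both sides have the same ratio of consecutive terms: m ≡ -1/2 gives m - 2k ≡ -(4k + 1)/2 and
    -- m - 2k - 1 ≡ -(4k + 3)/2. Dividing by (k + 1)² is allowed as long as k + 1 < p.
    A≋16^k*trinomial : ∀ k → k < p → + A k ≋ (+ 16) ^ k * trinomial m k
    A≋16^k*trinomial zero    _     = ≋-refl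
    A≋16^k*trinomial (suc k) 1+k<p = *-cancelˡ (+ suc k * + suc k) (*-nonzero 1+k≢0 1+k≢0) (begin
      K * K * + A (suc k)
        ≡⟨ A-stepℤ k ⟩
      + 4 * ((1ℤ + + 4 * + k) * (+ 3 + + 4 * + k)) * + A k
        ≈⟨ *-congˡ (+ 4 * ((1ℤ + + 4 * + k) * (+ 3 + + 4 * + k))) (A≋16^k*trinomial k (ℕ.<-trans (ℕ.n<1+n k) 1+k<p)) ⟩
      + 4 * ((1ℤ + + 4 * + k) * (+ 3 + + 4 * + k)) * ((+ 16) ^ k * trinomial m k)
        ≈⟨ linear (- ((+ 16) ^ k * trinomial m k) * q (+ m) (+ k)) 2m+1≋0
             (difference (+ m) (+ k) ((+ 16) ^ k) (trinomial m k)) ⟩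
      + 16 * (+ 16) ^ k * ((+ m - + k - + k) * (+ m - + k - + k - 1ℤ) * trinomial m k)
        ≡⟨ ≡.cong (+ 16 * (+ 16) ^ k *_) (trinomial-step m 0<m k) ⟨
      + 16 * (+ 16) ^ k * (K * K * trinomial m (suc k))
        ≡⟨ regroup K (+ 16 * (+ 16) ^ k) (trinomial m (suc k)) ⟩
      K * K * ((+ 16) ^ suc k * trinomial m (suc k)) ∎)
      where
      open ≋-Reasoning
      K : ℤ
      K = + suc k
      1+k≢0 : ¬ K ≋ 0ℤ
      1+k≢0 = small≢0 (suc k) (s≤s z≤n) 1+k<p
      regroup : ∀ K x y → x * (K * K * y) ≡ K * K * (x * y)
      regroup = solve-∀
      -- the quotient of 16 (m - 2k) (m - 2k - 1) - 4 (4k + 1) (4k + 3) by 2m + 1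
      q : ℤ → ℤ → ℤ
      q m k = + 8 * m - + 32 * k - + 12
      difference : ∀ m k x y →
        + 4 * ((1ℤ + + 4 * k) * (+ 3 + + 4 * k)) * (x * y) - + 16 * x * ((m - k - k) * (m - k - k - 1ℤ) * y) ≡
        (- (x * y) * (+ 8 * m - + 32 * k - + 12)) * (m + m + 1ℤ - 0ℤ)
      difference = solve-∀

    -- The factor k of the series lowers C(m, k) to m C(m - 1, k - 1) / k; this is how the exponent
    -- M = m - 1 arises.
    trinomial-absorb : ∀ M → m ≡ suc M → ∀ j →
      + suc j * trinomial m (suc j) ≡ + m * (+ (M C j) * + ((M ∸ j) C suc j))
    trinomial-absorb M ≡.refl j = begin
      + suc j * (+ (m C suc j) * + ((M ∸ j) C suc j))    ≡⟨ ℤ.*-assoc (+ suc j) (+ (m C suc j)) _ ⟨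
      + suc j * + (m C suc j) * + ((M ∸ j) C suc j)      ≡⟨ ≡.cong (_* + ((M ∸ j) C suc j)) absorb ⟩
      + m * + (M C j) * + ((M ∸ j) C suc j)              ≡⟨ ℤ.*-assoc (+ m) (+ (M C j)) _ ⟩
      + m * (+ (M C j) * + ((M ∸ j) C suc j))            ∎
      where
      open ≡.≡-Reasoning
      absorb : + suc j * + (suc M C suc j) ≡ + suc M * + (M C j)
      absorb = ≡.trans (≡.sym (ℤ.pos-* (suc j) (suc M C suc j)))
        (≡.trans (≡.cong +_ ([1+k]*[1+n]C[1+k]≡[1+n]*nCk M j)) (ℤ.pos-* (suc M) (M C j)))

    module W₁ = BinomialSum 1 (s≤s z≤n) 1ℤ
    module W₂ = BinomialSum 2 (s≤s z≤n) (- 1ℤ)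

    module _ (M : ℕ) (m≡1+M : m ≡ suc M) (v : ℤ) where

      private
        c : ℕ → ℤ
        c j = + (M C j) * + ((M ∸ j) C suc j) * v ^ j

      trinomialSum : Σ p (λ k → + k * trinomial m k * v ^ k) ≋ + m * v * Σ m c
      trinomialSum = begin
        Σ p f
          ≡⟨ ≡.cong (λ n → Σ n f) p≡1+2m ⟩
        Σ (suc (m ℕ.+ m)) f
          ≈⟨ Σ-head (m ℕ.+ m) f ⟩
        0ℤ + Σ (m ℕ.+ m) (f ∘ suc)
          ≡⟨ ℤ.+-identityˡ (Σ (m ℕ.+ m) (f ∘ suc)) ⟩
        Σ (m ℕ.+ m) (f ∘ suc)
          ≈⟨ Σ-ext (m ℕ.+ m) (λ j → ≋-reflexive (shifted j)) ⟩
        Σ (m ℕ.+ m) (λ j → + m * v * c j)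
          ≈⟨ *-distribˡ-Σ (m ℕ.+ m) (+ m * v) c ⟨
        + m * v * Σ (m ℕ.+ m) c
          ≈⟨ *-congˡ (+ m * v) (Σ-split m m c) ⟩
        + m * v * (Σ m c + Σ m (λ j → c (j ℕ.+ m)))
          ≈⟨ *-congˡ (+ m * v) (+-cong (≋-refl {Σ m c}) (Σ-zero m (λ j _ → ≋-reflexive (tail j)))) ⟩
        + m * v * (Σ m c + 0ℤ)
          ≡⟨ ≡.cong (+ m * v *_) (ℤ.+-identityʳ (Σ m c)) ⟩
        + m * v * Σ m c ∎
        where
        open ≋-Reasoning
        f : ℕ → ℤ
        f k = + k * trinomial m k * v ^ k
        lem : ∀ m x v y → m * x * (v * y) ≡ m * v * (x * y)
        lem = solve-∀
        shifted : ∀ j → f (suc j) ≡ + m * v * c j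
        shifted j = ≡.trans (≡.cong (_* v ^ suc j) (trinomial-absorb M m≡1+M j))
          (lem (+ m) (+ (M C j) * + ((M ∸ j) C suc j)) v (v ^ j))
        -- Indices from m on exceed M, so C(M, j + m) = 0.
        tail : ∀ j → c (j ℕ.+ m) ≡ 0ℤ
        tail j = ≡.cong (λ z → + z * + ((M ∸ (j ℕ.+ m)) C suc (j ℕ.+ m)) * v ^ (j ℕ.+ m))
          (k>n⇒nCk≡0 (ℕ.≤-trans (ℕ.≤-reflexive (≡.sym m≡1+M)) (ℕ.m≤n+m m j)))

      -- The j-th term of the expanded power is a multiple of t^(m+M-j) (t + 1)^(M-j), whose
      -- coefficient of t^(2m) is C(M - j, j + 1), because 2m - (m + M - j) = j + 1.
      quadraticSum : Σ p (λ t → (+ t) ^ m * (v + + t * (+ t + 1ℤ)) ^ M) ≋ - Σ m c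
      quadraticSum = begin
        Σ p (λ t → (+ t) ^ m * (v + + t * (+ t + 1ℤ)) ^ M)
          ≈⟨ Σ-ext p expand ⟩
        Σ p (λ t → Σ m (λ j → g j t))
          ≈⟨ Σ-comm p m (λ t j → g j t) ⟩
        Σ m (λ j → Σ p (g j))
          ≈⟨ Σ-cong m column ⟩
        Σ m (λ j → - 1ℤ * c j)
          ≈⟨ *-distribˡ-Σ m (- 1ℤ) c ⟨
        - 1ℤ * Σ m c
          ≡⟨ ℤ.-1*i≡-i (Σ m c) ⟩
        - Σ m c ∎
        where
        open ≋-Reasoning
        e : ℕ → ℕ
        e j = m ℕ.+ (M ∸ j)
        g : ℕ → ℕ → ℤ
        g j t = + (M C j) * v ^ j * ((+ t) ^ e j * ((+ t) ^ 1 + 1ℤ) ^ (M ∸ j))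

        lem : ∀ t b x y z → t * (b * (x * (y * z))) ≡ b * x * (t * y * z)
        lem = solve-∀

        term : ∀ t j → (+ t) ^ m * (+ (M C j) * (v ^ j * (+ t * (+ t + 1ℤ)) ^ (M ∸ j))) ≡ g j t
        term t j = ≡.trans
          (≡.cong (λ z → (+ t) ^ m * (+ (M C j) * (v ^ j * z))) (^-distribʳ-* (+ t) (+ t + 1ℤ) (M ∸ j)))
          (≡.trans (lem ((+ t) ^ m) (+ (M C j)) (v ^ j) ((+ t) ^ (M ∸ j)) ((+ t + 1ℤ) ^ (M ∸ j)))
            (≡.cong₂ (λ x y → + (M C j) * v ^ j * (x * (y + 1ℤ) ^ (M ∸ j)))
              (≡.sym (ℤ.^-distribˡ-+-* (+ t) m (M ∸ j))) (≡.sym (ℤ.*-identityʳ (+ t)))))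

        expand : ∀ t → (+ t) ^ m * (v + + t * (+ t + 1ℤ)) ^ M ≋ Σ m (λ j → g j t)
        expand t = begin
          (+ t) ^ m * (v + + t * (+ t + 1ℤ)) ^ M
            ≈⟨ *-congˡ ((+ t) ^ m) (binomial M v (+ t * (+ t + 1ℤ))) ⟩
          (+ t) ^ m * Σ (suc M) (λ j → + (M C j) * (v ^ j * (+ t * (+ t + 1ℤ)) ^ (M ∸ j)))
            ≈⟨ *-distribˡ-Σ (suc M) ((+ t) ^ m) _ ⟩
          Σ (suc M) (λ j → (+ t) ^ m * (+ (M C j) * (v ^ j * (+ t * (+ t + 1ℤ)) ^ (M ∸ j))))
            ≈⟨ Σ-ext (suc M) (λ j → ≋-reflexive (term t j)) ⟩
          Σ (suc M) (λ j → g j t)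
            ≡⟨ ≡.cong (λ n → Σ n (λ j → g j t)) m≡1+M ⟨
          Σ m (λ j → g j t) ∎

        column : ∀ j → j < m → Σ p (g j) ≋ - 1ℤ * c j
        column j j<m = begin
          Σ p (g j)
            ≈⟨ *-distribˡ-Σ p (+ (M C j) * v ^ j) _ ⟨
          + (M C j) * v ^ j * W₁.W (e j) (M ∸ j)
            ≈⟨ *-congˡ (+ (M C j) * v ^ j) (W₁.W-coefficient (M ∸ j) (e j) (suc j) degree total) ⟩
          + (M C j) * v ^ j * - (+ ((M ∸ j) C suc j) * 1ℤ ^ (M ∸ j ∸ suc j))
            ≡⟨ ≡.cong (λ z → + (M C j) * v ^ j * - (+ ((M ∸ j) C suc j) * z)) (ℤ.^-zeroˡ (M ∸ j ∸ suc j)) ⟩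
          + (M C j) * v ^ j * - (+ ((M ∸ j) C suc j) * 1ℤ)
            ≡⟨ reorder (+ (M C j)) (v ^ j) (+ ((M ∸ j) C suc j)) ⟩
          - 1ℤ * c j ∎
          where
          reorder : ∀ a b c → a * b * - (c * 1ℤ) ≡ - 1ℤ * (a * c * b)
          reorder = solve-∀
          j≤M : j ≤ M
          j≤M = ℕ.≤-pred (ℕ.≤-trans j<m (ℕ.≤-reflexive m≡1+M))
          M∸j<m : M ∸ j < m
          M∸j<m = ℕ.≤-trans (s≤s (ℕ.m∸n≤m M j)) (ℕ.≤-reflexive (≡.sym m≡1+M))
          degree : e j ℕ.+ 1 ℕ.* (M ∸ j) < (m ℕ.+ m) ℕ.+ (m ℕ.+ m)
          degree = ℕ.+-mono-<-≤ (ℕ.+-monoʳ-< m M∸j<m)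
            (ℕ.≤-trans (ℕ.≤-reflexive (ℕ.*-identityˡ (M ∸ j))) (ℕ.≤-trans (ℕ.<⇒≤ M∸j<m) (ℕ.m≤m+n m m)))
          total : e j ℕ.+ 1 ℕ.* suc j ≡ m ℕ.+ m
          total = ≡.trans (≡.cong (e j ℕ.+_) (ℕ.*-identityˡ (suc j)))
            (≡.trans (ℕ.+-assoc m (M ∸ j) (suc j)) (≡.cong (m ℕ.+_)
              (≡.trans (ℕ.+-suc (M ∸ j) j) (≡.trans (≡.cong suc (ℕ.m∸n+n≡m j≤M)) (≡.sym m≡1+M)))))

    module _ (M : ℕ) (m≡1+M : m ≡ suc M) (r : ℤ) (3r≋1 : + 3 * r ≋ 1ℤ) where

      private
        v K : ℤ
        -- With r = 1/3 this is 2/9 = 16/72; `K` collects the powers of r that the substitution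
        -- pulls out.
        v = + 2 * (r * r)
        K = r ^ m * (r * r) ^ M

      -- t = r (s - 1) turns t (t + r) (t + 2r) into r³ (s - 1) s (s + 1).
      substitution : Σ p (λ t → (+ t) ^ m * (v + + t * (+ t + 1ℤ)) ^ M) ≋ K * (W₂.W m M - W₂.W M M)
      substitution = begin
        Σ p (λ t → f (+ t))
          ≈⟨ reindex f f-cong σ τ σ-cong τ-cong στ τσ ⟩
        Σ p (λ s → f (σ (+ s)))
          ≈⟨ Σ-ext p factor ⟩
        Σ p (λ s → K * (h m s) + K * (- 1ℤ * h M s))
          ≈⟨ Σ-distrib-+ p (λ s → K * (h m s)) (λ s → K * (- 1ℤ * h M s)) ⟩
        Σ p (λ s → K * h m s) + Σ p (λ s → K * (- 1ℤ * h M s))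
          ≈⟨ +-cong (*-distribˡ-Σ p K (h m)) (*-distribˡ-Σ p K (λ s → - 1ℤ * h M s)) ⟨
        K * W₂.W m M + K * Σ p (λ s → - 1ℤ * h M s)
          ≈⟨ +-cong (≋-refl {K * W₂.W m M}) (*-congˡ K (*-distribˡ-Σ p (- 1ℤ) (h M))) ⟨
        K * W₂.W m M + K * (- 1ℤ * W₂.W M M)
          ≡⟨ collect K (W₂.W m M) (W₂.W M M) ⟩
        K * (W₂.W m M - W₂.W M M) ∎
        where
        open ≋-Reasoning
        f σ τ : ℤ → ℤ
        f t = t ^ m * (v + t * (t + 1ℤ)) ^ M
        σ s = r * (s - 1ℤ)
        τ t = + 3 * t + 1ℤ
        h : ℕ → ℕ → ℤ
        h e s = (+ s) ^ e * ((+ s) ^ 2 + - 1ℤ) ^ M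
        collect : ∀ K x y → K * x + K * (- 1ℤ * y) ≡ K * (x - y)
        collect = solve-∀
        f-cong : ∀ {a b} → a ≋ b → f a ≋ f b
        f-cong e = *-cong (^-cong m e) (^-cong M (+-cong (≋-refl {v}) (*-cong e (+-cong e (≋-refl {1ℤ})))))
        σ-cong : ∀ {a b} → a ≋ b → σ a ≋ σ b
        σ-cong e = *-congˡ r (sub-cong e (≋-refl {1ℤ}))
        τ-cong : ∀ {a b} → a ≋ b → τ a ≋ τ b
        τ-cong e = +-cong (*-congˡ (+ 3) e) (≋-refl {1ℤ})
        στ : ∀ a → σ (τ a) ≋ a
        στ a = linear a 3r≋1 (lem a r)
          where
          lem : ∀ a r → r * (+ 3 * a + 1ℤ - 1ℤ) - a ≡ a * (+ 3 * r - 1ℤ)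
          lem = solve-∀
        τσ : ∀ a → τ (σ a) ≋ a
        τσ a = linear (a - 1ℤ) 3r≋1 (lem a r)
          where
          lem : ∀ a r → + 3 * (r * (a - 1ℤ)) + 1ℤ - a ≡ (a - 1ℤ) * (+ 3 * r - 1ℤ)
          lem = solve-∀

        -- As 3r ≡ 1, the left side is (t + r) (t + 2r) at t = r (s - 1).
        quadratic : ∀ s → v + σ s * (σ s + 1ℤ) ≋ (r * r) * (s * (s + 1ℤ))
        quadratic s = linear (- (r * (s - 1ℤ))) 3r≋1 (lem r s)
          where
          lem : ∀ r s → + 2 * (r * r) + r * (s - 1ℤ) * (r * (s - 1ℤ) + 1ℤ) - r * r * (s * (s + 1ℤ)) ≡
                        - (r * (s - 1ℤ)) * (+ 3 * r - 1ℤ)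
          lem = solve-∀

        factor : ∀ s → f (σ (+ s)) ≋ K * h m s + K * (- 1ℤ * h M s)
        factor s = begin
          σ (+ s) ^ m * (v + σ (+ s) * (σ (+ s) + 1ℤ)) ^ M
            ≈⟨ *-congˡ (σ (+ s) ^ m) (^-cong M (quadratic (+ s))) ⟩
          σ (+ s) ^ m * ((r * r) * (+ s * (+ s + 1ℤ))) ^ M
            ≡⟨ ≡.cong₂ _*_ (^-distribʳ-* r (+ s - 1ℤ) m) (^-distribʳ-* (r * r) (+ s * (+ s + 1ℤ)) M) ⟩
          r ^ m * (+ s - 1ℤ) ^ m * ((r * r) ^ M * (+ s * (+ s + 1ℤ)) ^ M)
            ≡⟨ ≡.cong₂ (λ n z → r ^ m * (+ s - 1ℤ) ^ n * ((r * r) ^ M * z)) m≡1+M (^-distribʳ-* (+ s) (+ s + 1ℤ) M) ⟩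
          -- Since m = M + 1, one factor s - 1 has no partner s + 1; expanding it produces the two
          -- sums.
          r ^ m * ((+ s - 1ℤ) * (+ s - 1ℤ) ^ M) * ((r * r) ^ M * ((+ s) ^ M * (+ s + 1ℤ) ^ M))
            ≡⟨ regroup (r ^ m) (+ s) ((+ s - 1ℤ) ^ M) ((r * r) ^ M) ((+ s) ^ M) ((+ s + 1ℤ) ^ M) ⟩
          K * (+ s * (+ s) ^ M * ((+ s - 1ℤ) ^ M * (+ s + 1ℤ) ^ M)) + K * (- 1ℤ * ((+ s) ^ M * ((+ s - 1ℤ) ^ M * (+ s + 1ℤ) ^ M)))
            ≡⟨ ≡.cong₂ (λ n z → K * ((+ s) ^ n * z) + K * (- 1ℤ * ((+ s) ^ M * z))) m≡1+M (≡.sym square) ⟨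
          K * h m s + K * (- 1ℤ * h M s) ∎
          where
          regroup : ∀ a s x b y z → a * ((s - 1ℤ) * x) * (b * (y * z)) ≡
            a * b * (s * y * (x * z)) + a * b * (- 1ℤ * (y * (x * z)))
          regroup = solve-∀
          lem : ∀ s → (s - 1ℤ) * (s + 1ℤ) ≡ s * (s * 1ℤ) + - 1ℤ
          lem = solve-∀
          square : (+ s - 1ℤ) ^ M * (+ s + 1ℤ) ^ M ≡ ((+ s) ^ 2 + - 1ℤ) ^ M
          square = ≡.trans (≡.sym (^-distribʳ-* (+ s - 1ℤ) (+ s + 1ℤ) M)) (≡.cong (_^ M) (lem (+ s)))

      r^2m≋1 : (r * r) ^ m ≋ 1ℤ
      r^2m≋1 = ≋-trans (≋-reflexive (≡.trans (^-distribʳ-* r r m) (≡.sym (ℤ.^-distribˡ-+-* r m m)))) (fermat′ r≢0)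
        where
        r≢0 : ¬ r ≋ 0ℤ
        r≢0 r≋0 = 1≢0 (≋-trans (≋-sym 3r≋1) (*-congˡ (+ 3) r≋0))

      -- The accumulated factor -m v r^m r^(2M) is -2m r^(2m) r^m, and both -2m and r^(2m) are 1
      -- modulo p.
      series-value : ∀ w → + 72 * w ≋ 1ℤ →
        Σ p (λ k → + k * + A k * w ^ k) ≋ r ^ m * (W₂.W m M - W₂.W M M)
      series-value w 72w≋1 = begin
        Σ p (λ k → + k * + A k * w ^ k)
          ≈⟨ Σ-cong p term ⟩
        Σ p (λ k → + k * trinomial m k * v ^ k)
          ≈⟨ trinomialSum M m≡1+M v ⟩
        + m * v * S
          ≡⟨ double-neg (+ m * v) S ⟩
        - (+ m * v) * - S
          ≈⟨ *-congˡ (- (+ m * v)) (≋-trans (≋-sym (quadraticSum M m≡1+M v)) substitution) ⟩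
        - (+ m * v) * (r ^ m * (r * r) ^ M * X)
          ≡⟨ regroup (+ m) r (r ^ m) ((r * r) ^ M) X ⟩
        - ((+ m + + m) * (r ^ m * X)) * ((r * r) ^ suc M)
          ≈⟨ *-cong (neg-cong (*-congʳ (r ^ m * X) 2m≋-1))
               (≋-trans (≋-reflexive (≡.cong ((r * r) ^_) (≡.sym m≡1+M))) r^2m≋1) ⟩
        - (- 1ℤ * (r ^ m * X)) * 1ℤ
          ≡⟨ simplify (r ^ m * X) ⟩
        r ^ m * X ∎
        where
        open ≋-Reasoning
        S X : ℤ
        S = Σ m (λ j → + (M C j) * + ((M ∸ j) C suc j) * v ^ j)
        X = W₂.W m M - W₂.W M M
        double-neg : ∀ a b → a * b ≡ - a * - b
        double-neg = solve-∀
        simplify : ∀ a → - (- 1ℤ * a) * 1ℤ ≡ a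
        simplify = solve-∀
        regroup : ∀ m r a b x → - (m * (+ 2 * (r * r))) * (a * b * x) ≡ - ((m + m) * (a * x)) * (r * r * b)
        regroup = solve-∀

        72≢0 : ¬ + 72 ≋ 0ℤ
        72≢0 h = 1≢0 (≋-trans (≋-sym 72w≋1) (*-congʳ w h))

        16w≋v : + 16 * w ≋ v
        16w≋v = *-cancelˡ (+ 72) 72≢0 (begin
          + 72 * (+ 16 * w)               ≡⟨ lem w ⟩
          + 16 * (+ 72 * w)               ≈⟨ *-congˡ (+ 16) 72w≋1 ⟩
          + 16 * 1ℤ                       ≈⟨ *-congˡ (+ 16) (*-cong 3r≋1 3r≋1) ⟨
          + 16 * ((+ 3 * r) * (+ 3 * r))  ≡⟨ lem′ r ⟩
          + 72 * v                        ∎)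
          where
          lem : ∀ w → + 72 * (+ 16 * w) ≡ + 16 * (+ 72 * w)
          lem = solve-∀
          lem′ : ∀ r → + 16 * ((+ 3 * r) * (+ 3 * r)) ≡ + 72 * (+ 2 * (r * r))
          lem′ = solve-∀

        term : ∀ k → k < p → + k * + A k * w ^ k ≋ + k * trinomial m k * v ^ k
        term k k<p = begin
          + k * + A k * w ^ k
            ≈⟨ *-congʳ (w ^ k) (*-congˡ (+ k) (A≋16^k*trinomial k k<p)) ⟩
          + k * ((+ 16) ^ k * trinomial m k) * w ^ k
            ≡⟨ lem (+ k) ((+ 16) ^ k) (trinomial m k) (w ^ k) ⟩
          + k * trinomial m k * ((+ 16) ^ k * w ^ k)
            ≡⟨ ≡.cong (+ k * trinomial m k *_) (^-distribʳ-* (+ 16) w k) ⟨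
          + k * trinomial m k * (+ 16 * w) ^ k
            ≈⟨ *-congˡ (+ k * trinomial m k) (^-cong k 16w≋v) ⟩
          + k * trinomial m k * v ^ k ∎
          where
          lem : ∀ k x c y → k * (x * c) * y ≡ k * c * (x * y)
          lem = solve-∀

  -- Gaussian integers

  record ℤ[i] : Set where
    constructor _+i_
    field
      re im : ℤ

  open ℤ[i] public

  infix 4 _≟ᵍ_
  infix 5 _+i_
  infixl 6 _⊕_
  infixl 7 _⊛_

  _⊕_ _⊛_ : ℤ[i] → ℤ[i] → ℤ[i]
  (a +i b) ⊕ (c +i d) = (a + c) +i (b + d)
  (a +i b) ⊛ (c +i d) = (a * c - b * d) +i (a * d + b * c)

  ⊖_ conj : ℤ[i] → ℤ[i]
  ⊖ (a +i b) = (- a) +i (- b)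
  conj (a +i b) = a +i (- b)

  𝟘 𝟙 : ℤ[i]
  𝟘 = 0ℤ +i 0ℤ
  𝟙 = 1ℤ +i 0ℤ

  norm : ℤ[i] → ℤ
  norm (a +i b) = a * a + b * b

  ℤ[i]-ring : CommutativeRing 0ℓ 0ℓ
  ℤ[i]-ring = record
    { Carrier = ℤ[i] ; _≈_ = _≡_ ; _+_ = _⊕_ ; _*_ = _⊛_ ; -_ = ⊖_ ; 0# = 𝟘 ; 1# = 𝟙
    ; isCommutativeRing = record
      { isRing = record
        { +-isAbelianGroup = record
          { isGroup = record
            { isMonoid = record
              { isSemigroup = record
                { isMagma = record { isEquivalence = ≡.isEquivalence ; ∙-cong = ≡.cong₂ _⊕_ }
                ; assoc = λ x y z → ≡.cong₂ _+i_ (ℤ.+-assoc (re x) (re y) (re z)) (ℤ.+-assoc (im x) (im y) (im z)) }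
              ; identity = (λ x → ≡.cong₂ _+i_ (ℤ.+-identityˡ (re x)) (ℤ.+-identityˡ (im x)))
                         , (λ x → ≡.cong₂ _+i_ (ℤ.+-identityʳ (re x)) (ℤ.+-identityʳ (im x))) }
            ; inverse = (λ x → ≡.cong₂ _+i_ (ℤ.+-inverseˡ (re x)) (ℤ.+-inverseˡ (im x)))
                      , (λ x → ≡.cong₂ _+i_ (ℤ.+-inverseʳ (re x)) (ℤ.+-inverseʳ (im x)))
            ; ⁻¹-cong = ≡.cong ⊖_ }
          ; comm = λ x y → ≡.cong₂ _+i_ (ℤ.+-comm (re x) (re y)) (ℤ.+-comm (im x) (im y)) }
        ; *-cong = ≡.cong₂ _⊛_
        ; *-assoc = ⊛-assoc
        ; *-identity = ⊛-identityˡ , (λ x → ≡.trans (⊛-comm x 𝟙) (⊛-identityˡ x))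
        ; distrib = ⊛-distribˡ
                  , (λ x y z → ≡.trans (⊛-comm (y ⊕ z) x)
                       (≡.trans (⊛-distribˡ x y z) (≡.cong₂ _⊕_ (⊛-comm x y) (⊛-comm x z)))) }
      ; *-comm = ⊛-comm } }
    where
    ⊛-comm : ∀ x y → x ⊛ y ≡ y ⊛ x
    ⊛-comm x y = ≡.cong₂ _+i_ (lem₁ (re x) (im x) (re y) (im y)) (lem₂ (re x) (im x) (re y) (im y))
      where
      lem₁ : ∀ a b c d → a * c - b * d ≡ c * a - d * b
      lem₁ = solve-∀
      lem₂ : ∀ a b c d → a * d + b * c ≡ c * b + d * a
      lem₂ = solve-∀
    ⊛-assoc : ∀ x y z → (x ⊛ y) ⊛ z ≡ x ⊛ (y ⊛ z)
    ⊛-assoc x y z = ≡.cong₂ _+i_ (lem₁ (re x) (im x) (re y) (im y) (re z) (im z))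
                                 (lem₂ (re x) (im x) (re y) (im y) (re z) (im z))
      where
      lem₁ : ∀ a b c d e f → (a * c - b * d) * e - (a * d + b * c) * f ≡ a * (c * e - d * f) - b * (c * f + d * e)
      lem₁ = solve-∀
      lem₂ : ∀ a b c d e f → (a * c - b * d) * f + (a * d + b * c) * e ≡ a * (c * f + d * e) + b * (c * e - d * f)
      lem₂ = solve-∀
    ⊛-identityˡ : ∀ x → 𝟙 ⊛ x ≡ x
    ⊛-identityˡ x = ≡.cong₂ _+i_ (lem₁ (re x) (im x)) (lem₂ (re x) (im x))
      where
      lem₁ : ∀ a b → 1ℤ * a - 0ℤ * b ≡ a
      lem₁ = solve-∀
      lem₂ : ∀ a b → 1ℤ * b + 0ℤ * a ≡ b
      lem₂ = solve-∀
    ⊛-distribˡ : ∀ x y z → x ⊛ (y ⊕ z) ≡ x ⊛ y ⊕ x ⊛ z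
    ⊛-distribˡ x y z = ≡.cong₂ _+i_ (lem₁ (re x) (im x) (re y) (im y) (re z) (im z))
                                    (lem₂ (re x) (im x) (re y) (im y) (re z) (im z))
      where
      lem₁ : ∀ a b c d e f → a * (c + e) - b * (d + f) ≡ a * c - b * d + (a * e - b * f)
      lem₁ = solve-∀
      lem₂ : ∀ a b c d e f → a * (d + f) + b * (c + e) ≡ a * d + b * c + (a * f + b * e)
      lem₂ = solve-∀

  _≟ᵍ_ : (z w : ℤ[i]) → Dec (z ≡ w)
  z ≟ᵍ w = Dec.map′ (λ (p , q) → ≡.cong₂ _+i_ p q) (λ eq → ≡.cong re eq , ≡.cong im eq)
    ((re z ℤ.≟ re w) ×-dec (im z ℤ.≟ im w))

  conj-⊕ : ∀ z w → conj (z ⊕ w) ≡ conj z ⊕ conj w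
  conj-⊕ z w = ≡.cong ((re z + re w) +i_) (ℤ.neg-distrib-+ (im z) (im w))

  conj-⊛ : ∀ z w → conj (z ⊛ w) ≡ conj z ⊛ conj w
  conj-⊛ z w = ≡.cong₂ _+i_ (lem₁ (re z) (im z) (re w) (im w)) (lem₂ (re z) (im z) (re w) (im w))
    where
    lem₁ : ∀ a b c d → a * c - b * d ≡ a * c - - b * - d
    lem₁ = solve-∀
    lem₂ : ∀ a b c d → - (a * d + b * c) ≡ a * - d + - b * c
    lem₂ = solve-∀

  -- Zero and the four units, indexed by a finite type so that the facts below are exhaustive
  -- checks.
  quartic : Fin 5 → ℤ[i]
  quartic zero                         = 𝟘
  quartic (suc zero)                   = 𝟙
  quartic (suc (suc zero))             = 0ℤ +i 1ℤ
  quartic (suc (suc (suc zero)))       = (- 1ℤ) +i 0ℤ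
  quartic (suc (suc (suc (suc zero)))) = 0ℤ +i (- 1ℤ)

  abstract
    quartic-⊛ : ∀ j k → ∃ λ l → quartic j ⊛ quartic k ≡ quartic l
    quartic-⊛ = from-yes (Fin.all? {n = 5} (λ j → Fin.all? {n = 5} (λ k →
      Fin.any? {n = 5} (λ l → (quartic j ⊛ quartic k) ≟ᵍ quartic l))))

    -- Distinct values differ by an element of norm 1, 2 or 4. Such a norm stays nonzero modulo p,
    -- since p ≥ 5 whenever p ≡ 1 modulo 4.
    quartic-separated : ∀ j k → quartic j ≡ quartic k ⊎
      0 < ∣ norm (quartic j ⊕ ⊖ quartic k) ∣ × ∣ norm (quartic j ⊕ ⊖ quartic k) ∣ < 5
    quartic-separated = from-yes (Fin.all? {n = 5} (λ j → Fin.all? {n = 5} (λ k →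
      (quartic j ≟ᵍ quartic k) ⊎-dec
      ((0 ℕ.<? ∣ norm (quartic j ⊕ ⊖ quartic k) ∣) ×-dec (∣ norm (quartic j ⊕ ⊖ quartic k) ∣ ℕ.<? 5)))))

    quartic-conj : ∀ j → conj (quartic j) ≡ quartic j ⊛ (quartic j ⊛ quartic j)
    quartic-conj = from-yes (Fin.all? {n = 5} (λ j → conj (quartic j) ≟ᵍ (quartic j ⊛ (quartic j ⊛ quartic j))))

    quartic-unit : ∀ j → quartic j ≡ 𝟘 ⊎ quartic j ⊛ conj (quartic j) ≡ 𝟙
    quartic-unit = from-yes (Fin.all? {n = 5} (λ j →
      (quartic j ≟ᵍ 𝟘) ⊎-dec ((quartic j ⊛ conj (quartic j)) ≟ᵍ 𝟙)))

    quartic-odd : ∀ j → quartic j ≡ 𝟘 ⊎ (re (quartic j) + im (quartic j) ≡ 1ℤ ⊎ re (quartic j) + im (quartic j) ≡ - 1ℤ)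
    quartic-odd = from-yes (Fin.all? {n = 5} (λ j → (quartic j ≟ᵍ 𝟘) ⊎-dec
      ((re (quartic j) + im (quartic j) ℤ.≟ 1ℤ) ⊎-dec (re (quartic j) + im (quartic j) ℤ.≟ - 1ℤ))))

  -- Multiplying (1 - z) S = 0 by the conjugate of 1 - z gives N S = 0 with a nonzero integer N.
  -- Applied to character sums that a substitution reproduces up to the factor z.
  fixed⇒𝟘 : ∀ j S → quartic j ≢ 𝟙 → S ≡ quartic j ⊛ S → S ≡ 𝟘
  fixed⇒𝟘 j S j≢𝟙 eq with quartic-separated (suc zero) j
  ... | inj₁ 𝟙≡j = ⊥-elim (j≢𝟙 (≡.sym 𝟙≡j))
  ... | inj₂ (0<N , _) = ≡.cong₂ _+i_ (cancel (re S) re-zero) (cancel (im S) im-zero)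
    where
    a b s t N : ℤ
    a = re (quartic j)
    b = im (quartic j)
    s = re S
    t = im S
    N = norm (𝟙 ⊕ ⊖ quartic j)
    s-eq : s ≡ a * s - b * t
    s-eq = ≡.cong re eq
    t-eq : t ≡ a * t + b * s
    t-eq = ≡.cong im eq
    lem₁ : ∀ a b s t → ((1ℤ - a) * (1ℤ - a) + (0ℤ - b) * (0ℤ - b)) * s ≡
      (1ℤ - a) * (s - (a * s - b * t)) + - b * (t - (a * t + b * s))
    lem₁ = solve-∀
    lem₂ : ∀ a b s t → ((1ℤ - a) * (1ℤ - a) + (0ℤ - b) * (0ℤ - b)) * t ≡
      b * (s - (a * s - b * t)) + (1ℤ - a) * (t - (a * t + b * s))
    lem₂ = solve-∀
    collapse : ∀ x y u v → x * (u - u) + y * (v - v) ≡ 0ℤ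
    collapse = solve-∀
    re-zero : N * s ≡ 0ℤ
    re-zero = ≡.trans (lem₁ a b s t) (≡.trans
      (≡.cong₂ (λ x y → (1ℤ - a) * (s - x) + - b * (t - y)) (≡.sym s-eq) (≡.sym t-eq)) (collapse (1ℤ - a) (- b) s t))
    im-zero : N * t ≡ 0ℤ
    im-zero = ≡.trans (lem₂ a b s t) (≡.trans
      (≡.cong₂ (λ x y → b * (s - x) + (1ℤ - a) * (t - y)) (≡.sym s-eq) (≡.sym t-eq)) (collapse b (1ℤ - a) s t))
    cancel : ∀ z → N * z ≡ 0ℤ → z ≡ 0ℤ
    cancel z h = ℤ.∣i∣≡0⇒i≡0 (ℕ.m*n≡0⇒m≡0 ∣ z ∣ ∣ N ∣ {{ℕ.>-nonZero 0<N}}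
      (≡.trans (ℕ.*-comm ∣ z ∣ ∣ N ∣) (≡.trans (≡.sym (ℤ.abs-* N z)) (≡.cong ∣_∣ h))))

  -- The quartic character attached to a square root of -1

  module G = CommutativeRing ℤ[i]-ring
  module ΣG = Summation ℤ[i]-ring

  module QuarticCharacter (p : ℕ) (pp : Prime p) (m : ℕ) (p≡1+2m : p ≡ suc (m ℕ.+ m))
    (n : ℕ) (m≡2n : m ≡ n ℕ.+ n) (ι : ℤ) (ι²≋-1 : Congruence._≋_ p (ι * ι) (- 1ℤ)) where

    open Series p pp m p≡1+2m

    open Reindexing ℤ[i]-ring using () renaming (reindex to reindexG)

    0<n : 0 < n
    0<n = lem n m≡2n
      where
      lem : ∀ n → m ≡ n ℕ.+ n → 0 < n
      lem zero    eq = ⊥-elim (ℕ.<⇒≢ 0<m (≡.sym eq))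
      lem (suc n) _  = s≤s z≤n

    4<p : 4 < p
    4<p = ≡.subst (4 <_) (≡.sym (≡.trans p≡1+2m (≡.cong (λ k → suc (k ℕ.+ k)) m≡2n)))
      (s≤s (ℕ.+-mono-≤ (ℕ.+-mono-≤ 0<n 0<n) (ℕ.+-mono-≤ 0<n 0<n)))

    -- Reduction at the prime above p that contains i - ι; it is multiplicative modulo p because ι²
    -- ≡ -1.
    ev : ℤ[i] → ℤ
    ev (a +i b) = a + b * ι

    ev-⊕ : ∀ z w → ev (z ⊕ w) ≡ ev z + ev w
    ev-⊕ (a +i b) (c +i d) = lem a b c d ι
      where
      lem : ∀ a b c d ι → a + c + (b + d) * ι ≡ a + b * ι + (c + d * ι)
      lem = solve-∀

    ev-⊖ : ∀ z w → ev (z ⊕ ⊖ w) ≡ ev z - ev w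
    ev-⊖ (a +i b) (c +i d) = lem a b c d ι
      where
      lem : ∀ a b c d ι → a + - c + (b + - d) * ι ≡ a + b * ι - (c + d * ι)
      lem = solve-∀

    ev-⊛ : ∀ z w → ev (z ⊛ w) ≋ ev z * ev w
    ev-⊛ (a +i b) (c +i d) = linear (- (b * d)) ι²≋-1 (lem a b c d ι)
      where
      lem : ∀ a b c d ι → a * c - b * d + (a * d + b * c) * ι - (a + b * ι) * (c + d * ι) ≡
                          - (b * d) * (ι * ι - - 1ℤ)
      lem = solve-∀

    norm-≋ : ∀ z → norm z ≋ ev z * ev (conj z)
    norm-≋ (a +i b) = linear (b * b) ι²≋-1 (lem a b ι)
      where
      lem : ∀ a b ι → a * a + b * b - (a + b * ι) * (a + - b * ι) ≡ b * b * (ι * ι - - 1ℤ)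
      lem = solve-∀

    -- A difference in the kernel of `ev` has norm divisible by p, which the norms in
    -- `quartic-separated` are too small for.
    ev-injective : ∀ j k → ev (quartic j) ≋ ev (quartic k) → quartic j ≡ quartic k
    ev-injective j k h with quartic-separated j k
    ... | inj₁ eq = eq
    ... | inj₂ (0<N , N<5) = ⊥-elim (small≢0 _ 0<N (ℕ.<-≤-trans N<5 4<p) (∣⇒≋0 (≋0⇒∣ N≋0)))
      where
      d : ℤ[i]
      d = quartic j ⊕ ⊖ quartic k
      N≋0 : norm d ≋ 0ℤ
      N≋0 = ≋-trans (norm-≋ d) (*-congʳ (ev (conj d))
        (≋-trans (≋-reflexive (ev-⊖ (quartic j) (quartic k))) (≋⇒-≋0 h)))

    ^4n : ∀ a → a ^ (m ℕ.+ m) ≡ (a ^ n * a ^ n) * (a ^ n * a ^ n)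
    ^4n a = ≡.trans (ℤ.^-distribˡ-+-* a m m) (≡.cong₂ _*_ a^m a^m)
      where
      a^m : a ^ m ≡ a ^ n * a ^ n
      a^m = ≡.trans (≡.cong (a ^_) m≡2n) (ℤ.^-distribˡ-+-* a n n)

    0^n≋0 : ∀ {a} → a ≋ 0ℤ → a ^ n ≋ 0ℤ
    0^n≋0 {a} h = lem n 0<n
      where
      lem : ∀ k → 0 < k → a ^ k ≋ 0ℤ
      lem (suc k) _ = *-congʳ (a ^ k) h

    private
      square-root-of-1 : ∀ T → T * T - 1ℤ ≋ 0ℤ → T - 1ℤ ≋ 0ℤ ⊎ T + 1ℤ ≋ 0ℤ
      square-root-of-1 T h = integral (T - 1ℤ) (T + 1ℤ) (linear 1ℤ h (factor T))
        where
        factor : ∀ T → (T - 1ℤ) * (T + 1ℤ) - 0ℤ ≡ 1ℤ * (T * T - 1ℤ - 0ℤ)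
        factor = solve-∀

      square-root-of--1 : ∀ T → T * T + 1ℤ ≋ 0ℤ → T - ι ≋ 0ℤ ⊎ T + ι ≋ 0ℤ
      square-root-of--1 T h = integral (T - ι) (T + ι) (≋-trans (≋-reflexive (factor T ι))
        (≋⇒-≋0 (≋-trans T²≋-1 (≋-sym ι²≋-1))))
        where
        shift : ∀ T → T * T - - 1ℤ ≡ 1ℤ * (T * T + 1ℤ - 0ℤ)
        shift = solve-∀
        T²≋-1 : T * T ≋ - 1ℤ
        T²≋-1 = linear 1ℤ h (shift T)
        factor : ∀ T ι → (T - ι) * (T + ι) ≡ T * T - ι * ι
        factor = solve-∀

      fourth-root : ∀ T → (T * T) * (T * T) ≋ 1ℤ → ∃ λ k → ev (quartic k) ≋ T
      fourth-root T h = case (integral (T * T - 1ℤ) (T * T + 1ℤ) (linear 1ℤ h (lem T)))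
        where
        lem : ∀ T → (T * T - 1ℤ) * (T * T + 1ℤ) - 0ℤ ≡ 1ℤ * (T * T * (T * T) - 1ℤ)
        lem = solve-∀
        found : ∀ k → T - ev (quartic k) ≋ 0ℤ → ∃ λ k → ev (quartic k) ≋ T
        found k e = k , ≋-sym (-≋0⇒≋ {T} {ev (quartic k)} e)
        value : ∀ {u w} → u ≋ 0ℤ → w ≡ u → w ≋ 0ℤ
        value h ≡.refl = h
        one : ∀ T ι → T - (1ℤ + 0ℤ * ι) ≡ T - 1ℤ
        one = solve-∀
        minus-one : ∀ T ι → T - (- 1ℤ + 0ℤ * ι) ≡ T + 1ℤ
        minus-one = solve-∀
        iota : ∀ T ι → T - (0ℤ + 1ℤ * ι) ≡ T - ι
        iota = solve-∀
        minus-iota : ∀ T ι → T - (0ℤ + - 1ℤ * ι) ≡ T + ι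
        minus-iota = solve-∀
        case₁ : T - 1ℤ ≋ 0ℤ ⊎ T + 1ℤ ≋ 0ℤ → ∃ λ k → ev (quartic k) ≋ T
        case₁ (inj₁ e) = found (suc zero) (value e (one T ι))
        case₁ (inj₂ e) = found (suc (suc (suc zero))) (value e (minus-one T ι))
        case₂ : T - ι ≋ 0ℤ ⊎ T + ι ≋ 0ℤ → ∃ λ k → ev (quartic k) ≋ T
        case₂ (inj₁ e) = found (suc (suc zero)) (value e (iota T ι))
        case₂ (inj₂ e) = found (suc (suc (suc (suc zero)))) (value e (minus-iota T ι))
        case : T * T - 1ℤ ≋ 0ℤ ⊎ T * T + 1ℤ ≋ 0ℤ → ∃ λ k → ev (quartic k) ≋ T
        case (inj₁ e) = case₁ (square-root-of-1 T e)
        case (inj₂ e) = case₂ (square-root-of--1 T e)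

    abstract
      -- For a ≠ 0 Fermat gives (a^n)^4 = a^(p-1) ≡ 1, so a^n is one of 1, -1, ι, -ι. The character
      -- is this power lifted to ℤ[i].
      code : ∀ a → ∃ λ k → ev (quartic k) ≋ a ^ n
      code a with a ≋? 0ℤ
      ... | yes a≋0 = zero , ≋-trans (≋-reflexive (lem ι)) (≋-sym (0^n≋0 a≋0))
        where
        lem : ∀ ι → 0ℤ + 0ℤ * ι ≡ 0ℤ
        lem = solve-∀
      ... | no a≢0  = fourth-root (a ^ n) (≋-trans (≋-reflexive (≡.sym (^4n a))) (fermat′ a≢0))

    χ ψ : ℤ → ℤ[i]
    χ a = quartic (proj₁ (code a))
    ψ a = conj (χ a)

    ev-χ : ∀ a → ev (χ a) ≋ a ^ n
    ev-χ a = proj₂ (code a)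

    χ-unique : ∀ a k → a ^ n ≋ ev (quartic k) → χ a ≡ quartic k
    χ-unique a k h = ev-injective (proj₁ (code a)) k (≋-trans (ev-χ a) h)

    χ-cong : ∀ {a b} → a ≋ b → χ a ≡ χ b
    χ-cong {a} {b} h = χ-unique a (proj₁ (code b)) (≋-trans (^-cong n h) (≋-sym (ev-χ b)))

    ψ-cong : ∀ {a b} → a ≋ b → ψ a ≡ ψ b
    ψ-cong h = ≡.cong conj (χ-cong h)

    -- Multiplicativity of n-th powers, lifted along `ev`: the product is again a quartic value and
    -- `ev` is injective on those.
    χ-* : ∀ a b → χ (a * b) ≡ χ a ⊛ χ b
    χ-* a b = ≡.trans (χ-unique (a * b) l (begin
        (a * b) ^ n             ≡⟨ ^-distribʳ-* a b n ⟩
        a ^ n * b ^ n           ≈⟨ *-cong (ev-χ a) (ev-χ b) ⟨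
        ev (χ a) * ev (χ b)     ≈⟨ ev-⊛ (χ a) (χ b) ⟨
        ev (χ a ⊛ χ b)          ≡⟨ ≡.cong ev eq ⟩
        ev (quartic l)          ∎)) (≡.sym eq)
      where
      open ≋-Reasoning
      closed = quartic-⊛ (proj₁ (code a)) (proj₁ (code b))
      l : Fin 5
      l = proj₁ closed
      eq : χ a ⊛ χ b ≡ quartic l
      eq = proj₂ closed

    χ-zero : ∀ {a} → a ≋ 0ℤ → χ a ≡ 𝟘
    χ-zero {a} h = χ-unique a zero (≋-trans (0^n≋0 h) (≋-reflexive (lem ι)))
      where
      lem : ∀ ι → 0ℤ ≡ 0ℤ + 0ℤ * ι
      lem = solve-∀

    χ-one : ∀ {a} → a ^ n ≋ 1ℤ → χ a ≡ 𝟙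
    χ-one {a} h = χ-unique a (suc zero) (≋-trans h (≋-reflexive (lem ι)))
      where
      lem : ∀ ι → 1ℤ ≡ 1ℤ + 0ℤ * ι
      lem = solve-∀

    χ1≡𝟙 : ∀ {a} → a ≋ 1ℤ → χ a ≡ 𝟙
    χ1≡𝟙 h = χ-one (≋-trans (^-cong n h) (≋-reflexive (ℤ.^-zeroˡ n)))

    ψ-zero : ∀ {a} → a ≋ 0ℤ → ψ a ≡ 𝟘
    ψ-zero h = ≡.cong conj (χ-zero h)

    χ≢𝟘 : ∀ {a} → ¬ a ≋ 0ℤ → χ a ≢ 𝟘
    χ≢𝟘 {a} a≢0 eq = a≢0 (power-nonzero n (≋-trans (≋-sym (ev-χ a)) (≋-reflexive (≡.trans (≡.cong ev eq) (lem ι)))))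
      where
      lem : ∀ ι → 0ℤ + 0ℤ * ι ≡ 0ℤ
      lem = solve-∀
      power-nonzero : ∀ k → a ^ k ≋ 0ℤ → a ≋ 0ℤ
      power-nonzero zero    h = ⊥-elim (1≢0 h)
      power-nonzero (suc k) h = Sum.fromInj₁ (power-nonzero k) (integral a (a ^ k) h)

    χψ≡𝟙 : ∀ {a} → ¬ a ≋ 0ℤ → χ a ⊛ ψ a ≡ 𝟙
    χψ≡𝟙 {a} a≢0 = Sum.fromInj₂ (λ eq → ⊥-elim (χ≢𝟘 a≢0 eq)) (quartic-unit (proj₁ (code a)))

    inverse-zero : ∀ {a} → a ≋ 0ℤ → inverse a ≋ 0ℤ
    inverse-zero {a} h = lem (m ℕ.+ m ∸ 1) (ℕ.m<n⇒0<n∸m (ℕ.+-mono-≤ 0<m 0<m))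
      where
      lem : ∀ k → 0 < k → a ^ k ≋ 0ℤ
      lem (suc k) _ = *-congʳ (a ^ k) h

    inverse-nonzero : ∀ {a} → ¬ a ≋ 0ℤ → ¬ inverse a ≋ 0ℤ
    inverse-nonzero {a} a≢0 h = 1≢0 (≋-trans (≋-sym (*-inverse a≢0))
      (≋-trans (*-congˡ a h) (≋-reflexive (ℤ.*-zeroʳ a))))

    inverse-involutive : ∀ a → inverse (inverse a) ≋ a
    inverse-involutive a with a ≋? 0ℤ
    ... | yes a≋0 = ≋-trans (inverse-zero (inverse-zero a≋0)) (≋-sym a≋0)
    ... | no a≢0  = *-cancelˡ (inverse a) (inverse-nonzero a≢0)
      (≋-trans (*-inverse (inverse-nonzero a≢0))
        (≋-sym (≋-trans (≋-reflexive (ℤ.*-comm (inverse a) a)) (*-inverse a≢0))))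

    inverse-cong : ∀ {a b} → a ≋ b → inverse a ≋ inverse b
    inverse-cong = ^-cong (m ℕ.+ m ∸ 1)

    χ-inverse : ∀ a → χ (inverse a) ≡ ψ a
    χ-inverse a with a ≋? 0ℤ
    ... | yes a≋0 = ≡.trans (χ-zero (inverse-zero a≋0)) (≡.sym (ψ-zero a≋0))
    ... | no a≢0  = begin
      χ (inverse a)                    ≡⟨ G.*-identityˡ (χ (inverse a)) ⟨
      𝟙 ⊛ χ (inverse a)                ≡⟨ ≡.cong (_⊛ χ (inverse a)) (χψ≡𝟙 a≢0) ⟨
      χ a ⊛ ψ a ⊛ χ (inverse a)        ≡⟨ ≡.cong (_⊛ χ (inverse a)) (G.*-comm (χ a) (ψ a)) ⟩
      ψ a ⊛ χ a ⊛ χ (inverse a)        ≡⟨ G.*-assoc (ψ a) (χ a) (χ (inverse a)) ⟩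
      ψ a ⊛ (χ a ⊛ χ (inverse a))      ≡⟨ ≡.cong (ψ a ⊛_) (χ-* a (inverse a)) ⟨
      ψ a ⊛ χ (a * inverse a)          ≡⟨ ≡.cong (ψ a ⊛_) (χ1≡𝟙 (*-inverse a≢0)) ⟩
      ψ a ⊛ 𝟙                          ≡⟨ G.*-identityʳ (ψ a) ⟩
      ψ a                              ∎
      where open ≡.≡-Reasoning

    -- Otherwise the power sum of exponent m would be 2m ≡ -1.
    abstract
      nonresidue : ∃ λ g → ¬ g ≋ 0ℤ × ¬ g ^ m ≋ 1ℤ
      nonresidue with Fin.any? {n = m ℕ.+ m} (λ i → ¬? ((+ suc (toℕ i)) ^ m ≋? 1ℤ))
      ... | yes (i , g^m≢1) = + suc (toℕ i) , small≢0 (suc (toℕ i)) (s≤s z≤n)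
        (ℕ.≤-trans (s≤s (Fin.toℕ<n i)) (ℕ.≤-reflexive (≡.sym p≡1+2m))) , g^m≢1
      ... | no none = ⊥-elim (1≢0 (linear (- 1ℤ) total ≡.refl))
        where
        open ≋-Reasoning
        f : ℕ → ℤ
        f t = (+ t) ^ m
        zero-power : ∀ k → 0 < k → 0ℤ ^ k ≡ 0ℤ
        zero-power (suc k) _ = ≡.refl
        one : ∀ k → k < m ℕ.+ m → f (suc k) ≋ 1ℤ
        one k k<2m = decidable-stable (f (suc k) ≋? 1ℤ) (λ ¬h → none (fromℕ< k<2m ,
          ≡.subst (λ j → ¬ (+ suc j) ^ m ≋ 1ℤ) (≡.sym (Fin.toℕ-fromℕ< k<2m)) ¬h))
        simplify : ∀ x → 0ℤ + x * 1ℤ ≡ x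
        simplify = solve-∀
        total : - 1ℤ ≋ 0ℤ
        total = begin
          - 1ℤ                              ≈⟨ 2m≋-1 ⟨
          + (m ℕ.+ m)                       ≡⟨ simplify (+ (m ℕ.+ m)) ⟨
          0ℤ + + (m ℕ.+ m) * 1ℤ             ≈⟨ +-cong (≋-refl {0ℤ}) (Σ-const (m ℕ.+ m) 1ℤ) ⟨
          0ℤ + Σ (m ℕ.+ m) (λ _ → 1ℤ)       ≈⟨ +-cong (≋-reflexive (zero-power m 0<m)) (Σ-cong (m ℕ.+ m) one) ⟨
          f 0 + Σ (m ℕ.+ m) (f ∘ suc)       ≈⟨ Σ-head (m ℕ.+ m) f ⟨
          Σ (suc (m ℕ.+ m)) f               ≡⟨ ≡.cong (λ k → Σ k f) p≡1+2m ⟨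
          powerSum m                        ≈⟨ powerSum-low (m ℕ.+ m) m (ℕ.m<m+n m 0<m) ℕ.≤-refl ⟩
          0ℤ                                ∎

    private
      g : ℤ
      g = proj₁ nonresidue
      g≢0 : ¬ g ≋ 0ℤ
      g≢0 = proj₁ (proj₂ nonresidue)

    scale-Σ : ∀ (f : ℤ → ℤ[i]) → (∀ {a b} → a ≋ b → f a ≡ f b) → ∀ c → ¬ c ≋ 0ℤ →
              ΣG.Σ p (λ t → f (+ t)) ≡ ΣG.Σ p (λ t → f (c * + t))
    scale-Σ f f-cong c c≢0 = reindexG f f-cong (c *_) (inverse c *_) (*-congˡ c) (*-congˡ (inverse c))
      (λ a → ≋-trans (≋-reflexive (≡.sym (ℤ.*-assoc c (inverse c) a))) (unit a))
      (λ a → ≋-trans (≋-reflexive (≡.sym (ℤ.*-assoc (inverse c) c a)))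
        (≋-trans (*-congʳ a (≋-reflexive (ℤ.*-comm (inverse c) c))) (unit a)))
      where
      unit : ∀ a → c * inverse c * a ≋ a
      unit a = ≋-trans (*-congʳ a (*-inverse c≢0)) (≋-reflexive (ℤ.*-identityˡ a))

    -- `ev` sends χ(g)² to g^m, which is not 1. The same g thus shows χ² and χ to be nontrivial, and
    -- scaling by it annihilates both sums.
    χ²-g≢𝟙 : χ g ⊛ χ g ≢ 𝟙
    χ²-g≢𝟙 eq = proj₂ (proj₂ nonresidue) (begin
      g ^ m                ≡⟨ ≡.trans (≡.cong (g ^_) m≡2n) (ℤ.^-distribˡ-+-* g n n) ⟩
      g ^ n * g ^ n        ≈⟨ *-cong (ev-χ g) (ev-χ g) ⟨
      ev (χ g) * ev (χ g)  ≈⟨ ev-⊛ (χ g) (χ g) ⟨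
      ev (χ g ⊛ χ g)       ≡⟨ ≡.cong ev eq ⟩
      ev 𝟙                 ≡⟨ lem ι ⟩
      1ℤ                   ∎)
      where
      open ≋-Reasoning
      lem : ∀ ι → 1ℤ + 0ℤ * ι ≡ 1ℤ
      lem = solve-∀

    χ-g≢𝟙 : χ g ≢ 𝟙
    χ-g≢𝟙 eq = χ²-g≢𝟙 (≡.cong₂ _⊛_ eq eq)

    Σχ≡𝟘 : ΣG.Σ p (λ t → χ (+ t)) ≡ 𝟘
    Σχ≡𝟘 = fixed⇒𝟘 (proj₁ (code g)) _ χ-g≢𝟙
      (≡.trans (scale-Σ χ χ-cong g g≢0)
        (≡.trans (ΣG.Σ-ext p (λ t → χ-* g (+ t))) (≡.sym (ΣG.*-distribˡ-Σ p (χ g) (λ t → χ (+ t))))))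

    χ²-* : ∀ a b → χ (a * b) ⊛ χ (a * b) ≡ (χ a ⊛ χ a) ⊛ (χ b ⊛ χ b)
    χ²-* a b = ≡.trans (≡.cong₂ _⊛_ (χ-* a b) (χ-* a b)) (interchange (χ a) (χ b) (χ a) (χ b))
      where open Algebra.Properties.CommutativeSemigroup G.*-commutativeSemigroup using (interchange)

    Σχ²≡𝟘 : ΣG.Σ p (λ t → χ (+ t) ⊛ χ (+ t)) ≡ 𝟘
    Σχ²≡𝟘 = fixed⇒𝟘 (proj₁ closed) _ (λ eq → χ²-g≢𝟙 (≡.trans (proj₂ closed) eq))
      (≡.trans (scale-Σ (λ a → χ a ⊛ χ a) (λ h → ≡.cong₂ _⊛_ (χ-cong h) (χ-cong h)) g g≢0)
        (≡.trans (ΣG.Σ-ext p (λ t → ≡.trans (χ²-* g (+ t)) (≡.cong (_⊛ (χ (+ t) ⊛ χ (+ t))) (proj₂ closed))))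
          (≡.sym (ΣG.*-distribˡ-Σ p (quartic (proj₁ closed)) (λ t → χ (+ t) ⊛ χ (+ t))))))
      where
      closed = quartic-⊛ (proj₁ (code g)) (proj₁ (code g))

  -- The Jacobi sum

  module JacobiSum (p : ℕ) (pp : Prime p) (m : ℕ) (p≡1+2m : p ≡ suc (m ℕ.+ m))
    (n : ℕ) (m≡2n : m ≡ n ℕ.+ n) (ι : ℤ) (ι²≋-1 : Congruence._≋_ p (ι * ι) (- 1ℤ)) where

    open Series p pp m p≡1+2m
    open QuarticCharacter p pp m p≡1+2m n m≡2n ι ι²≋-1
    open Reindexing ℤ[i]-ring using () renaming (reindex to reindexG)
    private module ⊛-Solver = Algebra.Solver.CommutativeMonoid G.*-commutativeMonoid

    -- This is χ(4) times the usual Jacobi sum of χ with itself. For r = 1 + t the terms are χ(1 -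
    -- t²), which are even in t.
    J J̄ : ℤ[i]
    J = ΣG.Σ p (λ r → χ (+ r) ⊛ χ (+ 2 - + r))
    J̄ = ΣG.Σ p (λ r → ψ (+ r) ⊛ ψ (+ 2 - + r))

    -- χ ψ is the principal character, equal to 1 except at 0.
    drop-zero : ∀ (f : ℤ → ℤ[i]) →
      ΣG.Σ p (λ t → χ (+ t) ⊛ ψ (+ t) ⊛ f (+ t)) ≡ ΣG.Σ p (λ t → f (+ t)) ⊕ ⊖ f 0ℤ
    drop-zero f = begin
      ΣG.Σ p F                                       ≡⟨ ≡.cong (λ k → ΣG.Σ k F) p≡1+2m ⟩
      ΣG.Σ (suc (m ℕ.+ m)) F                         ≡⟨ ΣG.Σ-head (m ℕ.+ m) F ⟩
      F 0 ⊕ ΣG.Σ (m ℕ.+ m) (F ∘ suc)                 ≡⟨ ≡.cong₂ _⊕_ F0 (ΣG.Σ-cong (m ℕ.+ m) Fs) ⟩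
      𝟘 ⊕ ΣG.Σ (m ℕ.+ m) (λ t → f (+ suc t))         ≡⟨ cancel (f 0ℤ) _ ⟩
      f 0ℤ ⊕ ΣG.Σ (m ℕ.+ m) (λ t → f (+ suc t)) ⊕ ⊖ f 0ℤ
        ≡⟨ ≡.cong (_⊕ ⊖ f 0ℤ) (ΣG.Σ-head (m ℕ.+ m) (λ t → f (+ t))) ⟨
      ΣG.Σ (suc (m ℕ.+ m)) (λ t → f (+ t)) ⊕ ⊖ f 0ℤ
        ≡⟨ ≡.cong (λ k → ΣG.Σ k (λ t → f (+ t)) ⊕ ⊖ f 0ℤ) p≡1+2m ⟨
      ΣG.Σ p (λ t → f (+ t)) ⊕ ⊖ f 0ℤ ∎
      where
      open ≡.≡-Reasoning
      F : ℕ → ℤ[i]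
      F t = χ (+ t) ⊛ ψ (+ t) ⊛ f (+ t)
      F0 : F 0 ≡ 𝟘
      F0 = ≡.trans (≡.cong (λ z → z ⊛ ψ 0ℤ ⊛ f 0ℤ) (χ-zero ≋-refl))
        (≡.trans (≡.cong (_⊛ f 0ℤ) (G.zeroˡ (ψ 0ℤ))) (G.zeroˡ (f 0ℤ)))
      Fs : ∀ t → t < m ℕ.+ m → F (suc t) ≡ f (+ suc t)
      Fs t t<2m = ≡.trans (≡.cong (_⊛ f (+ suc t)) (χψ≡𝟙 (small≢0 (suc t) (s≤s z≤n)
        (ℕ.≤-trans (s≤s t<2m) (ℕ.≤-reflexive (≡.sym p≡1+2m)))))) (G.*-identityˡ (f (+ suc t)))
      cancel : ∀ z w → 𝟘 ⊕ w ≡ z ⊕ w ⊕ ⊖ z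
      cancel (a +i b) (c +i d) = ≡.cong₂ _+i_ (lem a c) (lem b d)
        where
        lem : ∀ a c → 0ℤ + c ≡ a + c + - a
        lem = solve-∀

    -- The substitution r = u v for u ≠ 0. The factor χ(u) ψ(u) makes both sides vanish at u = 0, so
    -- that the formula can be summed over all u.
    J-scale : ∀ u → J ⊛ ψ u ≡ χ u ⊛ ψ u ⊛ ΣG.Σ p (λ v → χ (+ v) ⊛ χ (+ 2 - u * + v))
    J-scale u with u ≋? 0ℤ
    ... | yes u≋0 = ≡.trans (≡.cong (J ⊛_) (ψ-zero u≋0)) (≡.trans (G.zeroʳ J) (≡.sym
      (≡.trans (≡.cong (_⊛ T) (≡.trans (≡.cong (χ u ⊛_) (ψ-zero u≋0)) (G.zeroʳ (χ u)))) (G.zeroˡ T))))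
      where
      T : ℤ[i]
      T = ΣG.Σ p (λ v → χ (+ v) ⊛ χ (+ 2 - u * + v))
    ... | no u≢0 = begin
      J ⊛ ψ u
        ≡⟨ ≡.cong (_⊛ ψ u) (scale-Σ (λ r → χ r ⊛ χ (+ 2 - r))
             (λ h → ≡.cong₂ _⊛_ (χ-cong h) (χ-cong (sub-cong (≋-refl {+ 2}) h))) u u≢0) ⟩
      ΣG.Σ p (λ v → χ (u * + v) ⊛ χ (+ 2 - u * + v)) ⊛ ψ u
        ≡⟨ ≡.cong (_⊛ ψ u) (ΣG.Σ-ext p (λ v → ≡.trans (≡.cong (_⊛ χ (+ 2 - u * + v)) (χ-* u (+ v)))
             (G.*-assoc (χ u) (χ (+ v)) (χ (+ 2 - u * + v))))) ⟩
      ΣG.Σ p (λ v → χ u ⊛ (χ (+ v) ⊛ χ (+ 2 - u * + v))) ⊛ ψ u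
        ≡⟨ ≡.cong (_⊛ ψ u) (ΣG.*-distribˡ-Σ p (χ u) (λ v → χ (+ v) ⊛ χ (+ 2 - u * + v))) ⟨
      χ u ⊛ T ⊛ ψ u
        ≡⟨ swap (χ u) T (ψ u) ⟩
      χ u ⊛ ψ u ⊛ T ∎
      where
      open ≡.≡-Reasoning
      T : ℤ[i]
      T = ΣG.Σ p (λ v → χ (+ v) ⊛ χ (+ 2 - u * + v))
      swap : ∀ a b c → a ⊛ b ⊛ c ≡ a ⊛ c ⊛ b
      swap a b c = ≡.trans (G.*-assoc a b c) (≡.trans (≡.cong (a ⊛_) (G.*-comm b c)) (≡.sym (G.*-assoc a c b)))

    -- A complete sum of χ over a linear function: 0 unless the slope 2 - 2v vanishes.
    D : ℤ → ℤ[i]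
    D v = ΣG.Σ p (λ q → χ ((+ 2 - + 2 * v) * + q + v))

    -- u = 2 - 1/q
    inner-sum : ∀ v → ΣG.Σ p (λ u → χ (+ u) ⊛ ψ (+ u) ⊛ (χ (+ 2 - + u * v) ⊛ ψ (+ 2 - + u))) ≡
                      D v ⊕ ⊖ χ v ⊕ ⊖ 𝟙
    inner-sum v = begin
      ΣG.Σ p (λ u → χ (+ u) ⊛ ψ (+ u) ⊛ f (+ u))
        ≡⟨ drop-zero f ⟩
      ΣG.Σ p (λ u → f (+ u)) ⊕ ⊖ f 0ℤ
        ≡⟨ ≡.cong₂ (λ s z → s ⊕ ⊖ z) (reindexG f f-cong σ τ σ-cong τ-cong στ τσ) f0≡𝟙 ⟩
      ΣG.Σ p (λ q → f (σ (+ q))) ⊕ ⊖ 𝟙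
        ≡⟨ ≡.cong (_⊕ ⊖ 𝟙) (ΣG.Σ-ext p (λ q → moebius (+ q))) ⟩
      ΣG.Σ p (λ q → χ (+ q) ⊛ ψ (+ q) ⊛ k (+ q)) ⊕ ⊖ 𝟙
        ≡⟨ ≡.cong (_⊕ ⊖ 𝟙) (drop-zero k) ⟩
      -- The two corrections come from u = 0, where f is χ(2) ψ(2) = 1, and from q = 0, where k is
      -- χ(v).
      D v ⊕ ⊖ k 0ℤ ⊕ ⊖ 𝟙
        ≡⟨ ≡.cong (λ z → D v ⊕ ⊖ z ⊕ ⊖ 𝟙) (χ-cong (≋-reflexive (at-zero v))) ⟩
      D v ⊕ ⊖ χ v ⊕ ⊖ 𝟙 ∎
      where
      open ≡.≡-Reasoning
      f k : ℤ → ℤ[i]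
      f u = χ (+ 2 - u * v) ⊛ ψ (+ 2 - u)
      k q = χ ((+ 2 - + 2 * v) * q + v)
      σ τ : ℤ → ℤ
      σ q = + 2 - inverse q
      τ u = inverse (+ 2 - u)
      f-cong : ∀ {a b} → a ≋ b → f a ≡ f b
      f-cong h = ≡.cong₂ _⊛_ (χ-cong (sub-cong (≋-refl {+ 2}) (*-congʳ v h))) (ψ-cong (sub-cong (≋-refl {+ 2}) h))
      σ-cong : ∀ {a b} → a ≋ b → σ a ≋ σ b
      σ-cong h = sub-cong (≋-refl {+ 2}) (inverse-cong h)
      τ-cong : ∀ {a b} → a ≋ b → τ a ≋ τ b
      τ-cong h = inverse-cong (sub-cong (≋-refl {+ 2}) h)
      twice : ∀ a → + 2 - (+ 2 - a) ≡ a
      twice = solve-∀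
      στ : ∀ a → σ (τ a) ≋ a
      στ a = ≋-trans (sub-cong (≋-refl {+ 2}) (inverse-involutive (+ 2 - a))) (≋-reflexive (twice a))
      τσ : ∀ a → τ (σ a) ≋ a
      τσ a = ≋-trans (inverse-cong (≋-reflexive (twice (inverse a)))) (inverse-involutive a)
      at-zero : ∀ v → (+ 2 - + 2 * v) * 0ℤ + v ≡ v
      at-zero = solve-∀
      2≢0 : ¬ + 2 ≋ 0ℤ
      2≢0 = small≢0 2 (s≤s z≤n) (ℕ.<-trans (s≤s (s≤s (s≤s z≤n))) 4<p)
      f0≡𝟙 : f 0ℤ ≡ 𝟙
      f0≡𝟙 = ≡.trans (≡.cong (_⊛ ψ (+ 2)) (χ-cong (≋-refl {+ 2}))) (χψ≡𝟙 2≢0)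
      -- Here ψ(2 - u) = ψ(1/q) = χ(q), which clears the denominator: (2 - u v) q = (2 - 2v) q + v.
      -- At q = 0 both sides are 0.
      moebius : ∀ q → f (σ q) ≡ χ q ⊛ ψ q ⊛ k q
      moebius q = ≡.trans (≡.cong (χ (+ 2 - σ q * v) ⊛_) last-factor) (combine (q ≋? 0ℤ))
        where
        last-factor : ψ (+ 2 - σ q) ≡ χ q
        last-factor = ≡.trans (ψ-cong (≋-reflexive (twice (inverse q))))
          (≡.trans (≡.sym (χ-inverse (inverse q))) (χ-cong (inverse-involutive q)))
        combine : Dec (q ≋ 0ℤ) → χ (+ 2 - σ q * v) ⊛ χ q ≡ χ q ⊛ ψ q ⊛ k q
        combine (yes q≋0) = ≡.trans (≡.cong (χ (+ 2 - σ q * v) ⊛_) (χ-zero q≋0))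
          (≡.trans (G.zeroʳ (χ (+ 2 - σ q * v))) (≡.sym (≡.trans (≡.cong (λ z → z ⊛ ψ q ⊛ k q) (χ-zero q≋0))
            (≡.trans (≡.cong (_⊛ k q) (G.zeroˡ (ψ q))) (G.zeroˡ (k q))))))
        combine (no q≢0) = begin
          χ (+ 2 - σ q * v) ⊛ χ q      ≡⟨ χ-* (+ 2 - σ q * v) q ⟨
          χ ((+ 2 - σ q * v) * q)      ≡⟨ χ-cong (linear v (*-inverse q≢0) (lem q (inverse q) v)) ⟩
          k q                          ≡⟨ G.*-identityˡ (k q) ⟨
          𝟙 ⊛ k q                      ≡⟨ ≡.cong (_⊛ k q) (χψ≡𝟙 q≢0) ⟨
          χ q ⊛ ψ q ⊛ k q              ∎
          where
          lem : ∀ q r v → (+ 2 - (+ 2 - r) * v) * q - ((+ 2 - + 2 * v) * q + v) ≡ v * (q * r - 1ℤ)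
          lem = solve-∀

    D-vanish : ∀ v → ¬ + 2 - + 2 * v ≋ 0ℤ → D v ≡ 𝟘
    D-vanish v c≢0 = ≡.trans (≡.sym (reindexG χ χ-cong σ τ σ-cong τ-cong στ τσ)) Σχ≡𝟘
      where
      c : ℤ
      c = + 2 - + 2 * v
      σ τ : ℤ → ℤ
      σ q = c * q + v
      τ a = inverse c * (a - v)
      σ-cong : ∀ {a b} → a ≋ b → σ a ≋ σ b
      σ-cong h = +-cong (*-congˡ c h) (≋-refl {v})
      τ-cong : ∀ {a b} → a ≋ b → τ a ≋ τ b
      τ-cong h = *-congˡ (inverse c) (sub-cong h (≋-refl {v}))
      στ : ∀ a → σ (τ a) ≋ a
      στ a = linear (a - v) (*-inverse c≢0) (lem c (inverse c) a v)
        where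
        lem : ∀ c d a v → c * (d * (a - v)) + v - a ≡ (a - v) * (c * d - 1ℤ)
        lem = solve-∀
      τσ : ∀ a → τ (σ a) ≋ a
      τσ a = linear a (*-inverse c≢0) (lem c (inverse c) a v)
        where
        lem : ∀ c d a v → d * (c * a + v - v) - a ≡ a * (c * d - 1ℤ)
        lem = solve-∀

    Σ𝟙 : ∀ k → ΣG.Σ k (λ _ → 𝟙) ≡ (+ k) +i 0ℤ
    Σ𝟙 zero    = ≡.refl
    Σ𝟙 (suc k) = ≡.trans (≡.cong (_⊕ 𝟙) (Σ𝟙 k)) (≡.cong (_+i 0ℤ) (≡.sym (pos-suc k)))

    -- Only v = 1 contributes: there the slope is 0 and each of the p terms of `D` is χ(1) = 1.
    ΣχD : ΣG.Σ p (λ v → χ (+ v) ⊛ D (+ v)) ≡ (+ p) +i 0ℤ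
    ΣχD = begin
      ΣG.Σ p F                                       ≡⟨ ≡.cong (λ k → ΣG.Σ k F) p≡2+q ⟩
      ΣG.Σ (suc (suc q)) F                           ≡⟨ ΣG.Σ-head (suc q) F ⟩
      F 0 ⊕ ΣG.Σ (suc q) (F ∘ suc)                   ≡⟨ ≡.cong (F 0 ⊕_) (ΣG.Σ-head q (F ∘ suc)) ⟩
      F 0 ⊕ (F 1 ⊕ ΣG.Σ q (λ k → F (suc (suc k))))   ≡⟨ ≡.cong₂ _⊕_ F0 (≡.cong₂ _⊕_ F1 (ΣG.Σ-zero q rest)) ⟩
      𝟘 ⊕ (((+ p) +i 0ℤ) ⊕ 𝟘)                        ≡⟨ G.+-identityˡ _ ⟩
      ((+ p) +i 0ℤ) ⊕ 𝟘                              ≡⟨ G.+-identityʳ _ ⟩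
      (+ p) +i 0ℤ                                    ∎
      where
      open ≡.≡-Reasoning
      F : ℕ → ℤ[i]
      F v = χ (+ v) ⊛ D (+ v)
      q : ℕ
      q = m ℕ.+ m ∸ 1
      p≡2+q : p ≡ suc (suc q)
      p≡2+q = ≡.trans p≡1+2m (≡.cong suc (≡.sym (ℕ.m+[n∸m]≡n (ℕ.≤-trans 0<m (ℕ.m≤m+n m m)))))
      F0 : F 0 ≡ 𝟘
      F0 = ≡.trans (≡.cong (_⊛ D 0ℤ) (χ-zero ≋-refl)) (G.zeroˡ (D 0ℤ))
      one : ∀ q → (+ 2 - + 2 * 1ℤ) * q + 1ℤ ≡ 1ℤ
      one = solve-∀
      F1 : F 1 ≡ (+ p) +i 0ℤ
      F1 = ≡.trans (≡.cong (_⊛ D 1ℤ) (χ1≡𝟙 ≋-refl)) (≡.trans (G.*-identityˡ (D 1ℤ))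
        (≡.trans (ΣG.Σ-ext p (λ q → χ1≡𝟙 (≋-reflexive (one (+ q))))) (Σ𝟙 p)))
      rest : ∀ k → k < q → F (suc (suc k)) ≡ 𝟘
      rest k k<q = ≡.trans (≡.cong (χ (+ suc (suc k)) ⊛_) (D-vanish (+ suc (suc k)) c≢0)) (G.zeroʳ (χ (+ suc (suc k))))
        where
        lem : ∀ k → + 2 - + 2 * (1ℤ + k) ≡ - + 2 * k
        lem = solve-∀
        2≢0 : ¬ - + 2 ≋ 0ℤ
        2≢0 h = small≢0 2 (s≤s z≤n) (ℕ.<-trans (s≤s (s≤s (s≤s z≤n))) 4<p) (neg-cong h)
        c≢0 : ¬ + 2 - + 2 * + suc (suc k) ≋ 0ℤ
        c≢0 h = *-nonzero 2≢0 (small≢0 (suc k) (s≤s z≤n)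
          (ℕ.<-trans (s≤s k<q) (ℕ.≤-reflexive (≡.sym p≡2+q))))
          (≋-trans (≋-reflexive (≡.sym (lem (+ suc k)))) h)

    -- Each term ψ(u) ψ(2 - u) of `J̄` rescales `J` by u. After exchanging the sums, `inner-sum`
    -- leaves χ D - χ² - χ to be summed over v, and the last two parts vanish.
    J⊛J̄ : J ⊛ J̄ ≡ (+ p) +i 0ℤ
    J⊛J̄ = begin
      J ⊛ J̄
        ≡⟨ ΣG.*-distribˡ-Σ p J (λ u → ψ (+ u) ⊛ ψ (+ 2 - + u)) ⟩
      ΣG.Σ p (λ u → J ⊛ (ψ (+ u) ⊛ ψ (+ 2 - + u)))
        ≡⟨ ΣG.Σ-ext p row ⟩
      ΣG.Σ p (λ u → ΣG.Σ p (λ v → entry u v))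
        ≡⟨ ΣG.Σ-comm p p entry ⟩
      ΣG.Σ p (λ v → ΣG.Σ p (λ u → entry u v))
        ≡⟨ ΣG.Σ-ext p column ⟩
      ΣG.Σ p (λ v → χ (+ v) ⊛ D (+ v) ⊕ (⊖ 𝟙 ⊛ (χ (+ v) ⊛ χ (+ v)) ⊕ ⊖ 𝟙 ⊛ χ (+ v)))
        ≡⟨ ΣG.Σ-distrib-+ p (λ v → χ (+ v) ⊛ D (+ v)) _ ⟩
      ΣG.Σ p (λ v → χ (+ v) ⊛ D (+ v)) ⊕ ΣG.Σ p (λ v → ⊖ 𝟙 ⊛ (χ (+ v) ⊛ χ (+ v)) ⊕ ⊖ 𝟙 ⊛ χ (+ v))
        ≡⟨ ≡.cong₂ _⊕_ ΣχD vanish ⟩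
      ((+ p) +i 0ℤ) ⊕ 𝟘
        ≡⟨ G.+-identityʳ _ ⟩
      (+ p) +i 0ℤ ∎
      where
      open ≡.≡-Reasoning
      entry : ℕ → ℕ → ℤ[i]
      entry u v = χ (+ v) ⊛ (χ (+ u) ⊛ ψ (+ u) ⊛ (χ (+ 2 - + u * + v) ⊛ ψ (+ 2 - + u)))

      shuffle : ∀ e w a b → e ⊛ w ⊛ (a ⊛ b) ≡ a ⊛ (e ⊛ (b ⊛ w))
      shuffle = ⊛-Solver.solve 4 (λ e w a b → (e ⊛-Solver.⊕ w) ⊛-Solver.⊕ (a ⊛-Solver.⊕ b) ⊛-Solver.⊜
        a ⊛-Solver.⊕ (e ⊛-Solver.⊕ (b ⊛-Solver.⊕ w))) ≡.refl

      row : ∀ u → J ⊛ (ψ (+ u) ⊛ ψ (+ 2 - + u)) ≡ ΣG.Σ p (λ v → entry u v)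
      row u = begin
        J ⊛ (ψ (+ u) ⊛ w)       ≡⟨ G.*-assoc J (ψ (+ u)) w ⟨
        J ⊛ ψ (+ u) ⊛ w         ≡⟨ ≡.cong (_⊛ w) (J-scale (+ u)) ⟩
        e ⊛ ΣG.Σ p T ⊛ w        ≡⟨ G.*-assoc e (ΣG.Σ p T) w ⟩
        e ⊛ (ΣG.Σ p T ⊛ w)      ≡⟨ ≡.cong (e ⊛_) (G.*-comm (ΣG.Σ p T) w) ⟩
        e ⊛ (w ⊛ ΣG.Σ p T)      ≡⟨ G.*-assoc e w (ΣG.Σ p T) ⟨
        e ⊛ w ⊛ ΣG.Σ p T        ≡⟨ ΣG.*-distribˡ-Σ p (e ⊛ w) T ⟩
        ΣG.Σ p (λ v → e ⊛ w ⊛ T v)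
          ≡⟨ ΣG.Σ-ext p (λ v → shuffle e w (χ (+ v)) (χ (+ 2 - + u * + v))) ⟩
        ΣG.Σ p (λ v → entry u v) ∎
        where
        e w : ℤ[i]
        e = χ (+ u) ⊛ ψ (+ u)
        w = ψ (+ 2 - + u)
        T : ℕ → ℤ[i]
        T v = χ (+ v) ⊛ χ (+ 2 - + u * + v)

      expand : ∀ x d → x ⊛ (d ⊕ ⊖ x ⊕ ⊖ 𝟙) ≡ x ⊛ d ⊕ (⊖ 𝟙 ⊛ (x ⊛ x) ⊕ ⊖ 𝟙 ⊛ x)
      expand (a +i b) (c +i d) = ≡.cong₂ _+i_ (lem₁ a b c d) (lem₂ a b c d)
        where
        lem₁ : ∀ a b c d → a * (c + - a + - 1ℤ) - b * (d + - b + 0ℤ) ≡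
          a * c - b * d + (- 1ℤ * (a * a - b * b) - 0ℤ * (a * b + b * a) + (- 1ℤ * a - 0ℤ * b))
        lem₁ = solve-∀
        lem₂ : ∀ a b c d → a * (d + - b + 0ℤ) + b * (c + - a + - 1ℤ) ≡
          a * d + b * c + (- 1ℤ * (a * b + b * a) + 0ℤ * (a * a - b * b) + (- 1ℤ * b + 0ℤ * a))
        lem₂ = solve-∀

      column : ∀ v → ΣG.Σ p (λ u → entry u v) ≡
        χ (+ v) ⊛ D (+ v) ⊕ (⊖ 𝟙 ⊛ (χ (+ v) ⊛ χ (+ v)) ⊕ ⊖ 𝟙 ⊛ χ (+ v))
      column v = ≡.trans (≡.sym (ΣG.*-distribˡ-Σ p (χ (+ v)) _))
        (≡.trans (≡.cong (χ (+ v) ⊛_) (inner-sum (+ v))) (expand (χ (+ v)) (D (+ v))))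

      vanish : ΣG.Σ p (λ v → ⊖ 𝟙 ⊛ (χ (+ v) ⊛ χ (+ v)) ⊕ ⊖ 𝟙 ⊛ χ (+ v)) ≡ 𝟘
      vanish = ≡.trans (ΣG.Σ-distrib-+ p (λ v → ⊖ 𝟙 ⊛ (χ (+ v) ⊛ χ (+ v))) (λ v → ⊖ 𝟙 ⊛ χ (+ v)))
        (≡.cong₂ _⊕_
          (≡.trans (≡.sym (ΣG.*-distribˡ-Σ p (⊖ 𝟙) (λ v → χ (+ v) ⊛ χ (+ v)))) (≡.cong (⊖ 𝟙 ⊛_) Σχ²≡𝟘))
          (≡.trans (≡.sym (ΣG.*-distribˡ-Σ p (⊖ 𝟙) (λ v → χ (+ v)))) (≡.cong (⊖ 𝟙 ⊛_) Σχ≡𝟘)))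

    conj-Σ : ∀ k (f : ℕ → ℤ[i]) → conj (ΣG.Σ k f) ≡ ΣG.Σ k (λ t → conj (f t))
    conj-Σ zero    f = ≡.refl
    conj-Σ (suc k) f = ≡.trans (conj-⊕ (ΣG.Σ k f) (f k)) (≡.cong (_⊕ conj (f k)) (conj-Σ k f))

    conj-J : conj J ≡ J̄
    conj-J = ≡.trans (conj-Σ p (λ r → χ (+ r) ⊛ χ (+ 2 - + r)))
      (ΣG.Σ-ext p (λ r → conj-⊛ (χ (+ r)) (χ (+ 2 - + r))))

    norm-J : re J * re J + im J * im J ≡ + p
    norm-J = ≡.trans (lem (re J) (im J)) (≡.cong re (≡.trans (≡.cong (J ⊛_) conj-J) J⊛J̄))
      where
      lem : ∀ a b → a * a + b * b ≡ a * a - b * - b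
      lem = solve-∀

  -- Values of the central binomial coefficients and of the Jacobi sum

  module CentralBinomial (p : ℕ) (pp : Prime p) (m : ℕ) (p≡1+2m : p ≡ suc (m ℕ.+ m)) where

    open Series p pp m p≡1+2m

    -- Factor by factor, m + k + 1 ≡ -(m - k), since the two sides differ by 2m + 1 = p.
    C-reflect : ∀ k → k < p → + ((m ℕ.+ k) C k) ≋ (- 1ℤ) ^ k * + (m C k)
    C-reflect zero    _     = ≋-refl
    C-reflect (suc k) 1+k<p = *-cancelˡ (+ suc k) (small≢0 (suc k) (s≤s z≤n) 1+k<p) (begin
      + suc k * + ((m ℕ.+ suc k) C suc k)
        ≡⟨ ≡.cong (λ i → + suc k * + (i C suc k)) (ℕ.+-suc m k) ⟩
      + suc k * + (suc (m ℕ.+ k) C suc k)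
        ≡⟨ ≡.sym (ℤ.pos-* (suc k) (suc (m ℕ.+ k) C suc k)) ⟩
      + (suc k ℕ.* (suc (m ℕ.+ k) C suc k))
        ≡⟨ ≡.cong +_ ([1+k]*[1+n]C[1+k]≡[1+n]*nCk (m ℕ.+ k) k) ⟩
      + (suc (m ℕ.+ k) ℕ.* ((m ℕ.+ k) C k))
        ≡⟨ ℤ.pos-* (suc (m ℕ.+ k)) ((m ℕ.+ k) C k) ⟩
      (1ℤ + (+ m + + k)) * + ((m ℕ.+ k) C k)
        ≈⟨ *-congˡ (1ℤ + (+ m + + k)) (C-reflect k (ℕ.<-trans (ℕ.n<1+n k) 1+k<p)) ⟩
      (1ℤ + (+ m + + k)) * (s * + (m C k))
        ≈⟨ linear (s * + (m C k)) 2m+1≋0 (lem (+ m) (+ k) s (+ (m C k))) ⟩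
      - 1ℤ * s * ((+ m - + k) * + (m C k))
        ≡⟨ ≡.cong (- 1ℤ * s *_) (C-lower-step m k) ⟨
      - 1ℤ * s * (+ suc k * + (m C suc k))
        ≡⟨ swap (- 1ℤ * s) (+ suc k) (+ (m C suc k)) ⟩
      + suc k * ((- 1ℤ) ^ suc k * + (m C suc k)) ∎)
      where
      open ≋-Reasoning
      s : ℤ
      s = (- 1ℤ) ^ k
      lem : ∀ m k s c → (1ℤ + (m + k)) * (s * c) - - 1ℤ * s * ((m - k) * c) ≡ s * c * (m + m + 1ℤ - 0ℤ)
      lem = solve-∀
      swap : ∀ a b c → a * (b * c) ≡ b * (a * c)
      swap = solve-∀

    -- The identity C(2k,k) = (-4)^k C(-1/2, k) read modulo p with m ≡ -1/2, proved by comparing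
    -- consecutive ratios.
    central≋ : ∀ k → k < p → + B k ≋ (- + 4) ^ k * + (m C k)
    central≋ zero    _     = ≋-refl
    central≋ (suc k) 1+k<p = *-cancelˡ (+ suc k) (small≢0 (suc k) (s≤s z≤n) 1+k<p) (begin
      + suc k * + B (suc k)
        ≡⟨ ≡.sym (ℤ.pos-* (suc k) (B (suc k))) ⟩
      + (suc k ℕ.* B (suc k))
        ≡⟨ ≡.cong +_ (B-step k) ⟩
      + (2 ℕ.* suc (k ℕ.+ k) ℕ.* B k)
        ≡⟨ ≡.trans (ℤ.pos-* (2 ℕ.* suc (k ℕ.+ k)) (B k)) (≡.cong (_* + B k) (ℤ.pos-* 2 (suc (k ℕ.+ k)))) ⟩
      + 2 * (1ℤ + (+ k + + k)) * + B k
        ≈⟨ *-congˡ (+ 2 * (1ℤ + (+ k + + k))) (central≋ k (ℕ.<-trans (ℕ.n<1+n k) 1+k<p)) ⟩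
      + 2 * (1ℤ + (+ k + + k)) * (s * + (m C k))
        ≈⟨ linear (+ 2 * (s * + (m C k))) 2m+1≋0 (lem (+ m) (+ k) s (+ (m C k))) ⟩
      - + 4 * s * ((+ m - + k) * + (m C k))
        ≡⟨ ≡.cong (- + 4 * s *_) (C-lower-step m k) ⟨
      - + 4 * s * (+ suc k * + (m C suc k))
        ≡⟨ swap (- + 4 * s) (+ suc k) (+ (m C suc k)) ⟩
      + suc k * ((- + 4) ^ suc k * + (m C suc k)) ∎)
      where
      open ≋-Reasoning
      s : ℤ
      s = (- + 4) ^ k
      lem : ∀ m k s c → + 2 * (1ℤ + (k + k)) * (s * c) - - + 4 * s * ((m - k) * c) ≡ + 2 * (s * c) * (m + m + 1ℤ - 0ℤ)
      lem = solve-∀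
      swap : ∀ a b c → a * (b * c) ≡ b * (a * c)
      swap = solve-∀

    m<p : m < p
    m<p = ℕ.≤-trans (s≤s (ℕ.m≤m+n m m)) (ℕ.≤-reflexive (≡.sym p≡1+2m))

    C≢0 : ∀ k → k ≤ m → ¬ + (m C k) ≋ 0ℤ
    C≢0 zero    _   = 1≢0
    C≢0 (suc k) k<m h = *-nonzero {+ m - + k} {+ (m C k)} m-k≢0 (C≢0 k (ℕ.<⇒≤ k<m))
      (≋-trans (≋-reflexive (≡.sym (C-lower-step m k)))
        (≋-trans (*-congˡ (+ suc k) h) (≋-reflexive (ℤ.*-zeroʳ (+ suc k)))))
      where
      m-k≢0 : ¬ + m - + k ≋ 0ℤ
      m-k≢0 e = small≢0 (m ∸ k) (ℕ.m<n⇒0<n∸m k<m) (ℕ.≤-<-trans (ℕ.m∸n≤m m k) m<p)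
        (≋-trans (≋-reflexive (≡.sym (≡.trans (ℤ.m-n≡m⊖n m k) (ℤ.⊖-≥ (ℕ.<⇒≤ k<m))))) e)

    private
      power-split : ∀ n → (- + 4) ^ n ≡ (- 1ℤ) ^ n * (+ 2) ^ (n ℕ.+ n)
      power-split n = ≡.trans (^-distribʳ-* (- 1ℤ) (+ 4) n)
        (≡.cong ((- 1ℤ) ^ n *_) (≡.trans (^-distribʳ-* (+ 2) (+ 2) n) (≡.sym (ℤ.^-distribˡ-+-* (+ 2) n n))))

    -1^n-square : ∀ n → (- 1ℤ) ^ n * (- 1ℤ) ^ n ≡ 1ℤ
    -1^n-square n = ≡.trans (≡.sym (^-distribʳ-* (- 1ℤ) (- 1ℤ) n)) (ℤ.^-zeroˡ n)

    sign-flip : ∀ n {a} → (- 1ℤ) ^ n * a ≋ 1ℤ → a ≋ (- 1ℤ) ^ n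
    sign-flip n {a} h = ≋-trans (≋-reflexive (≡.sym (≡.trans (≡.sym (ℤ.*-assoc ((- 1ℤ) ^ n) ((- 1ℤ) ^ n) a))
        (≡.trans (≡.cong (_* a) (-1^n-square n)) (ℤ.*-identityˡ a)))))
      (≋-trans (*-congˡ ((- 1ℤ) ^ n) h) (≋-reflexive (ℤ.*-identityʳ ((- 1ℤ) ^ n))))

    -- Modulo p, C(m, n) is C(2n, n) itself, or -2 C(2n, n) when m is odd; compare with central≋.
    2^m-even : ∀ n → m ≡ n ℕ.+ n → (+ 2) ^ m ≋ (- 1ℤ) ^ n
    2^m-even n m≡2n = sign-flip n (*-cancelˡ (+ (m C n)) (C≢0 n n≤m) (begin
      + (m C n) * ((- 1ℤ) ^ n * (+ 2) ^ m)          ≡⟨ ≡.cong (λ i → + (m C n) * ((- 1ℤ) ^ n * (+ 2) ^ i)) m≡2n ⟩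
      + (m C n) * ((- 1ℤ) ^ n * (+ 2) ^ (n ℕ.+ n))  ≡⟨ ≡.cong (+ (m C n) *_) (power-split n) ⟨
      + (m C n) * (- + 4) ^ n                       ≡⟨ ℤ.*-comm (+ (m C n)) ((- + 4) ^ n) ⟩
      (- + 4) ^ n * + (m C n)                       ≈⟨ central≋ n (ℕ.≤-<-trans n≤m m<p) ⟨
      + B n                                         ≡⟨ ≡.cong (λ i → + (i C n)) m≡2n ⟨
      + (m C n)                                     ≡⟨ ℤ.*-identityʳ (+ (m C n)) ⟨
      + (m C n) * 1ℤ ∎))
      where
      open ≋-Reasoning
      n≤m : n ≤ m
      n≤m = ℕ.≤-trans (ℕ.m≤m+n n n) (ℕ.≤-reflexive (≡.sym m≡2n))

    -- Here p = 4n + 3, so 4(n + 1) = p + 1.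
    4[n+1]≋1 : ∀ n → m ≡ suc (n ℕ.+ n) → + 4 * + suc n ≋ 1ℤ
    4[n+1]≋1 n m≡1+2n = linear 1ℤ p≋0 (≡.sym (≡.trans (≡.cong (λ i → 1ℤ * (+ i - 0ℤ))
      (≡.trans p≡1+2m (≡.cong (λ i → suc (i ℕ.+ i)) m≡1+2n))) (lem (+ n))))
      where
      lem : ∀ n → 1ℤ * (1ℤ + (1ℤ + (n + n) + (1ℤ + (n + n))) - 0ℤ) ≡ + 4 * (1ℤ + n) - 1ℤ
      lem = solve-∀

    -- From (n + 1) C(m, n) = m C(2n, n), with 4(n + 1) ≡ 1 and 4m ≡ -2.
    odd-central : ∀ n → m ≡ suc (n ℕ.+ n) → + (m C n) ≋ - + 2 * + B n
    odd-central n m≡1+2n = begin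
      + (m C n)                                ≡⟨ ℤ.*-identityˡ (+ (m C n)) ⟨
      1ℤ * + (m C n)                           ≈⟨ *-congʳ (+ (m C n)) (4[n+1]≋1 n m≡1+2n) ⟨
      + 4 * + suc n * + (m C n)                ≡⟨ ℤ.*-assoc (+ 4) (+ suc n) (+ (m C n)) ⟩
      + 4 * (+ suc n * + (m C n))              ≡⟨ ≡.cong (+ 4 *_) absorb ⟩
      + 4 * (+ m * + B n)                      ≈⟨ linear (+ 2 * + B n) 2m+1≋0 (lem (+ m) (+ B n)) ⟩
      - + 2 * + B n                            ∎
      where
      open ≋-Reasoning
      absorb : + suc n * + (m C n) ≡ + m * + B n
      absorb = ≡.trans (≡.cong (λ i → + suc n * + (i C n)) m≡1+2n)
        (≡.trans (≡.sym (ℤ.pos-* (suc n) (suc (n ℕ.+ n) C n)))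
        (≡.trans (≡.cong +_ ([1+k]*[1+2k]Ck≡[1+2k]*[2k]Ck n))
        (≡.trans (ℤ.pos-* (suc (n ℕ.+ n)) (B n)) (≡.cong (λ i → + i * + B n) (≡.sym m≡1+2n)))))
      lem : ∀ m b → + 4 * (m * b) - - + 2 * b ≡ + 2 * b * (m + m + 1ℤ - 0ℤ)
      lem = solve-∀

    2^m-odd : ∀ n → m ≡ suc (n ℕ.+ n) → (+ 2) ^ m ≋ (- 1ℤ) ^ suc n
    2^m-odd n m≡1+2n = sign-flip (suc n) (*-cancelˡ (+ (m C n)) (C≢0 n n≤m) (begin
      + (m C n) * ((- 1ℤ) ^ suc n * (+ 2) ^ m)
        ≡⟨ ≡.cong (λ i → + (m C n) * ((- 1ℤ) ^ suc n * (+ 2) ^ i)) m≡1+2n ⟩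
      + (m C n) * ((- 1ℤ) ^ suc n * (+ 2) ^ suc (n ℕ.+ n))
        ≡⟨ regroup (+ (m C n)) ((- 1ℤ) ^ n) ((+ 2) ^ (n ℕ.+ n)) ⟩
      - + 2 * ((- 1ℤ) ^ n * (+ 2) ^ (n ℕ.+ n) * + (m C n))
        ≡⟨ ≡.cong (λ z → - + 2 * (z * + (m C n))) (power-split n) ⟨
      - + 2 * ((- + 4) ^ n * + (m C n))
        ≈⟨ *-congˡ (- + 2) (central≋ n (ℕ.≤-<-trans n≤m m<p)) ⟨
      - + 2 * + B n
        ≈⟨ odd-central n m≡1+2n ⟨
      + (m C n)
        ≡⟨ ℤ.*-identityʳ (+ (m C n)) ⟨
      + (m C n) * 1ℤ ∎))
      where
      open ≋-Reasoning
      n≤m : n ≤ m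
      n≤m = ℕ.≤-trans (ℕ.m≤n⇒m≤1+n (ℕ.m≤m+n n n)) (ℕ.≤-reflexive (≡.sym m≡1+2n))
      regroup : ∀ c s t → c * (- 1ℤ * s * (+ 2 * t)) ≡ - + 2 * (s * t * c)
      regroup = solve-∀

  module JacobiValue (p : ℕ) (pp : Prime p) (m : ℕ) (p≡1+2m : p ≡ suc (m ℕ.+ m))
    (n : ℕ) (m≡2n : m ≡ n ℕ.+ n) (ι : ℤ) (ι²≋-1 : Congruence._≋_ p (ι * ι) (- 1ℤ)) where

    open Series p pp m p≡1+2m
    open CentralBinomial p pp m p≡1+2m
    open QuarticCharacter p pp m p≡1+2m n m≡2n ι ι²≋-1
    open JacobiSum p pp m p≡1+2m n m≡2n ι ι²≋-1 public
    open Reindexing ℤ[i]-ring using () renaming (reindex to reindexG)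

    ev-Σ : ∀ k (f : ℕ → ℤ[i]) → ev (ΣG.Σ k f) ≋ Σ k (λ t → ev (f t))
    ev-Σ zero    f = ≋-reflexive (lem ι)
      where
      lem : ∀ ι → 0ℤ + 0ℤ * ι ≡ 0ℤ
      lem = solve-∀
    ev-Σ (suc k) f = ≋-trans (≋-reflexive (ev-⊕ (ΣG.Σ k f) (f k))) (+-cong (ev-Σ k f) (≋-refl {ev (f k)}))

    -- With r = 1 + t, r (2 - r) = -(t² - 1).
    symmetric-sum : ∀ N → Σ p (λ r → (+ r) ^ N * (+ 2 - + r) ^ N) ≋ (- 1ℤ) ^ N * W₂.W 0 N
    symmetric-sum N = begin
      Σ p (λ r → f (+ r))
        ≈⟨ reindex f f-cong (λ t → 1ℤ + t) (λ r → r - 1ℤ) (+-cong (≋-refl {1ℤ})) (λ h → sub-cong h (≋-refl {1ℤ}))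
             (λ a → ≋-reflexive (lem₁ a)) (λ a → ≋-reflexive (lem₂ a)) ⟩
      Σ p (λ t → f (1ℤ + + t))
        ≈⟨ Σ-ext p (λ t → ≋-reflexive (term (+ t))) ⟩
      Σ p (λ t → (- 1ℤ) ^ N * ((+ t) ^ 0 * ((+ t) ^ 2 + - 1ℤ) ^ N))
        ≈⟨ *-distribˡ-Σ p ((- 1ℤ) ^ N) (λ t → (+ t) ^ 0 * ((+ t) ^ 2 + - 1ℤ) ^ N) ⟨
      (- 1ℤ) ^ N * W₂.W 0 N ∎
      where
      open ≋-Reasoning
      f : ℤ → ℤ
      f r = r ^ N * (+ 2 - r) ^ N
      f-cong : ∀ {a b} → a ≋ b → f a ≋ f b
      f-cong h = *-cong (^-cong N h) (^-cong N (sub-cong (≋-refl {+ 2}) h))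
      lem₁ : ∀ a → 1ℤ + (a - 1ℤ) ≡ a
      lem₁ = solve-∀
      lem₂ : ∀ a → 1ℤ + a - 1ℤ ≡ a
      lem₂ = solve-∀
      factor : ∀ t → (1ℤ + t) * (+ 2 - (1ℤ + t)) ≡ - 1ℤ * (t * (t * 1ℤ) + - 1ℤ)
      factor = solve-∀
      term : ∀ t → f (1ℤ + t) ≡ (- 1ℤ) ^ N * (1ℤ * (t ^ 2 + - 1ℤ) ^ N)
      term t = ≡.trans (≡.sym (^-distribʳ-* (1ℤ + t) (+ 2 - (1ℤ + t)) N))
        (≡.trans (≡.cong (_^ N) (factor t)) (≡.trans (^-distribʳ-* (- 1ℤ) (t ^ 2 + - 1ℤ) N)
          (≡.cong ((- 1ℤ) ^ N *_) (≡.sym (ℤ.*-identityˡ ((t ^ 2 + - 1ℤ) ^ N))))))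

    n<m : n < m
    n<m = ≡.subst (n <_) (≡.sym m≡2n) (ℕ.m<m+n n 0<n)

    -- Modulo p the terms of J form a polynomial in r of degree 2n = m, below p - 1, so the sum
    -- vanishes.
    ev-J : ev J ≋ 0ℤ
    ev-J = begin
      ev J
        ≈⟨ ev-Σ p (λ r → χ (+ r) ⊛ χ (+ 2 - + r)) ⟩
      Σ p (λ r → ev (χ (+ r) ⊛ χ (+ 2 - + r)))
        ≈⟨ Σ-ext p (λ r → ≋-trans (ev-⊛ (χ (+ r)) (χ (+ 2 - + r))) (*-cong (ev-χ (+ r)) (ev-χ (+ 2 - + r)))) ⟩
      Σ p (λ r → (+ r) ^ n * (+ 2 - + r) ^ n)
        ≈⟨ symmetric-sum n ⟩
      (- 1ℤ) ^ n * W₂.W 0 n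
        ≈⟨ *-congˡ ((- 1ℤ) ^ n) (W₂.W-coefficient n 0 m degree (2k≡k+k m)) ⟩
      (- 1ℤ) ^ n * - (+ (n C m) * (- 1ℤ) ^ (n ∸ m))
        ≡⟨ ≡.cong (λ c → (- 1ℤ) ^ n * - (+ c * (- 1ℤ) ^ (n ∸ m))) (k>n⇒nCk≡0 n<m) ⟩
      (- 1ℤ) ^ n * 0ℤ
        ≡⟨ ℤ.*-zeroʳ ((- 1ℤ) ^ n) ⟩
      0ℤ ∎
      where
      open ≋-Reasoning
      degree : 2 ℕ.* n < (m ℕ.+ m) ℕ.+ (m ℕ.+ m)
      degree = ≡.subst (_< (m ℕ.+ m) ℕ.+ (m ℕ.+ m)) (≡.sym (2k≡k+k n))
        (ℕ.≤-trans (ℕ.+-mono-<-≤ n<m (ℕ.<⇒≤ n<m)) (ℕ.m≤m+n (m ℕ.+ m) (m ℕ.+ m)))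

    ev-ψ : ∀ a → ev (ψ a) ≋ a ^ (m ℕ.+ n)
    ev-ψ a = begin
      ev (conj (χ a))                    ≡⟨ ≡.cong ev (quartic-conj (proj₁ (code a))) ⟩
      ev (χ a ⊛ (χ a ⊛ χ a))             ≈⟨ ev-⊛ (χ a) (χ a ⊛ χ a) ⟩
      ev (χ a) * ev (χ a ⊛ χ a)          ≈⟨ *-congˡ (ev (χ a)) (ev-⊛ (χ a) (χ a)) ⟩
      ev (χ a) * (ev (χ a) * ev (χ a))   ≈⟨ *-cong (ev-χ a) (*-cong (ev-χ a) (ev-χ a)) ⟩
      a ^ n * (a ^ n * a ^ n)            ≡⟨ ℤ.*-comm (a ^ n) (a ^ n * a ^ n) ⟩
      a ^ n * a ^ n * a ^ n              ≡⟨ ≡.cong (_* a ^ n) (ℤ.^-distribˡ-+-* a n n) ⟨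
      a ^ (n ℕ.+ n) * a ^ n              ≡⟨ ≡.cong (λ i → a ^ i * a ^ n) m≡2n ⟨
      a ^ m * a ^ n                      ≡⟨ ℤ.^-distribˡ-+-* a m n ⟨
      a ^ (m ℕ.+ n)                      ∎
      where open ≋-Reasoning

    -- Conjugation replaces the exponent n by 3n = m + n, and now t^(p-1) does occur in (t² -
    -- 1)^(3n). The signs cancel to -C(3n, n), which `C-reflect` brings back to C(m, n).
    ev-conj-J : ev (conj J) ≋ - ((- 1ℤ) ^ n * + (m C n))
    ev-conj-J = begin
      ev (conj J)
        ≡⟨ ≡.cong ev conj-J ⟩
      ev J̄
        ≈⟨ ev-Σ p (λ r → ψ (+ r) ⊛ ψ (+ 2 - + r)) ⟩
      Σ p (λ r → ev (ψ (+ r) ⊛ ψ (+ 2 - + r)))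
        ≈⟨ Σ-ext p (λ r → ≋-trans (ev-⊛ (ψ (+ r)) (ψ (+ 2 - + r))) (*-cong (ev-ψ (+ r)) (ev-ψ (+ 2 - + r)))) ⟩
      Σ p (λ r → (+ r) ^ (m ℕ.+ n) * (+ 2 - + r) ^ (m ℕ.+ n))
        ≈⟨ symmetric-sum (m ℕ.+ n) ⟩
      (- 1ℤ) ^ (m ℕ.+ n) * W₂.W 0 (m ℕ.+ n)
        ≈⟨ *-congˡ ((- 1ℤ) ^ (m ℕ.+ n)) (W₂.W-coefficient (m ℕ.+ n) 0 m degree (2k≡k+k m)) ⟩
      (- 1ℤ) ^ (m ℕ.+ n) * - (+ ((m ℕ.+ n) C m) * (- 1ℤ) ^ (m ℕ.+ n ∸ m))
        ≡⟨ ≡.cong₂ (λ c e → (- 1ℤ) ^ (m ℕ.+ n) * - (+ c * (- 1ℤ) ^ e)) flip (ℕ.m+n∸m≡n m n) ⟩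
      (- 1ℤ) ^ (m ℕ.+ n) * - (+ ((m ℕ.+ n) C n) * (- 1ℤ) ^ n)
        ≡⟨ ≡.cong (λ s → s * - (+ ((m ℕ.+ n) C n) * (- 1ℤ) ^ n)) sign ⟩
      (- 1ℤ) ^ n * - (+ ((m ℕ.+ n) C n) * (- 1ℤ) ^ n)
        ≡⟨ regroup ((- 1ℤ) ^ n) (+ ((m ℕ.+ n) C n)) ⟩
      (- 1ℤ) ^ n * (- 1ℤ) ^ n * - + ((m ℕ.+ n) C n)
        ≡⟨ ≡.trans (≡.cong (_* - + ((m ℕ.+ n) C n)) (-1^n-square n)) (ℤ.*-identityˡ (- + ((m ℕ.+ n) C n))) ⟩
      - + ((m ℕ.+ n) C n)
        ≈⟨ neg-cong (C-reflect n (ℕ.<-trans n<m m<p)) ⟩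
      - ((- 1ℤ) ^ n * + (m C n)) ∎
      where
      open ≋-Reasoning
      regroup : ∀ s c → s * - (c * s) ≡ s * s * - c
      regroup = solve-∀
      flip : (m ℕ.+ n) C m ≡ (m ℕ.+ n) C n
      flip = ≡.trans (nCk≡nC[n∸k] (ℕ.m≤m+n m n)) (≡.cong ((m ℕ.+ n) C_) (ℕ.m+n∸m≡n m n))
      sign : (- 1ℤ) ^ (m ℕ.+ n) ≡ (- 1ℤ) ^ n
      sign = ≡.trans (ℤ.^-distribˡ-+-* (- 1ℤ) m n) (≡.trans (≡.cong (_* (- 1ℤ) ^ n)
        (≡.trans (≡.cong ((- 1ℤ) ^_) m≡2n) (≡.trans (ℤ.^-distribˡ-+-* (- 1ℤ) n n) (-1^n-square n))))
        (ℤ.*-identityˡ ((- 1ℤ) ^ n)))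
      degree : 2 ℕ.* (m ℕ.+ n) < (m ℕ.+ m) ℕ.+ (m ℕ.+ m)
      degree = ≡.subst (_< (m ℕ.+ m) ℕ.+ (m ℕ.+ m)) (≡.sym (2k≡k+k (m ℕ.+ n)))
        (ℕ.+-mono-<-≤ (ℕ.+-monoʳ-< m n<m) (ℕ.+-monoʳ-≤ m (ℕ.<⇒≤ n<m)))

    2reJ≋ : re J + re J ≋ - ((- 1ℤ) ^ n * + (m C n))
    2reJ≋ = begin
      re J + re J            ≡⟨ lem (re J) (im J) ι ⟩
      ev J + ev (conj J)     ≈⟨ +-cong ev-J ev-conj-J ⟩
      0ℤ + - ((- 1ℤ) ^ n * + (m C n))  ≡⟨ ℤ.+-identityˡ _ ⟩
      - ((- 1ℤ) ^ n * + (m C n)) ∎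
      where
      open ≋-Reasoning
      lem : ∀ a b ι → a + a ≡ a + b * ι + (a + - b * ι)
      lem = solve-∀

    private
      h : ℤ → ℤ[i]
      h t = χ (1ℤ + t) ⊛ χ (+ 2 - (1ℤ + t))

      h-cong : ∀ {a b} → a ≋ b → h a ≡ h b
      h-cong e = ≡.cong₂ _⊛_ (χ-cong (+-cong (≋-refl {1ℤ}) e))
        (χ-cong (sub-cong (≋-refl {+ 2}) (+-cong (≋-refl {1ℤ}) e)))

      h-even : ∀ t → h (- t) ≡ h t
      h-even t = ≡.trans (≡.cong₂ (λ a b → χ a ⊛ χ b) (lem₁ t) (lem₂ t)) (G.*-comm (χ (+ 2 - (1ℤ + t))) (χ (1ℤ + t)))
        where
        lem₁ : ∀ t → 1ℤ + - t ≡ + 2 - (1ℤ + t)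
        lem₁ = solve-∀
        lem₂ : ∀ t → + 2 - (1ℤ + - t) ≡ 1ℤ + t
        lem₂ = solve-∀

      half : ℤ[i]
      half = ΣG.Σ m (λ k → h (+ suc k))

    -- Pairing t = r - 1 with -t leaves t = 0 alone, where the term is χ(1)² = 1.
    J-fold : J ≡ 𝟙 ⊕ (half ⊕ half)
    J-fold = begin
      J
        ≡⟨ reindexG f (λ e → ≡.cong₂ _⊛_ (χ-cong e) (χ-cong (sub-cong (≋-refl {+ 2}) e)))
             (λ t → 1ℤ + t) (λ r → r - 1ℤ) (+-cong (≋-refl {1ℤ})) (λ e → sub-cong e (≋-refl {1ℤ}))
             (λ a → ≋-reflexive (lem₁ a)) (λ a → ≋-reflexive (lem₂ a)) ⟩
      ΣG.Σ p (λ t → h (+ t))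
        ≡⟨ ≡.cong (λ k → ΣG.Σ k (λ t → h (+ t))) p≡1+2m ⟩
      ΣG.Σ (suc (m ℕ.+ m)) (λ t → h (+ t))
        ≡⟨ ΣG.Σ-head (m ℕ.+ m) (λ t → h (+ t)) ⟩
      h 0ℤ ⊕ ΣG.Σ (m ℕ.+ m) (λ t → h (+ suc t))
        ≡⟨ ≡.cong₂ _⊕_ h0 (ΣG.Σ-split m m (λ t → h (+ suc t))) ⟩
      𝟙 ⊕ (half ⊕ ΣG.Σ m (λ k → h (+ suc (k ℕ.+ m))))
        ≡⟨ ≡.cong (λ z → 𝟙 ⊕ (half ⊕ z)) (ΣG.Σ-reverse m (λ k → h (+ suc (k ℕ.+ m)))) ⟩
      𝟙 ⊕ (half ⊕ ΣG.Σ m (λ k → h (+ suc (m ∸ suc k ℕ.+ m))))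
        ≡⟨ ≡.cong (λ z → 𝟙 ⊕ (half ⊕ z)) (ΣG.Σ-cong m reflect) ⟩
      𝟙 ⊕ (half ⊕ half) ∎
      where
      open ≡.≡-Reasoning
      f : ℤ → ℤ[i]
      f r = χ r ⊛ χ (+ 2 - r)
      lem₁ : ∀ a → 1ℤ + (a - 1ℤ) ≡ a
      lem₁ = solve-∀
      lem₂ : ∀ a → 1ℤ + a - 1ℤ ≡ a
      lem₂ = solve-∀
      h0 : h 0ℤ ≡ 𝟙
      h0 = ≡.cong₂ _⊛_ (χ1≡𝟙 (≋-refl {1ℤ})) (χ1≡𝟙 (≋-refl {1ℤ}))
      -- The index on the left is p - (k + 1), hence congruent to -(k + 1).
      reflect : ∀ k → k < m → h (+ suc (m ∸ suc k ℕ.+ m)) ≡ h (+ suc k)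
      reflect k k<m = ≡.trans (h-cong {+ suc (m ∸ suc k ℕ.+ m)} { - + suc k} (linear 1ℤ p≋0 (≡.trans (lem (+ suc (m ∸ suc k ℕ.+ m)) (+ suc k))
        (≡.cong (λ i → 1ℤ * (+ i - 0ℤ)) total)))) (h-even (+ suc k))
        where
        lem : ∀ a b → a - - b ≡ 1ℤ * (a + b - 0ℤ)
        lem = solve-∀
        total : suc (m ∸ suc k ℕ.+ m) ℕ.+ suc k ≡ p
        total = ≡.trans (lemℕ (m ∸ suc k) m (suc k)) (≡.trans (≡.cong (λ i → suc (i ℕ.+ m)) (ℕ.m∸n+n≡m k<m)) (≡.sym p≡1+2m))
          where
          lemℕ : ∀ a b c → suc (a ℕ.+ b) ℕ.+ c ≡ suc (a ℕ.+ c ℕ.+ b)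
          lemℕ = ℕ-Solver.solve-∀

    odd-Σ : ∀ k (f : ℕ → ℤ[i]) → (∀ t → t < k → ∃ λ c → re (f t) + im (f t) ≡ 1ℤ + + 2 * c) →
            ∃ λ c → re (ΣG.Σ k f) + im (ΣG.Σ k f) ≡ + k + + 2 * c
    odd-Σ zero    f odd = 0ℤ , ≡.refl
    odd-Σ (suc k) f odd with odd-Σ k f (λ t t<k → odd t (ℕ.m<n⇒m<1+n t<k)) | odd k (ℕ.n<1+n k)
    ... | c , eq | d , eq′ = c + d , ≡.trans (swap (re (ΣG.Σ k f)) (im (ΣG.Σ k f)) (re (f k)) (im (f k)))
      (≡.trans (≡.cong₂ _+_ eq eq′) (lem (+ k) c d))
      where
      swap : ∀ a b c d → a + c + (b + d) ≡ a + b + (c + d)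
      swap = solve-∀
      lem : ∀ k c d → k + + 2 * c + (1ℤ + + 2 * d) ≡ 1ℤ + k + + 2 * (c + d)
      lem = solve-∀

    χ-odd : ∀ a → ¬ a ≋ 0ℤ → ∃ λ c → re (χ a) + im (χ a) ≡ 1ℤ + + 2 * c
    χ-odd a a≢0 with quartic-odd (proj₁ (code a))
    ... | inj₁ eq        = ⊥-elim (χ≢𝟘 a≢0 eq)
    ... | inj₂ (inj₁ eq) = 0ℤ , eq
    ... | inj₂ (inj₂ eq) = - 1ℤ , eq

    -- The term at t = 1 contains χ(0) = 0. The other m - 1 terms are units, whose coordinates have
    -- an odd sum.
    half-odd : ∃ λ c → re half + im half ≡ + m - 1ℤ + + 2 * c
    half-odd = c , ≡.trans (≡.cong (λ z → re z + im z) half≡) (≡.trans eq (≡.cong (_+ + 2 * c) q≡m-1))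
      where
      q : ℕ
      q = m ∸ 1
      m≡1+q : m ≡ suc q
      m≡1+q = ≡.sym (ℕ.m+[n∸m]≡n 0<m)
      q≡m-1 : + q ≡ + m - 1ℤ
      q≡m-1 = ≡.trans (lem (+ q)) (≡.cong (λ i → + i - 1ℤ) (≡.sym m≡1+q))
        where
        lem : ∀ q → q ≡ 1ℤ + q - 1ℤ
        lem = solve-∀
      h1 : h 1ℤ ≡ 𝟘
      h1 = ≡.trans (≡.cong (χ (+ 2) ⊛_) (χ-zero (≋-refl {0ℤ}))) (G.zeroʳ (χ (+ 2)))
      half≡ : half ≡ ΣG.Σ q (λ k → h (+ suc (suc k)))
      half≡ = ≡.trans (≡.cong (λ i → ΣG.Σ i (λ k → h (+ suc k))) m≡1+q)
        (≡.trans (ΣG.Σ-head q (λ k → h (+ suc k))) (≡.trans (≡.cong (_⊕ ΣG.Σ q (λ k → h (+ suc (suc k)))) h1)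
          (G.+-identityˡ (ΣG.Σ q (λ k → h (+ suc (suc k)))))))
      term : ∀ k → k < q → ∃ λ c → re (h (+ suc (suc k))) + im (h (+ suc (suc k))) ≡ 1ℤ + + 2 * c
      term k k<q = ≡.subst (λ z → ∃ λ c → re z + im z ≡ 1ℤ + + 2 * c) (χ-* (+ (3 ℕ.+ k)) (+ 2 - + (3 ℕ.+ k)))
        (χ-odd (+ (3 ℕ.+ k) * (+ 2 - + (3 ℕ.+ k))) (*-nonzero
          (small≢0 (3 ℕ.+ k) (s≤s z≤n) (ℕ.≤-trans (s≤s (s≤s k+2≤m)) 1+m<p))
          (λ e → small≢0 (suc k) (s≤s z≤n) (ℕ.≤-trans (s≤s (ℕ.≤-trans (ℕ.n≤1+n (suc k)) k+2≤m)) m<p)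
            (linear (- 1ℤ) e (lem (+ k))))))
        where
        k+2≤m : suc (suc k) ≤ m
        k+2≤m = ≡.subst (suc (suc k) ≤_) (≡.sym m≡1+q) (s≤s k<q)
        1+m<p : suc (suc m) ≤ p
        1+m<p = ≡.subst (suc (suc m) ≤_) (≡.sym p≡1+2m) (s≤s (ℕ.m<m+n m 0<m))
        lem : ∀ k → 1ℤ + k - 0ℤ ≡ - 1ℤ * (+ 2 - (+ 3 + k) - 0ℤ)
        lem = solve-∀
      odd = odd-Σ q (λ k → h (+ suc (suc k))) term
      c : ℤ
      c = proj₁ odd
      eq : re (ΣG.Σ q (λ k → h (+ suc (suc k)))) + im (ΣG.Σ q (λ k → h (+ suc (suc k)))) ≡ + q + + 2 * c
      eq = proj₂ odd

    imJ-even : ∃ λ t → im J ≡ + 2 * t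
    imJ-even = im half , ≡.trans (≡.cong im J-fold) (lem (im half))
      where
      lem : ∀ x → 0ℤ + (x + x) ≡ + 2 * x
      lem = solve-∀

    -- J = 1 + 2 `half`, and the coordinate sum of `half` is odd because m = 2n. Together with
    -- `imJ-even` this says J ≡ -1 modulo 2 + 2i, a condition that distinguishes J from its other
    -- associates.
    J-mod-4 : ∃ λ c → re J + im J ≡ + 4 * c - 1ℤ
    J-mod-4 = + n + c , ≡.trans (≡.cong (λ z → re z + im z) J-fold)
      (≡.trans (lem₁ (re half) (im half)) (≡.trans (≡.cong (λ z → 1ℤ + + 2 * z) (proj₂ half-odd))
        (≡.trans (≡.cong (λ i → 1ℤ + + 2 * (+ i - 1ℤ + + 2 * c)) m≡2n) (lem₂ (+ n) c))))
      where
      c : ℤ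
      c = proj₁ half-odd
      lem₁ : ∀ a b → 1ℤ + (a + a) + (0ℤ + (b + b)) ≡ 1ℤ + + 2 * (a + b)
      lem₁ = solve-∀
      lem₂ : ∀ n c → 1ℤ + + 2 * (n + n - 1ℤ + + 2 * c) ≡ + 4 * (n + c) - 1ℤ
      lem₂ = solve-∀

  -- Gauss's congruence

  2z≢1 : ∀ z → + 2 * z ≢ 1ℤ
  2z≢1 z eq = ℕ.even≢odd ∣ z ∣ 0 (≡.trans (≡.sym (ℤ.abs-* (+ 2) z)) (≡.cong ∣_∣ eq))

  unit-norm : ∀ g q → g * g + q * q ≡ 1ℤ →
    g ≡ 0ℤ × (q ≡ 1ℤ ⊎ q ≡ - 1ℤ) ⊎ q ≡ 0ℤ × (g ≡ 1ℤ ⊎ g ≡ - 1ℤ)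
  unit-norm (+ 0) (+ 0) ()
  unit-norm (+ 0) (+ 1) _ = inj₁ (≡.refl , inj₁ ≡.refl)
  unit-norm (+ 0) (+ suc (suc q)) ()
  unit-norm (+ 0) -[1+ 0 ] _ = inj₁ (≡.refl , inj₂ ≡.refl)
  unit-norm (+ 0) -[1+ suc q ] ()
  unit-norm (+ 1) (+ 0) _ = inj₂ (≡.refl , inj₁ ≡.refl)
  unit-norm (+ 1) +[1+ q ] ()
  unit-norm (+ 1) -[1+ q ] ()
  unit-norm (+ suc (suc g)) (+ 0) ()
  unit-norm (+ suc (suc g)) +[1+ q ] ()
  unit-norm (+ suc (suc g)) -[1+ q ] ()
  unit-norm -[1+ 0 ] (+ 0) _ = inj₂ (≡.refl , inj₂ ≡.refl)
  unit-norm -[1+ 0 ] +[1+ q ] ()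
  unit-norm -[1+ 0 ] -[1+ q ] ()
  unit-norm -[1+ suc g ] (+ 0) ()
  unit-norm -[1+ suc g ] +[1+ q ] ()
  unit-norm -[1+ suc g ] -[1+ q ] ()

  even-or-odd : ∀ n → ∃ λ k → n ≡ k ℕ.+ k ⊎ n ≡ suc (k ℕ.+ k)
  even-or-odd zero    = 0 , inj₁ ≡.refl
  even-or-odd (suc n) with even-or-odd n
  ... | k , inj₁ eq = k , inj₂ (≡.cong suc eq)
  ... | k , inj₂ eq = suc k , inj₁ (≡.cong suc (≡.trans eq (≡.sym (ℕ.+-suc k k))))

  -- The sign relating two representations of 4n + 1 as a sum of an odd and an even square, the first
  -- normalised by x ≡ 1 and the second by a + b ≡ -1 (mod 4).
  rotation-sign : ∀ n x′ y′ a b g q c t → g * g + q * q ≡ 1ℤ →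
    a ≡ (1ℤ + + 4 * x′) * g + + 2 * y′ * q → b ≡ + 2 * y′ * g - (1ℤ + + 4 * x′) * q →
    a + b ≡ + 4 * c - 1ℤ → b ≡ + 2 * t →
    + 4 * + n + 1ℤ ≡ (1ℤ + + 4 * x′) * (1ℤ + + 4 * x′) + + 2 * y′ * (+ 2 * y′) →
    a ≡ - ((- 1ℤ) ^ n * (1ℤ + + 4 * x′))
  -- The formulas for a and b say a + ib = (x + iy) (g - iq) with a unit g - iq. If g = 0, then b =
  -- ±x is odd, against b = 2t.
  rotation-sign n x′ y′ a b g q c t unit a≡ b≡ a+b≡ b≡2t norm≡ = case (unit-norm g q unit)
    where
    -- Modulo 2 this reads n ≡ y′. The congruence for a + b determines the parity of y′ from g, and
    -- so relates g to (-1)^n.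
    N≡ : + n ≡ + 2 * x′ + + 4 * (x′ * x′) + y′ * y′
    N≡ = ℤ.*-cancelˡ-≡ (+ 4) (+ n) (+ 2 * x′ + + 4 * (x′ * x′) + y′ * y′) (≡.trans (lem₁ (+ n)) (≡.trans (≡.cong (_- 1ℤ) norm≡) (lem₂ x′ y′)))
      where
      lem₁ : ∀ n → + 4 * n ≡ + 4 * n + 1ℤ - 1ℤ
      lem₁ = solve-∀
      lem₂ : ∀ x y → (1ℤ + + 4 * x) * (1ℤ + + 4 * x) + + 2 * y * (+ 2 * y) - 1ℤ ≡ + 4 * (+ 2 * x + + 4 * (x * x) + y * y)
      lem₂ = solve-∀

    contradiction₁ : g ≡ 0ℤ → q ≡ 1ℤ → ⊥
    contradiction₁ ≡.refl ≡.refl = 2z≢1 (- t - + 2 * x′) (≡.trans (lem₁ t x′) (≡.trans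
      (≡.cong (λ z → - z - + 4 * x′) (≡.trans (≡.sym b≡2t) b≡)) (lem₂ x′ y′)))
      where
      lem₁ : ∀ t x → + 2 * (- t - + 2 * x) ≡ - (+ 2 * t) - + 4 * x
      lem₁ = solve-∀
      lem₂ : ∀ x y → - (+ 2 * y * 0ℤ - (1ℤ + + 4 * x) * 1ℤ) - + 4 * x ≡ 1ℤ
      lem₂ = solve-∀

    contradiction₂ : g ≡ 0ℤ → q ≡ - 1ℤ → ⊥
    contradiction₂ ≡.refl ≡.refl = 2z≢1 (t - + 2 * x′) (≡.trans (lem₁ t x′) (≡.trans
      (≡.cong (λ z → z - + 4 * x′) (≡.trans (≡.sym b≡2t) b≡)) (lem₂ x′ y′)))
      where
      lem₁ : ∀ t x → + 2 * (t - + 2 * x) ≡ + 2 * t - + 4 * x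
      lem₁ = solve-∀
      lem₂ : ∀ x y → + 2 * y * 0ℤ - (1ℤ + + 4 * x) * - 1ℤ - + 4 * x ≡ 1ℤ
      lem₂ = solve-∀

    sum≡ : ∀ {g′} → g ≡ g′ → q ≡ 0ℤ → g′ * (1ℤ + + 4 * x′ + + 2 * y′) ≡ + 4 * c - 1ℤ
    sum≡ {g′} ≡.refl ≡.refl = ≡.trans (lem x′ y′ g) (≡.trans (≡.sym (≡.cong₂ _+_ a≡ b≡)) a+b≡)
      where
      lem : ∀ x y g → g * (1ℤ + + 4 * x + + 2 * y) ≡
        (1ℤ + + 4 * x) * g + + 2 * y * 0ℤ + (+ 2 * y * g - (1ℤ + + 4 * x) * 0ℤ)
      lem = solve-∀

    a≡gx : q ≡ 0ℤ → a ≡ g * (1ℤ + + 4 * x′)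
    a≡gx ≡.refl = ≡.trans a≡ (lem (1ℤ + + 4 * x′) (+ 2 * y′) g)
      where
      lem : ∀ x y g → x * g + y * 0ℤ ≡ g * x
      lem = solve-∀

    -1^even : ∀ k → (- 1ℤ) ^ (k ℕ.+ k) ≡ 1ℤ
    -1^even k = ≡.trans (ℤ.^-distribˡ-+-* (- 1ℤ) k k)
      (≡.trans (≡.sym (^-distribʳ-* (- 1ℤ) (- 1ℤ) k)) (ℤ.^-zeroˡ k))

    g≡1 : q ≡ 0ℤ → g ≡ 1ℤ → ∀ k → n ≡ k ℕ.+ k ⊎ n ≡ suc (k ℕ.+ k) → - (- 1ℤ) ^ n ≡ 1ℤ
    g≡1 q≡0 g≡1 k (inj₂ ≡.refl) = ≡.trans (≡.cong (λ s → - (- 1ℤ * s)) (-1^even k)) ≡.refl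
    -- For g = 1, y′ = 2w - 1 is odd; inserted in `N≡` with n = 2k this yields an integer whose
    -- double is 1.
    g≡1 q≡0 g≡1 k (inj₁ ≡.refl) = ⊥-elim (2z≢1 (+ k - x′ - + 2 * (x′ * x′) - + 2 * w * w + + 2 * w)
      (≡.trans (lem₁ (+ k) x′ w) (≡.trans (≡.cong (λ z → z - + 2 * x′ - + 4 * (x′ * x′) - + 4 * w * w + + 4 * w) N≡)
        (≡.trans (≡.cong (λ z → + 2 * x′ + + 4 * (x′ * x′) + z * z - + 2 * x′ - + 4 * (x′ * x′) - + 4 * w * w + + 4 * w) y≡)
          (lem₂ x′ w)))))
      where
      w : ℤ
      w = c - x′
      y≡ : y′ ≡ + 2 * w - 1ℤ
      y≡ = ℤ.*-cancelˡ-≡ (+ 2) y′ (+ 2 * w - 1ℤ) (≡.trans (lem x′ y′) (≡.trans (≡.cong (λ z → z - 1ℤ - + 4 * x′) (sum≡ g≡1 q≡0)) (lem′ c x′)))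
        where
        lem : ∀ x y → + 2 * y ≡ 1ℤ * (1ℤ + + 4 * x + + 2 * y) - 1ℤ - + 4 * x
        lem = solve-∀
        lem′ : ∀ c x → + 4 * c - 1ℤ - 1ℤ - + 4 * x ≡ + 2 * (+ 2 * (c - x) - 1ℤ)
        lem′ = solve-∀
      lem₁ : ∀ k x w → + 2 * (k - x - + 2 * (x * x) - + 2 * w * w + + 2 * w) ≡
        k + k - + 2 * x - + 4 * (x * x) - + 4 * w * w + + 4 * w
      lem₁ = solve-∀
      lem₂ : ∀ x w → + 2 * x + + 4 * (x * x) + (+ 2 * w - 1ℤ) * (+ 2 * w - 1ℤ) - + 2 * x - + 4 * (x * x) - + 4 * w * w + + 4 * w ≡ 1ℤ
      lem₂ = solve-∀

    g≡-1 : q ≡ 0ℤ → g ≡ - 1ℤ → ∀ k → n ≡ k ℕ.+ k ⊎ n ≡ suc (k ℕ.+ k) → - (- 1ℤ) ^ n ≡ - 1ℤ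
    g≡-1 q≡0 g≡-1 k (inj₁ ≡.refl) = ≡.cong -_ (-1^even k)
    g≡-1 q≡0 g≡-1 k (inj₂ ≡.refl) = ⊥-elim (2z≢1 (x′ + + 2 * (x′ * x′) + + 2 * w * w - + k)
      (≡.trans (lem₁ (+ k) x′ w) (≡.trans (≡.cong (λ z → + 2 * x′ + + 4 * (x′ * x′) + z * z + 1ℤ - (1ℤ + (+ k + + k))) (≡.sym y≡))
        (≡.trans (≡.cong (λ z → z + 1ℤ - (1ℤ + (+ k + + k))) (≡.sym N≡)) (lem₂ (+ k))))))
      where
      w : ℤ
      w = - c - x′
      y≡ : y′ ≡ + 2 * w
      y≡ = ℤ.*-cancelˡ-≡ (+ 2) y′ (+ 2 * w) (≡.trans (lem x′ y′) (≡.trans (≡.cong (λ z → - z - 1ℤ - + 4 * x′) (sum≡ g≡-1 q≡0)) (lem′ c x′)))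
        where
        lem : ∀ x y → + 2 * y ≡ - (- 1ℤ * (1ℤ + + 4 * x + + 2 * y)) - 1ℤ - + 4 * x
        lem = solve-∀
        lem′ : ∀ c x → - (+ 4 * c - 1ℤ) - 1ℤ - + 4 * x ≡ + 2 * (+ 2 * (- c - x))
        lem′ = solve-∀
      lem₁ : ∀ k x w → + 2 * (x + + 2 * (x * x) + + 2 * w * w - k) ≡
        + 2 * x + + 4 * (x * x) + + 2 * w * (+ 2 * w) + 1ℤ - (1ℤ + (k + k))
      lem₁ = solve-∀
      lem₂ : ∀ k → 1ℤ + (k + k) + 1ℤ - (1ℤ + (k + k)) ≡ 1ℤ
      lem₂ = solve-∀

    parity = even-or-odd n

    finish : ∀ {g′} → g ≡ g′ → q ≡ 0ℤ → - (- 1ℤ) ^ n ≡ g′ → a ≡ - ((- 1ℤ) ^ n * (1ℤ + + 4 * x′))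
    finish g≡ q≡0 s≡ = ≡.trans (a≡gx q≡0) (≡.trans (≡.cong (_* (1ℤ + + 4 * x′)) (≡.trans g≡ (≡.sym s≡)))
      (≡.sym (ℤ.neg-distribˡ-* ((- 1ℤ) ^ n) (1ℤ + + 4 * x′))))

    case : g ≡ 0ℤ × (q ≡ 1ℤ ⊎ q ≡ - 1ℤ) ⊎ q ≡ 0ℤ × (g ≡ 1ℤ ⊎ g ≡ - 1ℤ) → a ≡ - ((- 1ℤ) ^ n * (1ℤ + + 4 * x′))
    case (inj₁ (g≡0 , inj₁ q≡))  = ⊥-elim (contradiction₁ g≡0 q≡)
    case (inj₁ (g≡0 , inj₂ q≡))  = ⊥-elim (contradiction₂ g≡0 q≡)
    case (inj₂ (q≡0 , inj₁ g≡))  = finish g≡ q≡0 (g≡1 q≡0 g≡ (proj₁ parity) (proj₂ parity))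
    case (inj₂ (q≡0 , inj₂ g≡)) = finish g≡ q≡0 (g≡-1 q≡0 g≡ (proj₁ parity) (proj₂ parity))

  module Gauss (p : ℕ) (pp : Prime p) (m : ℕ) (p≡1+2m : p ≡ suc (m ℕ.+ m))
    (n : ℕ) (m≡2n : m ≡ n ℕ.+ n) (x′ y′ : ℤ)
    (p≡x²+y² : + p ≡ (1ℤ + + 4 * x′) * (1ℤ + + 4 * x′) + + 2 * y′ * (+ 2 * y′)) where

    open Series p pp m p≡1+2m

    private
      x y : ℤ
      x = 1ℤ + + 4 * x′
      y = + 2 * y′

      instance _ = prime⇒nonZero pp

    x²+y²≋0 : x * x + y * y ≋ 0ℤ
    x²+y²≋0 = ≋-trans (≋-reflexive (≡.sym p≡x²+y²)) p≋0

    -- If p divided y, it would divide x too, and then p² would divide x² + y² = p.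
    y≢0 : ¬ y ≋ 0ℤ
    y≢0 y≋0 = divide x≋0 y≋0
      where
      lem : ∀ x y → x * x - 0ℤ ≡ 1ℤ * (x * x + y * y - y * y)
      lem = solve-∀
      x≋0 : x ≋ 0ℤ
      x≋0 = Sum.fromInj₁ id (integral x x (linear 1ℤ (≋-trans x²+y²≋0 (≋-sym (*-cong y≋0 y≋0))) (lem x y)))
      divide : x ≋ 0ℤ → y ≋ 0ℤ → ⊥
      divide (quot s x≡) (quot t y≡) = 1≢0 (quot (s * s + t * t) (ℤ.*-cancelˡ-≡ (+ p) 1ℤ (0ℤ + (s * s + t * t) * + p)
        (≡.trans (ℤ.*-identityʳ (+ p)) (≡.trans p≡x²+y² (≡.trans (≡.cong₂ (λ a b → a * a + b * b) x≡ y≡) (lem′ s t (+ p)))))))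
        where
        lem′ : ∀ s t P → (0ℤ + s * P) * (0ℤ + s * P) + (0ℤ + t * P) * (0ℤ + t * P) ≡ P * (0ℤ + (s * s + t * t) * P)
        lem′ = solve-∀

    -- The residue -x/y, chosen among the two square roots of -1 so that `ev` sends x + iy to 0.
    ι : ℤ
    ι = - (x * inverse y)

    x+yι≋0 : x + y * ι ≋ 0ℤ
    x+yι≋0 = linear (- x) (*-inverse y≢0) (lem x y (inverse y))
      where
      lem : ∀ x y z → x + y * - (x * z) - 0ℤ ≡ - x * (y * z - 1ℤ)
      lem = solve-∀

    ι²≋-1 : ι * ι ≋ - 1ℤ
    ι²≋-1 = *-cancelˡ (y * y) (*-nonzero y≢0 y≢0) (begin
      y * y * (ι * ι)      ≡⟨ lem₁ y ι ⟩
      (y * ι) * (y * ι)    ≈⟨ *-cong yι≋-x yι≋-x ⟩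
      - x * - x            ≈⟨ linear 1ℤ x²+y²≋0 (lem₂ x y) ⟩
      y * y * - 1ℤ         ∎)
      where
      open ≋-Reasoning
      lem₀ : ∀ x z → z - - x ≡ 1ℤ * (x + z - 0ℤ)
      lem₀ = solve-∀
      yι≋-x : y * ι ≋ - x
      yι≋-x = linear 1ℤ x+yι≋0 (lem₀ x (y * ι))
      lem₁ : ∀ y i → y * y * (i * i) ≡ (y * i) * (y * i)
      lem₁ = solve-∀
      lem₂ : ∀ x y → - x * - x - y * y * - 1ℤ ≡ 1ℤ * (x * x + y * y - 0ℤ)
      lem₂ = solve-∀

    open JacobiValue p pp m p≡1+2m n m≡2n ι ι²≋-1
    open CentralBinomial p pp m p≡1+2m using (-1^n-square)

    private
      a b : ℤ
      a = re J
      b = im J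

    -- J and x + iy both lie in the kernel of `ev`, so their coordinates are proportional modulo p.
    ay-bx≋0 : a * y - b * x ≋ 0ℤ
    ay-bx≋0 = ≋-trans (≋-reflexive (lem a b x y ι))
      (≋-trans (sub-cong (*-congˡ y ev-J) (*-congˡ b x+yι≋0)) (≋-reflexive (lem′ y b)))
      where
      lem : ∀ a b x y ι → a * y - b * x ≡ y * (a + b * ι) - b * (x + y * ι)
      lem = solve-∀
      lem′ : ∀ y b → y * 0ℤ - b * 0ℤ ≡ 0ℤ
      lem′ = solve-∀

    -- Both ay - bx and, by (ax + by)² + (ay - bx)² = p², also ax + by are divisible by p.
    ax+by≋0 : a * x + b * y ≋ 0ℤ
    ax+by≋0 = Sum.fromInj₁ id (integral (a * x + b * y) (a * x + b * y)
      (≋-trans (≋-reflexive (lem a b x y)) (≋-trans (sub-cong (*-congˡ (a * a + b * b) x²+y²≋0) (*-cong ay-bx≋0 ay-bx≋0))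
        (≋-reflexive (lem′ (a * a + b * b))))))
      where
      lem : ∀ a b x y → (a * x + b * y) * (a * x + b * y) ≡
        (a * a + b * b) * (x * x + y * y) - (a * y - b * x) * (a * y - b * x)
      lem = solve-∀
      lem′ : ∀ z → z * 0ℤ - 0ℤ * 0ℤ ≡ 0ℤ
      lem′ = solve-∀

    -- The two quotients by p form g - iq = J (x - iy) / p. It has norm p · p / p² = 1, and J = (x +
    -- iy) (g - iq).
    reJ≡ : re J ≡ - ((- 1ℤ) ^ n * x)
    reJ≡ = go ax+by≋0 ay-bx≋0
      where
      4n+1≡p : + 4 * + n + 1ℤ ≡ x * x + y * y
      4n+1≡p = ≡.trans (lem (+ n)) (≡.trans (≡.cong +_ (≡.sym (≡.trans p≡1+2m (≡.cong (λ i → suc (i ℕ.+ i)) m≡2n)))) p≡x²+y²)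
        where
        lem : ∀ n → + 4 * n + 1ℤ ≡ 1ℤ + (n + n + (n + n))
        lem = solve-∀
      go : a * x + b * y ≋ 0ℤ → a * y - b * x ≋ 0ℤ → a ≡ - ((- 1ℤ) ^ n * x)
      go (quot g f≡) (quot q e≡) = rotation-sign n x′ y′ a b g q (proj₁ J-mod-4) (proj₁ imJ-even)
        unit a≡ b≡ (proj₂ J-mod-4) (proj₂ imJ-even) 4n+1≡p
        where
        P : ℤ
        P = + p
        unit : g * g + q * q ≡ 1ℤ
        unit = ℤ.*-cancelˡ-≡ P (g * g + q * q) 1ℤ (ℤ.*-cancelˡ-≡ P (P * (g * g + q * q)) (P * 1ℤ) (≡.trans (lem₁ P g q)
          (≡.trans (≡.cong₂ (λ f e → f * f + e * e) (≡.sym f≡) (≡.sym e≡))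
          (≡.trans (lem₂ a b x y) (≡.trans (≡.cong₂ _*_ norm-J (≡.sym p≡x²+y²)) (lem₃ P))))))
          where
          lem₁ : ∀ P g q → P * (P * (g * g + q * q)) ≡ (0ℤ + g * P) * (0ℤ + g * P) + (0ℤ + q * P) * (0ℤ + q * P)
          lem₁ = solve-∀
          lem₂ : ∀ a b x y → (a * x + b * y) * (a * x + b * y) + (a * y - b * x) * (a * y - b * x) ≡
            (a * a + b * b) * (x * x + y * y)
          lem₂ = solve-∀
          lem₃ : ∀ P → P * P ≡ P * (P * 1ℤ)
          lem₃ = solve-∀
        a≡ : a ≡ x * g + y * q
        a≡ = ℤ.*-cancelˡ-≡ P a (x * g + y * q) (≡.trans (≡.cong (_* a) p≡x²+y²) (≡.trans (lem a b x y)
          (≡.trans (≡.cong₂ (λ f e → x * f + y * e) f≡ e≡) (lem′ x y g q P))))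
          where
          lem : ∀ a b x y → (x * x + y * y) * a ≡ x * (a * x + b * y) + y * (a * y - b * x)
          lem = solve-∀
          lem′ : ∀ x y g q P → x * (0ℤ + g * P) + y * (0ℤ + q * P) ≡ P * (x * g + y * q)
          lem′ = solve-∀
        b≡ : b ≡ y * g - x * q
        b≡ = ℤ.*-cancelˡ-≡ P b (y * g - x * q) (≡.trans (≡.cong (_* b) p≡x²+y²) (≡.trans (lem a b x y)
          (≡.trans (≡.cong₂ (λ f e → y * f - x * e) f≡ e≡) (lem′ x y g q P))))
          where
          lem : ∀ a b x y → (x * x + y * y) * b ≡ y * (a * x + b * y) - x * (a * y - b * x)
          lem = solve-∀
          lem′ : ∀ x y g q P → y * (0ℤ + g * P) - x * (0ℤ + q * P) ≡ P * (y * g - x * q)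
          lem′ = solve-∀

    -- The sign (-1)^n occurs both in `2reJ≋` and in the exact value `reJ≡`, and cancels.
    gauss : + (m C n) ≋ + 2 * x
    gauss = begin
      + (m C n)
        ≡⟨ lem₁ (+ (m C n)) ⟩
      1ℤ * + (m C n)
        ≡⟨ ≡.cong (_* + (m C n)) (-1^n-square n) ⟨
      s * s * + (m C n)
        ≡⟨ lem₂ s (+ (m C n)) ⟩
      - s * - (s * + (m C n))
        ≈⟨ *-congˡ (- s) 2reJ≋ ⟨
      - s * (re J + re J)
        ≡⟨ ≡.cong (λ z → - s * (z + z)) reJ≡ ⟩
      - s * (- (s * x) + - (s * x))
        ≡⟨ lem₃ s x ⟩
      s * s * (+ 2 * x)
        ≡⟨ ≡.cong (_* (+ 2 * x)) (-1^n-square n) ⟩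
      1ℤ * (+ 2 * x)
        ≡⟨ ℤ.*-identityˡ (+ 2 * x) ⟩
      + 2 * x ∎
      where
      open ≋-Reasoning
      s : ℤ
      s = (- 1ℤ) ^ n
      lem₁ : ∀ c → c ≡ 1ℤ * c
      lem₁ = solve-∀
      lem₂ : ∀ s c → s * s * c ≡ - s * - (s * c)
      lem₂ = solve-∀
      lem₃ : ∀ s x → - s * (- (s * x) + - (s * x)) ≡ s * s * (+ 2 * x)
      lem₃ = solve-∀

  -- Evaluation of the first sum modulo p

  module Evaluation (p : ℕ) (pp : Prime p) (m : ℕ) (p≡1+2m : p ≡ suc (m ℕ.+ m)) (3<p : 3 < p) where

    open Series p pp m p≡1+2m public
    open CentralBinomial p pp m p≡1+2m

    2≢0 : ¬ + 2 ≋ 0ℤ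
    2≢0 = small≢0 2 (s≤s z≤n) (ℕ.<-trans (ℕ.n<1+n 2) 3<p)

    3≢0 : ¬ + 3 ≋ 0ℤ
    3≢0 = small≢0 3 (s≤s z≤n) 3<p

    6≢0 : ¬ + 6 ≋ 0ℤ
    6≢0 = *-nonzero 2≢0 3≢0

    72≢0 : ¬ + 72 ≋ 0ℤ
    72≢0 = *-nonzero 2≢0 (*-nonzero 6≢0 6≢0)

    1/72 : ℤ
    1/72 = inverse (+ 72)

    S : ℤ
    S = Σ p (λ k → + k * + A k * 1/72 ^ k)

    private
      r : ℤ
      r = inverse (+ 3)

      r^m≋3^m : r ^ m ≋ (+ 3) ^ m
      r^m≋3^m = begin
        r ^ m                              ≡⟨ ℤ.*-identityˡ (r ^ m) ⟨
        1ℤ * r ^ m                         ≈⟨ *-congʳ (r ^ m) (fermat′ 3≢0) ⟨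
        (+ 3) ^ (m ℕ.+ m) * r ^ m          ≡⟨ ≡.cong (_* r ^ m) (ℤ.^-distribˡ-+-* (+ 3) m m) ⟩
        (+ 3) ^ m * (+ 3) ^ m * r ^ m      ≡⟨ ℤ.*-assoc ((+ 3) ^ m) ((+ 3) ^ m) (r ^ m) ⟩
        (+ 3) ^ m * ((+ 3) ^ m * r ^ m)    ≡⟨ ≡.cong ((+ 3) ^ m *_) (^-distribʳ-* (+ 3) r m) ⟨
        (+ 3) ^ m * (+ 3 * r) ^ m          ≈⟨ *-congˡ ((+ 3) ^ m) (^-cong m (*-inverse 3≢0)) ⟩
        (+ 3) ^ m * 1ℤ ^ m                 ≡⟨ ≡.cong ((+ 3) ^ m *_) (ℤ.^-zeroˡ m) ⟩
        (+ 3) ^ m * 1ℤ                     ≡⟨ ℤ.*-identityʳ ((+ 3) ^ m) ⟩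
        (+ 3) ^ m                          ∎
        where open ≋-Reasoning

    S≋ : ∀ M → m ≡ suc M → S ≋ (+ 3) ^ m * (W₂.W m M - W₂.W M M)
    S≋ M m≡1+M = ≋-trans (series-value M m≡1+M r (*-inverse 3≢0) 1/72 (*-inverse 72≢0))
      (*-congʳ (W₂.W m M - W₂.W M M) r^m≋3^m)

    private
      degree : ∀ M → m ≡ suc M → ∀ e → e ≤ m → e ℕ.+ 2 ℕ.* M < (m ℕ.+ m) ℕ.+ (m ℕ.+ m)
      degree M m≡1+M e e≤m = ℕ.+-mono-≤-< (ℕ.≤-trans e≤m (ℕ.m≤m+n m m))
        (≡.subst (_< m ℕ.+ m) (≡.sym (2k≡k+k M)) (ℕ.+-mono-<-≤ M<m (ℕ.<⇒≤ M<m)))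
        where
        M<m : M < m
        M<m = ℕ.≤-reflexive (≡.sym m≡1+M)

      odd+even≢even : ∀ k j → suc (k ℕ.+ k) ℕ.+ 2 ℕ.* j ≢ m ℕ.+ m
      odd+even≢even k j eq = ℕ.even≢odd m (k ℕ.+ j) (≡.trans (2k≡k+k m) (≡.trans (≡.sym eq) (lem k j)))
        where
        lem : ∀ k j → suc (k ℕ.+ k) ℕ.+ 2 ℕ.* j ≡ suc (2 ℕ.* (k ℕ.+ j))
        lem = ℕ-Solver.solve-∀

    -- M = m - 1 is odd, so `W₂.W M M` vanishes by parity. The other sum has its coefficient at j =
    -- n, namely ±C(2n - 1, n), half of ±C(2n, n); the sign is 2^m and joins 3^m to give 6^m.
    2S-even : ∀ n → m ≡ n ℕ.+ n → + 2 * S ≋ (+ 6) ^ m * + (m C n)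
    2S-even zero    m≡0  = ⊥-elim (ℕ.<⇒≢ 0<m (≡.sym m≡0))
    2S-even (suc k) m≡2n = begin
      + 2 * S
        ≈⟨ *-congˡ (+ 2) (S≋ M m≡1+M) ⟩
      + 2 * ((+ 3) ^ m * (W₂.W m M - W₂.W M M))
        ≈⟨ *-congˡ (+ 2) (*-congˡ ((+ 3) ^ m) (sub-cong
             (W₂.W-coefficient M m (suc k) (degree M m≡1+M m ℕ.≤-refl) total)
             (W₂.W-vanish M M (degree M m≡1+M M M≤m) (odd+even≢even k)))) ⟩
      + 2 * ((+ 3) ^ m * (- (+ (M C suc k) * (- 1ℤ) ^ (M ∸ suc k)) - 0ℤ))
        ≡⟨ ≡.cong (λ e → + 2 * ((+ 3) ^ m * (- (+ (M C suc k) * (- 1ℤ) ^ e) - 0ℤ))) (ℕ.m+n∸m≡n k k) ⟩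
      + 2 * ((+ 3) ^ m * (- (+ (M C suc k) * (- 1ℤ) ^ k) - 0ℤ))
        ≡⟨ regroup ((+ 3) ^ m) (+ (M C suc k)) ((- 1ℤ) ^ k) ⟩
      (- 1ℤ) ^ suc k * (+ 3) ^ m * (+ 2 * + (M C suc k))
        ≡⟨ ≡.cong ((- 1ℤ) ^ suc k * (+ 3) ^ m *_) double ⟩
      (- 1ℤ) ^ suc k * (+ 3) ^ m * + (m C suc k)
        ≈⟨ *-congʳ (+ (m C suc k)) (*-congʳ ((+ 3) ^ m) (2^m-even (suc k) m≡2n)) ⟨
      (+ 2) ^ m * (+ 3) ^ m * + (m C suc k)
        ≡⟨ ≡.cong (_* + (m C suc k)) (^-distribʳ-* (+ 2) (+ 3) m) ⟨
      (+ 6) ^ m * + (m C suc k) ∎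
      where
      open ≋-Reasoning
      M : ℕ
      M = suc (k ℕ.+ k)
      m≡1+M : m ≡ suc M
      m≡1+M = ≡.trans m≡2n (≡.cong suc (ℕ.+-suc k k))
      M≤m : M ≤ m
      M≤m = ℕ.≤-trans (ℕ.n≤1+n M) (ℕ.≤-reflexive (≡.sym m≡1+M))
      total : m ℕ.+ 2 ℕ.* suc k ≡ m ℕ.+ m
      total = ≡.cong (m ℕ.+_) (≡.trans (2k≡k+k (suc k)) (≡.sym m≡2n))
      regroup : ∀ a c s → + 2 * (a * (- (c * s) - 0ℤ)) ≡ - 1ℤ * s * a * (+ 2 * c)
      regroup = solve-∀
      double : + 2 * + (M C suc k) ≡ + (m C suc k)
      double = ≡.trans (≡.sym (ℤ.pos-* 2 (M C suc k))) (≡.cong +_ (≡.trans (≡.cong (2 ℕ.*_) (≡.sym ([1+2k]C[k]≡[1+2k]C[1+k] k)))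
        (≡.trans (≡.sym ([2+2k]C[1+k]≡2*[1+2k]Ck k)) (≡.cong (_C suc k) (≡.sym m≡1+M)))))

    -- Now M = 2n is even and only `W₂.W M M` survives, giving C(2n, n + 1). Modulo p this is -3
    -- C(2n, n), whereas C(m + 1, n + 1) = 2 C(m, n) is -4 C(2n, n): hence the factor 3/4 of the
    -- theorem.
    4S-odd : ∀ n → m ≡ suc (n ℕ.+ n) → + 4 * S ≋ + 3 * (+ 6) ^ m * + (suc m C suc n)
    4S-odd zero    m≡1    = ⊥-elim (ℕ.<⇒≢ 3<p (≡.sym (≡.trans p≡1+2m (≡.cong (λ i → suc (i ℕ.+ i)) m≡1))))
    4S-odd (suc k) m≡1+2n = begin
      + 4 * S
        ≈⟨ *-congˡ (+ 4) (S≋ M m≡1+2n) ⟩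
      + 4 * ((+ 3) ^ m * (W₂.W m M - W₂.W M M))
        ≈⟨ *-congˡ (+ 4) (*-congˡ ((+ 3) ^ m) (sub-cong
             (W₂.W-vanish M m (degree M m≡1+2n m ℕ.≤-refl) (≡.subst (λ i → ∀ j → i ℕ.+ 2 ℕ.* j ≢ m ℕ.+ m) (≡.sym m≡1+2n) (odd+even≢even n)))
             (W₂.W-coefficient M M (suc n) (degree M m≡1+2n M M≤m) total))) ⟩
      + 4 * ((+ 3) ^ m * (0ℤ - - (+ (M C suc n) * (- 1ℤ) ^ (M ∸ suc n))))
        ≡⟨ ≡.cong (λ e → + 4 * ((+ 3) ^ m * (0ℤ - - (+ (M C suc n) * (- 1ℤ) ^ e)))) M∸1+n≡k ⟩
      + 4 * ((+ 3) ^ m * (0ℤ - - (+ (M C suc n) * (- 1ℤ) ^ k)))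
        ≡⟨ regroup₁ ((+ 3) ^ m) (+ (M C suc n)) ((- 1ℤ) ^ k) ⟩
      + 4 * (+ 3) ^ m * (- 1ℤ) ^ k * + (M C suc n)
        ≈⟨ *-congˡ (+ 4 * (+ 3) ^ m * (- 1ℤ) ^ k) off-central ⟩
      + 4 * (+ 3) ^ m * (- 1ℤ) ^ k * (- + 3 * + B n)
        ≡⟨ regroup₂ ((+ 3) ^ m) ((- 1ℤ) ^ k) (+ B n) ⟩
      + 3 * ((- 1ℤ) ^ suc n * (+ 3) ^ m) * (+ 2 * (- + 2 * + B n))
        ≈⟨ *-cong (*-congˡ (+ 3) (*-congʳ ((+ 3) ^ m) (2^m-odd n m≡1+2n))) (*-congˡ (+ 2) (odd-central n m≡1+2n)) ⟨
      + 3 * ((+ 2) ^ m * (+ 3) ^ m) * (+ 2 * + (m C n))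
        ≡⟨ ≡.cong₂ (λ x y → + 3 * x * y) (^-distribʳ-* (+ 2) (+ 3) m) double ⟨
      + 3 * (+ 6) ^ m * + (suc m C suc n) ∎
      where
      open ≋-Reasoning
      n M : ℕ
      n = suc k
      M = n ℕ.+ n
      M≤m : M ≤ m
      M≤m = ℕ.≤-trans (ℕ.n≤1+n M) (ℕ.≤-reflexive (≡.sym m≡1+2n))
      total : M ℕ.+ 2 ℕ.* suc n ≡ m ℕ.+ m
      total = ≡.trans (lem n) (≡.cong (λ i → i ℕ.+ i) (≡.sym m≡1+2n))
        where
        lem : ∀ n → n ℕ.+ n ℕ.+ 2 ℕ.* suc n ≡ suc (n ℕ.+ n) ℕ.+ suc (n ℕ.+ n)
        lem = ℕ-Solver.solve-∀
      M∸1+n≡k : M ∸ suc n ≡ k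
      M∸1+n≡k = ≡.trans (≡.cong (_∸ suc n) (≡.cong suc (ℕ.+-suc k k))) (ℕ.m+n∸m≡n k k)
      regroup₁ : ∀ a c s → + 4 * (a * (0ℤ - - (c * s))) ≡ + 4 * a * s * c
      regroup₁ = solve-∀
      regroup₂ : ∀ a s b → + 4 * a * s * (- + 3 * b) ≡ + 3 * (- 1ℤ * (- 1ℤ * s) * a) * (+ 2 * (- + 2 * b))
      regroup₂ = solve-∀
      double : + (suc m C suc n) ≡ + 2 * + (m C n)
      double = ≡.trans (≡.cong (λ i → + (suc i C suc n)) m≡1+2n) (≡.trans (≡.cong +_ ([2+2k]C[1+k]≡2*[1+2k]Ck n))
        (≡.trans (ℤ.pos-* 2 (suc (n ℕ.+ n) C n)) (≡.cong (λ i → + 2 * + (i C n)) (≡.sym m≡1+2n))))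
      -- From (n + 1) C(2n, n + 1) = n C(2n, n), with 4(n + 1) ≡ 1 and therefore 4n ≡ -3.
      off-central : + (M C suc n) ≋ - + 3 * + B n
      off-central = begin
        + (M C suc n)                           ≡⟨ ℤ.*-identityˡ (+ (M C suc n)) ⟨
        1ℤ * + (M C suc n)                      ≈⟨ *-congʳ (+ (M C suc n)) (4[n+1]≋1 n m≡1+2n) ⟨
        + 4 * + suc n * + (M C suc n)           ≡⟨ ℤ.*-assoc (+ 4) (+ suc n) (+ (M C suc n)) ⟩
        + 4 * (+ suc n * + (M C suc n))         ≡⟨ ≡.cong (+ 4 *_) (C-lower-step M n) ⟩
        + 4 * ((+ n + + n - + n) * + B n)       ≈⟨ linear (+ B n) (4[n+1]≋1 n m≡1+2n) (lem (+ n) (+ B n)) ⟩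
        - + 3 * + B n                           ∎
        where
        lem : ∀ n b → + 4 * ((n + n - n) * b) - - + 3 * b ≡ b * (+ 4 * (1ℤ + n) - 1ℤ)
        lem = solve-∀

open ModularArithmetic

open import Data.Rational using (_+_; _*_; _-_; -_)

-- Rational numbers as fractions

infix 4 _≐_÷_

-- Fractions need not be in lowest terms, so numerators and denominators of sums and products can be
-- followed without normalisation.
record _≐_÷_ (q : ℚ) (N D : ℤ) : Set where
  constructor cross
  field
    equality : ↥ q ℤ.* D ≡ N ℤ.* ↧ q

/-≐ : ∀ i n .{{_ : ℕ.NonZero n}} → (i ℚ./ n) ≐ i ÷ + n
/-≐ i n = cross (begin
  ↥ (i ℚ./ n) ℤ.* + n                                       ≡⟨ ≡.cong (↥ (i ℚ./ n) ℤ.*_) (ℚ.↧-/ i n) ⟨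
  ↥ (i ℚ./ n) ℤ.* (↧ (i ℚ./ n) ℤ.* ℤ.gcd i (+ n))           ≡⟨ swap (↥ (i ℚ./ n)) (↧ (i ℚ./ n)) (ℤ.gcd i (+ n)) ⟩
  (↥ (i ℚ./ n) ℤ.* ℤ.gcd i (+ n)) ℤ.* ↧ (i ℚ./ n)           ≡⟨ ≡.cong (ℤ._* ↧ (i ℚ./ n)) (ℚ.↥-/ i n) ⟩
  i ℤ.* ↧ (i ℚ./ n)                                         ∎)
  where
  open ≡.≡-Reasoning
  swap : ∀ a b c → a ℤ.* (b ℤ.* c) ≡ (a ℤ.* c) ℤ.* b
  swap = solve-∀

+-≐ : ∀ {q q′ N N′ D D′} → q ≐ N ÷ D → q′ ≐ N′ ÷ D′ →
      q + q′ ≐ N ℤ.* D′ ℤ.+ N′ ℤ.* D ÷ D ℤ.* D′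
+-≐ {q@(mkℚ _ _ _)} {q′@(mkℚ _ _ _)} {N} {N′} {D} {D′} (cross e) (cross e′) =
  cross (ℤ.*-cancelˡ-≡ (↧ q ℤ.* ↧ q′) (↥ s ℤ.* (D ℤ.* D′)) ((N ℤ.* D′ ℤ.+ N′ ℤ.* D) ℤ.* ↧ s) (begin
    ↧ q ℤ.* ↧ q′ ℤ.* (↥ s ℤ.* (D ℤ.* D′))
      ≡⟨ lem₁ (↧ q) (↧ q′) (↥ s) D D′ ⟩
    ↥ s ℤ.* (↧ q ℤ.* ↧ q′) ℤ.* (D ℤ.* D′)
      ≡⟨ ≡.cong (ℤ._* (D ℤ.* D′)) (_≐_÷_.equality (/-≐ (↥ q ℤ.* ↧ q′ ℤ.+ ↥ q′ ℤ.* ↧ q) (↧ₙ q ℕ.* ↧ₙ q′))) ⟩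
    (↥ q ℤ.* ↧ q′ ℤ.+ ↥ q′ ℤ.* ↧ q) ℤ.* ↧ s ℤ.* (D ℤ.* D′)
      ≡⟨ lem₂ (↥ q) (↧ q) (↥ q′) (↧ q′) (↧ s) D D′ ⟩
    (↥ q ℤ.* D ℤ.* ↧ q′ ℤ.* D′ ℤ.+ ↥ q′ ℤ.* D′ ℤ.* ↧ q ℤ.* D) ℤ.* ↧ s
      ≡⟨ ≡.cong₂ (λ a b → (a ℤ.* ↧ q′ ℤ.* D′ ℤ.+ b ℤ.* ↧ q ℤ.* D) ℤ.* ↧ s) e e′ ⟩
    (N ℤ.* ↧ q ℤ.* ↧ q′ ℤ.* D′ ℤ.+ N′ ℤ.* ↧ q′ ℤ.* ↧ q ℤ.* D) ℤ.* ↧ s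
      ≡⟨ lem₃ (↧ q) (↧ q′) (↧ s) N N′ D D′ ⟩
    ↧ q ℤ.* ↧ q′ ℤ.* ((N ℤ.* D′ ℤ.+ N′ ℤ.* D) ℤ.* ↧ s) ∎))
  where
  open ≡.≡-Reasoning
  s : ℚ
  s = q + q′
  lem₁ : ∀ a b c d e → a ℤ.* b ℤ.* (c ℤ.* (d ℤ.* e)) ≡ c ℤ.* (a ℤ.* b) ℤ.* (d ℤ.* e)
  lem₁ = solve-∀
  lem₂ : ∀ n d n′ d′ s D D′ → (n ℤ.* d′ ℤ.+ n′ ℤ.* d) ℤ.* s ℤ.* (D ℤ.* D′) ≡
    (n ℤ.* D ℤ.* d′ ℤ.* D′ ℤ.+ n′ ℤ.* D′ ℤ.* d ℤ.* D) ℤ.* s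
  lem₂ = solve-∀
  lem₃ : ∀ d d′ s N N′ D D′ → (N ℤ.* d ℤ.* d′ ℤ.* D′ ℤ.+ N′ ℤ.* d′ ℤ.* d ℤ.* D) ℤ.* s ≡
    d ℤ.* d′ ℤ.* ((N ℤ.* D′ ℤ.+ N′ ℤ.* D) ℤ.* s)
  lem₃ = solve-∀

*-≐ : ∀ {q q′ N N′ D D′} → q ≐ N ÷ D → q′ ≐ N′ ÷ D′ → q * q′ ≐ N ℤ.* N′ ÷ D ℤ.* D′
*-≐ {q@(mkℚ _ _ _)} {q′@(mkℚ _ _ _)} {N} {N′} {D} {D′} (cross e) (cross e′) =
  cross (ℤ.*-cancelˡ-≡ (↧ q ℤ.* ↧ q′) (↥ s ℤ.* (D ℤ.* D′)) ((N ℤ.* N′) ℤ.* ↧ s) (begin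
    ↧ q ℤ.* ↧ q′ ℤ.* (↥ s ℤ.* (D ℤ.* D′))
      ≡⟨ lem₁ (↧ q) (↧ q′) (↥ s) D D′ ⟩
    ↥ s ℤ.* (↧ q ℤ.* ↧ q′) ℤ.* (D ℤ.* D′)
      ≡⟨ ≡.cong (ℤ._* (D ℤ.* D′)) (_≐_÷_.equality (/-≐ (↥ q ℤ.* ↥ q′) (↧ₙ q ℕ.* ↧ₙ q′))) ⟩
    ↥ q ℤ.* ↥ q′ ℤ.* ↧ s ℤ.* (D ℤ.* D′)
      ≡⟨ lem₂ (↥ q) (↥ q′) (↧ s) D D′ ⟩
    (↥ q ℤ.* D) ℤ.* (↥ q′ ℤ.* D′) ℤ.* ↧ s
      ≡⟨ ≡.cong₂ (λ a b → a ℤ.* b ℤ.* ↧ s) e e′ ⟩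
    (N ℤ.* ↧ q) ℤ.* (N′ ℤ.* ↧ q′) ℤ.* ↧ s
      ≡⟨ lem₃ (↧ q) (↧ q′) (↧ s) N N′ ⟩
    ↧ q ℤ.* ↧ q′ ℤ.* (N ℤ.* N′ ℤ.* ↧ s) ∎))
  where
  open ≡.≡-Reasoning
  s : ℚ
  s = q * q′
  lem₁ : ∀ a b c d e → a ℤ.* b ℤ.* (c ℤ.* (d ℤ.* e)) ≡ c ℤ.* (a ℤ.* b) ℤ.* (d ℤ.* e)
  lem₁ = solve-∀
  lem₂ : ∀ n n′ s D D′ → n ℤ.* n′ ℤ.* s ℤ.* (D ℤ.* D′) ≡ (n ℤ.* D) ℤ.* (n′ ℤ.* D′) ℤ.* s
  lem₂ = solve-∀
  lem₃ : ∀ d d′ s N N′ → (N ℤ.* d) ℤ.* (N′ ℤ.* d′) ℤ.* s ≡ d ℤ.* d′ ℤ.* (N ℤ.* N′ ℤ.* s)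
  lem₃ = solve-∀

neg-≐ : ∀ {q N D} → q ≐ N ÷ D → - q ≐ ℤ.- N ÷ D
neg-≐ {q} {N} {D} (cross e) = cross (begin
  ↥ (- q) ℤ.* D          ≡⟨ ≡.cong (ℤ._* D) (ℚ.↥-neg q) ⟩
  ℤ.- ↥ q ℤ.* D          ≡⟨ ℤ.neg-distribˡ-* (↥ q) D ⟨
  ℤ.- (↥ q ℤ.* D)        ≡⟨ ≡.cong ℤ.-_ e ⟩
  ℤ.- (N ℤ.* ↧ q)        ≡⟨ ℤ.neg-distribˡ-* N (↧ q) ⟩
  ℤ.- N ℤ.* ↧ q          ≡⟨ ≡.cong (ℤ.- N ℤ.*_) (ℚ.↧-neg q) ⟨
  ℤ.- N ℤ.* ↧ (- q)      ∎)
  where open ≡.≡-Reasoning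

≐-unique : ∀ {q q′ N N′} D D′ .{{_ : ℤ.NonZero D}} .{{_ : ℤ.NonZero D′}} →
           q ≐ N ÷ D → q′ ≐ N′ ÷ D′ → N ℤ.* D′ ≡ N′ ℤ.* D → q ≡ q′
≐-unique {q@(mkℚ _ _ _)} {q′@(mkℚ _ _ _)} {N} {N′} D D′ (cross e) (cross e′) eq =
  ℚ.≃⇒≡ (ℚ.*≡* (ℤ.*-cancelˡ-≡ D (↥ q ℤ.* ↧ q′) (↥ q′ ℤ.* ↧ q)
    (ℤ.*-cancelˡ-≡ D′ (D ℤ.* (↥ q ℤ.* ↧ q′)) (D ℤ.* (↥ q′ ℤ.* ↧ q)) (begin
    D′ ℤ.* (D ℤ.* (↥ q ℤ.* ↧ q′))       ≡⟨ lem₁ D D′ (↥ q) (↧ q′) ⟩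
    ↥ q ℤ.* D ℤ.* (D′ ℤ.* ↧ q′)         ≡⟨ ≡.cong (ℤ._* (D′ ℤ.* ↧ q′)) e ⟩
    N ℤ.* ↧ q ℤ.* (D′ ℤ.* ↧ q′)         ≡⟨ lem₂ N D′ (↧ q) (↧ q′) ⟩
    N ℤ.* D′ ℤ.* (↧ q ℤ.* ↧ q′)         ≡⟨ ≡.cong (ℤ._* (↧ q ℤ.* ↧ q′)) eq ⟩
    N′ ℤ.* D ℤ.* (↧ q ℤ.* ↧ q′)         ≡⟨ lem₃ N′ D (↧ q) (↧ q′) ⟩
    N′ ℤ.* ↧ q′ ℤ.* (D ℤ.* ↧ q)         ≡⟨ ≡.cong (ℤ._* (D ℤ.* ↧ q)) e′ ⟨
    ↥ q′ ℤ.* D′ ℤ.* (D ℤ.* ↧ q)         ≡⟨ lem₄ D D′ (↥ q′) (↧ q) ⟩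
    D′ ℤ.* (D ℤ.* (↥ q′ ℤ.* ↧ q))       ∎))))
  where
  open ≡.≡-Reasoning
  lem₁ : ∀ D D′ a b → D′ ℤ.* (D ℤ.* (a ℤ.* b)) ≡ a ℤ.* D ℤ.* (D′ ℤ.* b)
  lem₁ = solve-∀
  lem₂ : ∀ N D a b → N ℤ.* a ℤ.* (D ℤ.* b) ≡ N ℤ.* D ℤ.* (a ℤ.* b)
  lem₂ = solve-∀
  lem₃ : ∀ N D a b → N ℤ.* D ℤ.* (a ℤ.* b) ≡ N ℤ.* b ℤ.* (D ℤ.* a)
  lem₃ = solve-∀
  lem₄ : ∀ D D′ a b → a ℤ.* D′ ℤ.* (D ℤ.* b) ≡ D′ ℤ.* (D ℤ.* (a ℤ.* b))
  lem₄ = solve-∀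

-- The terms as fractions and the telescoping relation

pos-^ : ∀ a k → + (a ℕ.^ k) ≡ (+ a) ℤ.^ k
pos-^ a zero    = ≡.refl
pos-^ a (suc k) = ≡.trans (ℤ.pos-* a (a ℕ.^ k)) (≡.cong (+ a ℤ.*_) (pos-^ a k))

inv72^-≐ : ∀ k → inv72^ k ≐ 1ℤ ÷ (+ 72) ℤ.^ k
inv72^-≐ k = ≡.subst (inv72^ k ≐ 1ℤ ÷_) (pos-^ 72 k) (/-≐ 1ℤ (72 ℕ.^ k) {{ℕ.m^n≢0 72 k}})

72^k≢0 : ∀ k → ℤ.NonZero ((+ 72) ℤ.^ k)
72^k≢0 k = ≡.subst ℤ.NonZero (pos-^ 72 k) (ℕ.m^n≢0 72 k)

≐-cong : ∀ {q N N′ D D′} → q ≐ N ÷ D → N ≡ N′ → D ≡ D′ → q ≐ N′ ÷ D′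
≐-cong h ≡.refl ≡.refl = h

weighted-≐ : ∀ a k → ℕ→ℚ a * inv72^ k ≐ + a ÷ (+ 72) ℤ.^ k
weighted-≐ a k = ≐-cong (*-≐ (/-≐ (+ a) 1) (inv72^-≐ k)) (ℤ.*-identityʳ (+ a)) (ℤ.*-identityˡ ((+ 72) ℤ.^ k))

pos-k*A : ∀ k → + (k ℕ.* ((4 ℕ.* k) C (2 ℕ.* k)) ℕ.* ((2 ℕ.* k) C k)) ≡ + k ℤ.* + A k
pos-k*A k = ≡.trans (≡.cong +_ (ℕ.*-assoc k ((4 ℕ.* k) C (2 ℕ.* k)) ((2 ℕ.* k) C k))) (ℤ.pos-* k (A k))

term1-≐ : ∀ k → term1 k ≐ + k ℤ.* + A k ÷ (+ 72) ℤ.^ k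
term1-≐ k = ≐-cong (weighted-≐ (k ℕ.* ((4 ℕ.* k) C (2 ℕ.* k)) ℕ.* ((2 ℕ.* k) C k)) k) (pos-k*A k) ≡.refl

term2-≐ : ∀ k → term2 k ≐ + A k ÷ + suc k ℤ.* (+ 72) ℤ.^ k
term2-≐ k = ≐-cong
  (*-≐ (*-≐ (/-≐ (+ ((4 ℕ.* k) C (2 ℕ.* k))) 1) (/-≐ (+ ((2 ℕ.* k) C k)) (suc k))) (inv72^-≐ k))
  (≡.trans (ℤ.*-identityʳ (+ ((4 ℕ.* k) C (2 ℕ.* k)) ℤ.* + ((2 ℕ.* k) C k)))
    (≡.sym (ℤ.pos-* ((4 ℕ.* k) C (2 ℕ.* k)) ((2 ℕ.* k) C k))))
  (≡.cong (ℤ._* (+ 72) ℤ.^ k) (ℤ.*-identityˡ (+ suc k)))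

-- The T_n of the telescoping relation. Since A(k + 1) / (72 A(k)) tends to 64/72 = 8/9, the factor
-- 9 = 1/(1 - 8/9) makes the leading part of T_k - T_(k+1) equal to k A(k) / 72^k.
boundary : ℕ → ℚ
boundary n = ℕ→ℚ (9 ℕ.* (n ℕ.* A n)) * inv72^ n

boundary-≐ : ∀ n → boundary n ≐ + 9 ℤ.* (+ n ℤ.* + A n) ÷ (+ 72) ℤ.^ n
boundary-≐ n = ≐-cong (weighted-≐ (9 ℕ.* (n ℕ.* A n)) n)
  (≡.trans (ℤ.pos-* 9 (n ℕ.* A n)) (≡.cong (+ 9 ℤ.*_) (ℤ.pos-* n (A n)))) ≡.refl

-- Once `A-stepℤ` eliminates A(k + 1), the relation comes down to 2k(k + 1) + (4k + 1)(4k + 3) =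
-- 18k(k + 1) + 3.
boundary-step : ∀ k → term1 k + boundary (suc k) ≡ boundary k + (+ 3 ℚ./ 2) * term2 k
boundary-step k = ≐-unique (P ℤ.* (+ 72 ℤ.* P)) (P ℤ.* (+ 2 ℤ.* (s ℤ.* P))) {{nonZero₁}} {{nonZero₂}}
  (+-≐ (term1-≐ k) (boundary-≐ (suc k)))
  (+-≐ (boundary-≐ k) (*-≐ (/-≐ (+ 3) 2) (term2-≐ k)))
  (≡.trans (isolate (+ k) (+ A k) (+ A (suc k)) P)
    (≡.trans (≡.cong (λ z → + 2 ℤ.* P ℤ.* P ℤ.* P ℤ.* (+ 72 ℤ.* + k ℤ.* + A k ℤ.* s ℤ.+ + 9 ℤ.* z)) (A-stepℤ k))
      (recombine (+ k) (+ A k) P)))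
  where
  P s : ℤ
  P = (+ 72) ℤ.^ k
  s = + suc k
  nonZero₁ : ℤ.NonZero (P ℤ.* (+ 72 ℤ.* P))
  nonZero₁ = ℤ.i*j≢0 P (+ 72 ℤ.* P) {{72^k≢0 k}} {{72^k≢0 (suc k)}}
  nonZero₂ : ℤ.NonZero (P ℤ.* (+ 2 ℤ.* (s ℤ.* P)))
  nonZero₂ = ℤ.i*j≢0 P (+ 2 ℤ.* (s ℤ.* P)) {{72^k≢0 k}}
    {{ℤ.i*j≢0 (+ 2) (s ℤ.* P) {{_}} {{ℤ.i*j≢0 s P {{_}} {{72^k≢0 k}}}}}}
  isolate : ∀ k a a′ P →
    (k ℤ.* a ℤ.* (+ 72 ℤ.* P) ℤ.+ + 9 ℤ.* ((1ℤ ℤ.+ k) ℤ.* a′) ℤ.* P) ℤ.* (P ℤ.* (+ 2 ℤ.* ((1ℤ ℤ.+ k) ℤ.* P))) ≡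
    + 2 ℤ.* P ℤ.* P ℤ.* P ℤ.* (+ 72 ℤ.* k ℤ.* a ℤ.* (1ℤ ℤ.+ k) ℤ.+ + 9 ℤ.* ((1ℤ ℤ.+ k) ℤ.* (1ℤ ℤ.+ k) ℤ.* a′))
  isolate = solve-∀
  recombine : ∀ k a P →
    + 2 ℤ.* P ℤ.* P ℤ.* P ℤ.* (+ 72 ℤ.* k ℤ.* a ℤ.* (1ℤ ℤ.+ k) ℤ.+ + 9 ℤ.* (+ 4 ℤ.* ((1ℤ ℤ.+ + 4 ℤ.* k) ℤ.* (+ 3 ℤ.+ + 4 ℤ.* k)) ℤ.* a)) ≡
    (+ 9 ℤ.* (k ℤ.* a) ℤ.* (+ 2 ℤ.* ((1ℤ ℤ.+ k) ℤ.* P)) ℤ.+ + 3 ℤ.* a ℤ.* P) ℤ.* (P ℤ.* (+ 72 ℤ.* P))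
  recombine = solve-∀

telescoped : ∀ n → sumℚ n term1 + boundary n ≡ (+ 3 ℚ./ 2) * sumℚ n term2
telescoped zero    = ≡.refl
telescoped (suc n) = begin
  sumℚ n term1 + term1 n + boundary (suc n)              ≡⟨ ℚ.+-assoc (sumℚ n term1) (term1 n) (boundary (suc n)) ⟩
  sumℚ n term1 + (term1 n + boundary (suc n))            ≡⟨ ≡.cong (λ z → sumℚ n term1 + z) (boundary-step n) ⟩
  sumℚ n term1 + (boundary n + 3/2 * term2 n)            ≡⟨ ℚ.+-assoc (sumℚ n term1) (boundary n) (3/2 * term2 n) ⟨
  sumℚ n term1 + boundary n + 3/2 * term2 n              ≡⟨ ≡.cong (λ z → z + 3/2 * term2 n) (telescoped n) ⟩
  3/2 * sumℚ n term2 + 3/2 * term2 n                     ≡⟨ ℚ.*-distribˡ-+ 3/2 (sumℚ n term2) (term2 n) ⟨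
  3/2 * (sumℚ n term2 + term2 n)                         ∎
  where
  open ≡.≡-Reasoning
  3/2 : ℚ
  3/2 = + 3 ℚ./ 2

-- Reduction of rational numbers modulo p

module Reduction (p : ℕ) (pp : Prime p) where

  open Congruence p
  open PrimeModulus pp

  private instance _ = prime⇒nonZero pp

  -- `a` represents the image in ℤ/p of q, an element of the localisation at p; any fraction for q
  -- with denominator prime to p may witness this.
  record Reduces (q : ℚ) (a : ℤ) : Set where
    constructor reduction
    field
      {N D}    : ℤ
      fraction : q ≐ N ÷ D
      unit     : ¬ D ≋ 0ℤ
      residue≋ : N ≋ a ℤ.* D

  reduces-+ : ∀ {q q′ a a′} → Reduces q a → Reduces q′ a′ → Reduces (q + q′) (a ℤ.+ a′)
  reduces-+ {a = a} {a′} (reduction {N} {D} f u h) (reduction {N′} {D′} f′ u′ h′) =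
    reduction (+-≐ f f′) (*-nonzero u u′)
      (≋-trans (+-cong (*-congʳ D′ h) (*-congʳ D h′)) (≋-reflexive (lem a a′ D D′)))
    where
    lem : ∀ a a′ D D′ → a ℤ.* D ℤ.* D′ ℤ.+ a′ ℤ.* D′ ℤ.* D ≡ (a ℤ.+ a′) ℤ.* (D ℤ.* D′)
    lem = solve-∀

  reduces-* : ∀ {q q′ a a′} → Reduces q a → Reduces q′ a′ → Reduces (q * q′) (a ℤ.* a′)
  reduces-* {a = a} {a′} (reduction {N} {D} f u h) (reduction {N′} {D′} f′ u′ h′) =
    reduction (*-≐ f f′) (*-nonzero u u′)
      (≋-trans (*-cong h h′) (≋-reflexive (lem a a′ D D′)))
    where
    lem : ∀ a a′ D D′ → a ℤ.* D ℤ.* (a′ ℤ.* D′) ≡ a ℤ.* a′ ℤ.* (D ℤ.* D′)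
    lem = solve-∀

  reduces-neg : ∀ {q a} → Reduces q a → Reduces (- q) (ℤ.- a)
  reduces-neg {a = a} (reduction {N} {D} f u h) = reduction (neg-≐ f) u
    (≋-trans (neg-cong h) (≋-reflexive (ℤ.neg-distribˡ-* a D)))

  reduces-cong : ∀ {q a b} → a ≋ b → Reduces q a → Reduces q b
  reduces-cong e (reduction {D = D} f u h) = reduction f u (≋-trans h (*-congʳ D e))

  reduces-ℤ : ∀ z → Reduces (ℤ→ℚ z) z
  reduces-ℤ z = reduction (/-≐ z 1) 1≢0 (≋-reflexive (≡.sym (ℤ.*-identityʳ z)))

  -- If q - q′ = N/D with N = Mp and p not dividing D, then (q - q′)/p = M/D. Were p to divide its
  -- reduced denominator, it would also divide the numerator, against lowest terms.
  CongQ-intro : ∀ {q q′ a a′} → Reduces q a → Reduces q′ a′ → a ≋ a′ → CongQ p pp q q′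
  CongQ-intro {q} {q′} {a} {a′} h h′ e p∣den with reduces-+ h (reduces-neg h′)
  ... | reduction {N} {D} f u residue≋ with ≋-trans residue≋ (*-congʳ D (≋⇒-≋0 e))
  ...   | quot M N≡ = not-coprime (divByPrime (q - q′) p pp) (_≐_÷_.equality (*-≐ f (/-≐ 1ℤ p))) p∣den
    where
    not-coprime : ∀ t → ↥ t ℤ.* (D ℤ.* + p) ≡ N ℤ.* 1ℤ ℤ.* ↧ t → p ℕ.∣ ↧ₙ t → ⊥
    not-coprime t@(mkℚ num den-1 coprime) eq p∣den =
      ℕ.nonTrivial⇒≢1 {{prime⇒nonTrivial pp}} (Coprimality.recompute coprime (≋0⇒∣ {↥ t} num≋0 , p∣den))
      where
      lem₁ : ∀ a D P → P ℤ.* (a ℤ.* D) ≡ a ℤ.* (D ℤ.* P)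
      lem₁ = solve-∀
      lem₂ : ∀ M D P d → (0ℤ ℤ.* D ℤ.+ M ℤ.* P) ℤ.* 1ℤ ℤ.* d ≡ P ℤ.* (M ℤ.* d)
      lem₂ = solve-∀
      divided : ↥ t ℤ.* D ≡ M ℤ.* ↧ t
      divided = ℤ.*-cancelˡ-≡ (+ p) (↥ t ℤ.* D) (M ℤ.* ↧ t) (≡.trans (lem₁ (↥ t) D (+ p)) (≡.trans eq
        (≡.trans (≡.cong (λ z → z ℤ.* 1ℤ ℤ.* ↧ t) N≡) (lem₂ M D (+ p) (↧ t)))))
      num≋0 : ↥ t ≋ 0ℤ
      num≋0 = Sum.fromInj₁ (λ h → ⊥-elim (u h)) (integral (↥ t) D
        (≋-trans (≋-reflexive divided) (≋-trans (*-congˡ M (∣⇒≋0 {↧ t} p∣den)) (≋-reflexive (ℤ.*-zeroʳ M)))))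

module Conclusion (p : ℕ) (pp : Prime p) (m : ℕ) (p≡1+2m : p ≡ suc (m ℕ.+ m)) (3<p : 3 < p) where

  open Evaluation p pp m p≡1+2m 3<p
  open Reduction p pp

  reduces-weighted : ∀ a k → Reduces (ℕ→ℚ a * inv72^ k) (+ a ℤ.* 1/72 ℤ.^ k)
  reduces-weighted a k = reduces-* (reduces-ℤ (+ a)) (reduction (inv72^-≐ k) (power-nonzero k) (begin
    1ℤ                                ≡⟨ ℤ.^-zeroˡ k ⟨
    1ℤ ℤ.^ k                          ≈⟨ ^-cong k (*-inverse 72≢0) ⟨
    (+ 72 ℤ.* 1/72) ℤ.^ k             ≡⟨ ^-distribʳ-* (+ 72) 1/72 k ⟩
    (+ 72) ℤ.^ k ℤ.* 1/72 ℤ.^ k       ≡⟨ ℤ.*-comm ((+ 72) ℤ.^ k) (1/72 ℤ.^ k) ⟩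
    1/72 ℤ.^ k ℤ.* (+ 72) ℤ.^ k       ∎))
    where
    open ≋-Reasoning
    power-nonzero : ∀ k → ¬ (+ 72) ℤ.^ k ≋ 0ℤ
    power-nonzero zero    = 1≢0
    power-nonzero (suc k) = *-nonzero 72≢0 (power-nonzero k)

  reduces-sum₁ : ∀ n → Reduces (sumℚ n term1) (Σ n (λ k → + k ℤ.* + A k ℤ.* 1/72 ℤ.^ k))
  reduces-sum₁ zero    = reduces-ℤ 0ℤ
  reduces-sum₁ (suc n) = reduces-+ (reduces-sum₁ n)
    (≡.subst (λ z → Reduces (term1 n) (z ℤ.* 1/72 ℤ.^ n)) (pos-k*A n)
      (reduces-weighted (n ℕ.* ((4 ℕ.* n) C (2 ℕ.* n)) ℕ.* ((2 ℕ.* n) C n)) n))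

  -- Transported from the first sum by the identity in ℚ: the last term of the second sum is written
  -- with denominator p, so it has no immediate witness of `Reduces`.
  reduces-sum₂ : Reduces ((+ 3 ℚ./ 2) * sumℚ p term2) S
  reduces-sum₂ = ≡.subst (λ q → Reduces q S) (telescoped p)
    (reduces-cong (≋-trans (+-cong (≋-refl {S}) boundary≋0) (≋-reflexive (ℤ.+-identityʳ S)))
      (reduces-+ (reduces-sum₁ p) (reduces-weighted (9 ℕ.* (p ℕ.* A p)) p)))
    where
    boundary≋0 : + (9 ℕ.* (p ℕ.* A p)) ℤ.* 1/72 ℤ.^ p ≋ 0ℤ
    boundary≋0 = *-congʳ (1/72 ℤ.^ p) (∣⇒≋0 {+ (9 ℕ.* (p ℕ.* A p))} (ℕ.∣n⇒∣m*n 9 (ℕ.m∣m*n (A p))))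

  legendre≋ : legendre (+ 6) p ≋ (+ 6) ℤ.^ m
  legendre≋ = euler (+ 6) 6≢0

  part₁ : CongQ p pp (sumℚ p term1) ((+ 3 ℚ./ 2) * sumℚ p term2)
  part₁ = CongQ-intro (reduces-sum₁ p) reduces-sum₂ ≋-refl

  part₂ : ∀ n → m ≡ n ℕ.+ n → ∀ x′ y′ → let x = 1ℤ ℤ.+ + 4 ℤ.* x′ ; y = + 2 ℤ.* y′ in
    + p ≡ x ℤ.* x ℤ.+ y ℤ.* y → CongQ p pp ((+ 3 ℚ./ 2) * sumℚ p term2) (ℤ→ℚ (legendre (+ 6) p ℤ.* x))
  part₂ n m≡2n x′ y′ p≡x²+y² = CongQ-intro reduces-sum₂ (reduces-ℤ (legendre (+ 6) p ℤ.* x))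
    (*-cancelˡ (+ 2) 2≢0 (begin
      + 2 ℤ.* S                             ≈⟨ 2S-even n m≡2n ⟩
      (+ 6) ℤ.^ m ℤ.* + (m C n)             ≈⟨ *-cong legendre≋ (≋-sym (Gauss.gauss p pp m p≡1+2m n m≡2n x′ y′ p≡x²+y²)) ⟨
      legendre (+ 6) p ℤ.* (+ 2 ℤ.* x)      ≡⟨ swap (legendre (+ 6) p) x ⟩
      + 2 ℤ.* (legendre (+ 6) p ℤ.* x)      ∎))
    where
    open ≋-Reasoning
    x : ℤ
    x = 1ℤ ℤ.+ + 4 ℤ.* x′
    swap : ∀ a b → a ℤ.* (+ 2 ℤ.* b) ≡ + 2 ℤ.* (a ℤ.* b)
    swap = solve-∀

  part₃ : ∀ n → m ≡ suc (n ℕ.+ n) → CongQ p pp ((+ 3 ℚ./ 2) * sumℚ p term2)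
    ((+ 3 ℚ./ 4) * ℤ→ℚ (legendre (+ 6) p) * ℕ→ℚ (suc m C suc n))
  part₃ n m≡1+2n = CongQ-intro reduces-sum₂
    (reduces-* (reduces-* 3/4 (reduces-ℤ (legendre (+ 6) p))) (reduces-ℤ (+ (suc m C suc n))))
    (*-cancelˡ (+ 4) 4≢0 (begin
      + 4 ℤ.* S
        ≈⟨ 4S-odd n m≡1+2n ⟩
      + 3 ℤ.* (+ 6) ℤ.^ m ℤ.* c
        ≈⟨ *-congʳ c (*-congˡ (+ 3) legendre≋) ⟨
      + 3 ℤ.* legendre (+ 6) p ℤ.* c
        ≡⟨ regroup₁ (legendre (+ 6) p) c ⟩
      1ℤ ℤ.* (+ 3 ℤ.* legendre (+ 6) p ℤ.* c)
        ≈⟨ *-congʳ (+ 3 ℤ.* legendre (+ 6) p ℤ.* c) (*-inverse 4≢0) ⟨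
      + 4 ℤ.* inverse (+ 4) ℤ.* (+ 3 ℤ.* legendre (+ 6) p ℤ.* c)
        ≡⟨ regroup₂ (inverse (+ 4)) (legendre (+ 6) p) c ⟩
      + 4 ℤ.* (+ 3 ℤ.* inverse (+ 4) ℤ.* legendre (+ 6) p ℤ.* c) ∎))
    where
    open ≋-Reasoning
    c : ℤ
    c = + (suc m C suc n)
    4≢0 : ¬ + 4 ≋ 0ℤ
    4≢0 = *-nonzero 2≢0 2≢0
    regroup₁ : ∀ l c → + 3 ℤ.* l ℤ.* c ≡ 1ℤ ℤ.* (+ 3 ℤ.* l ℤ.* c)
    regroup₁ = solve-∀
    regroup₂ : ∀ i l c → + 4 ℤ.* i ℤ.* (+ 3 ℤ.* l ℤ.* c) ≡ + 4 ℤ.* (+ 3 ℤ.* i ℤ.* l ℤ.* c)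
    regroup₂ = solve-∀
    3/4 : Reduces (+ 3 ℚ./ 4) (+ 3 ℤ.* inverse (+ 4))
    3/4 = reduction (/-≐ (+ 3) 4) 4≢0 (begin
      + 3                                  ≡⟨ ℤ.*-identityʳ (+ 3) ⟨
      + 3 ℤ.* 1ℤ                           ≈⟨ *-congˡ (+ 3) (*-inverse 4≢0) ⟨
      + 3 ℤ.* (+ 4 ℤ.* inverse (+ 4))      ≡⟨ regroup₃ (inverse (+ 4)) ⟩
      + 3 ℤ.* inverse (+ 4) ℤ.* + 4        ∎)
      where
      regroup₃ : ∀ i → + 3 ℤ.* (+ 4 ℤ.* i) ≡ + 3 ℤ.* i ℤ.* + 4
      regroup₃ = solve-∀

-- Parity cases and the theorem

odd-prime : ∀ p → Prime p → 3 < p → ∃ λ m → p ≡ suc (m ℕ.+ m)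
odd-prime p pp 3<p with even-or-odd p
... | m , inj₂ p≡1+2m = m , p≡1+2m
... | m , inj₁ p≡2m   = ⊥-elim (impossible (prime⇒irreducible pp 2∣p))
  where
  2∣p : 2 ℕ.∣ p
  2∣p = ℕ.divides m (≡.trans p≡2m (≡.trans (≡.sym (2k≡k+k m)) (ℕ.*-comm 2 m)))
  impossible : 2 ≡ 1 ⊎ 2 ≡ p → ⊥
  impossible (inj₂ 2≡p) = ℕ.<⇒≢ (ℕ.<-trans (ℕ.n<1+n 2) 3<p) 2≡p

private
  4n+3≢1+4N : ∀ n N → + suc (suc (n ℕ.+ n) ℕ.+ suc (n ℕ.+ n)) ≢ 1ℤ ℤ.+ + 4 ℤ.* N
  4n+3≢1+4N n N eq = 2z≢1 (N ℤ.- + n) (ℤ.*-cancelˡ-≡ (+ 2) (+ 2 ℤ.* (N ℤ.- + n)) 1ℤ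
    (≡.trans (lem₁ N (+ n)) (≡.trans (≡.cong (λ z → z ℤ.- 1ℤ ℤ.- + 4 ℤ.* + n) (≡.sym eq)) (lem₂ (+ n)))))
    where
    lem₁ : ∀ N n → + 2 ℤ.* (+ 2 ℤ.* (N ℤ.- n)) ≡ 1ℤ ℤ.+ + 4 ℤ.* N ℤ.- 1ℤ ℤ.- + 4 ℤ.* n
    lem₁ = solve-∀
    lem₂ : ∀ n → 1ℤ ℤ.+ (1ℤ ℤ.+ (n ℤ.+ n) ℤ.+ (1ℤ ℤ.+ (n ℤ.+ n))) ℤ.- 1ℤ ℤ.- + 4 ℤ.* n ≡ + 2 ℤ.* 1ℤ
    lem₂ = solve-∀

  shifted : ∀ {x} q → x ℤ.- 1ℤ ≡ q ℤ.* + 4 → x ≡ 1ℤ ℤ.+ + 4 ℤ.* q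
  shifted {x} q eq = ≡.trans (lem₁ x) (≡.cong (λ z → 1ℤ ℤ.+ z) (≡.trans eq (ℤ.*-comm q (+ 4))))
    where
    lem₁ : ∀ x → x ≡ 1ℤ ℤ.+ (x ℤ.- 1ℤ)
    lem₁ = solve-∀

theorem1p6 : (p : ℕ) → (pp : Prime p) → 3 < p →
    CongQ p pp (sumℚ p term1) ((+ 3 ℚ./ 2) * sumℚ p term2)
    × (∀ (x y : ℤ) → + p ≡ x ℤ.* x ℤ.+ y ℤ.* y → (+ 4) ℤD.∣ (x ℤ.- + 1) → (+ 2) ℤD.∣ y →
    CongQ p pp ((+ 3 ℚ./ 2) * sumℚ p term2) (ℤ→ℚ (legendre (+ 6) p ℤ.* x)))
    × (p % 4 ≡ 3 →
    CongQ p pp ((+ 3 ℚ./ 2) * sumℚ p term2)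
    ((+ 3 ℚ./ 4) * ℤ→ℚ (legendre (+ 6) p) * ℕ→ℚ (((p ℕ.+ 1) / 2) C ((p ℕ.+ 1) / 4))))
theorem1p6 p pp 3<p = part₁ , first-case , second-case
  where
  m : ℕ
  m = proj₁ (odd-prime p pp 3<p)
  p≡1+2m : p ≡ suc (m ℕ.+ m)
  p≡1+2m = proj₂ (odd-prime p pp 3<p)

  open Conclusion p pp m p≡1+2m 3<p

  first-case : ∀ (x y : ℤ) → + p ≡ x ℤ.* x ℤ.+ y ℤ.* y → (+ 4) ℤD.∣ (x ℤ.- + 1) → (+ 2) ℤD.∣ y →
    CongQ p pp ((+ 3 ℚ./ 2) * sumℚ p term2) (ℤ→ℚ (legendre (+ 6) p ℤ.* x))
  first-case x y p≡x²+y² 4∣x-1 2∣y with ∣ᵤ⇒∣ {+ 4} {x ℤ.- 1ℤ} 4∣x-1 | ∣ᵤ⇒∣ {+ 2} {y} 2∣y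
  ... | divides x′ x-1≡ | divides y′ y≡ = ≡.subst
    (λ z → CongQ p pp ((+ 3 ℚ./ 2) * sumℚ p term2) (ℤ→ℚ (legendre (+ 6) p ℤ.* z))) (≡.sym x≡)
    (by-parity (even-or-odd m))
    where
    x≡ : x ≡ 1ℤ ℤ.+ + 4 ℤ.* x′
    x≡ = shifted x′ x-1≡
    p≡ : + p ≡ (1ℤ ℤ.+ + 4 ℤ.* x′) ℤ.* (1ℤ ℤ.+ + 4 ℤ.* x′) ℤ.+ + 2 ℤ.* y′ ℤ.* (+ 2 ℤ.* y′)
    p≡ = ≡.trans p≡x²+y² (≡.cong₂ (λ a b → a ℤ.* a ℤ.+ b ℤ.* b) x≡ (≡.trans y≡ (ℤ.*-comm y′ (+ 2))))
    lem : ∀ x y → (1ℤ ℤ.+ + 4 ℤ.* x) ℤ.* (1ℤ ℤ.+ + 4 ℤ.* x) ℤ.+ + 2 ℤ.* y ℤ.* (+ 2 ℤ.* y) ≡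
      1ℤ ℤ.+ + 4 ℤ.* (+ 2 ℤ.* x ℤ.+ + 4 ℤ.* x ℤ.* x ℤ.+ y ℤ.* y)
    lem = solve-∀
    by-parity : (∃ λ n → m ≡ n ℕ.+ n ⊎ m ≡ suc (n ℕ.+ n)) →
      CongQ p pp ((+ 3 ℚ./ 2) * sumℚ p term2) (ℤ→ℚ (legendre (+ 6) p ℤ.* (1ℤ ℤ.+ + 4 ℤ.* x′)))
    by-parity (n , inj₁ m≡2n)   = part₂ n m≡2n x′ y′ p≡
    -- Here p = 4n + 3, but an odd square plus an even square is 1 modulo 4.
    by-parity (n , inj₂ m≡1+2n) = ⊥-elim (4n+3≢1+4N n (+ 2 ℤ.* x′ ℤ.+ + 4 ℤ.* x′ ℤ.* x′ ℤ.+ y′ ℤ.* y′)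
      (≡.trans (≡.cong +_ (≡.sym (≡.trans p≡1+2m (≡.cong (λ i → suc (i ℕ.+ i)) m≡1+2n)))) (≡.trans p≡ (lem x′ y′))))

  second-case : p % 4 ≡ 3 → CongQ p pp ((+ 3 ℚ./ 2) * sumℚ p term2)
    ((+ 3 ℚ./ 4) * ℤ→ℚ (legendre (+ 6) p) * ℕ→ℚ (((p ℕ.+ 1) / 2) C ((p ℕ.+ 1) / 4)))
  second-case p%4≡3 = by-parity (even-or-odd m)
    where
    by-parity : (∃ λ n → m ≡ n ℕ.+ n ⊎ m ≡ suc (n ℕ.+ n)) → CongQ p pp ((+ 3 ℚ./ 2) * sumℚ p term2)
      ((+ 3 ℚ./ 4) * ℤ→ℚ (legendre (+ 6) p) * ℕ→ℚ (((p ℕ.+ 1) / 2) C ((p ℕ.+ 1) / 4)))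
    by-parity (n , inj₁ m≡2n) = ⊥-elim (1≢3 (≡.trans (≡.sym p%4≡1) p%4≡3))
      where
      1≢3 : 1 ≢ 3
      1≢3 ()
      lem : ∀ n → suc ((n ℕ.+ n) ℕ.+ (n ℕ.+ n)) ≡ 1 ℕ.+ n ℕ.* 4
      lem = ℕ-Solver.solve-∀
      p%4≡1 : p % 4 ≡ 1
      p%4≡1 = ≡.trans (≡.cong (_% 4) (≡.trans p≡1+2m (≡.trans (≡.cong (λ i → suc (i ℕ.+ i)) m≡2n) (lem n))))
        (ℕ.[m+kn]%n≡m%n 1 n 4)
    -- p + 1 = 2(m + 1) = 4(n + 1), so both divisions are exact.
    by-parity (n , inj₂ m≡1+2n) = ≡.subst₂
      (λ a b → CongQ p pp ((+ 3 ℚ./ 2) * sumℚ p term2)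
        ((+ 3 ℚ./ 4) * ℤ→ℚ (legendre (+ 6) p) * ℕ→ℚ (a C b)))
      (≡.sym (≡.trans (≡.cong (_/ 2) (≡.trans (≡.cong (ℕ._+ 1) p≡1+2m) (lem₂ m))) (ℕ.m*n/n≡m (suc m) 2)))
      (≡.sym (≡.trans (≡.cong (_/ 4) (≡.trans (≡.cong (ℕ._+ 1) (≡.trans p≡1+2m (≡.cong (λ i → suc (i ℕ.+ i)) m≡1+2n))) (lem₄ n)))
        (ℕ.m*n/n≡m (suc n) 4)))
      (part₃ n m≡1+2n)
      where
      lem₂ : ∀ m → suc (m ℕ.+ m) ℕ.+ 1 ≡ suc m ℕ.* 2
      lem₂ = ℕ-Solver.solve-∀
      lem₄ : ∀ n → suc (suc (n ℕ.+ n) ℕ.+ suc (n ℕ.+ n)) ℕ.+ 1 ≡ suc n ℕ.* 4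
      lem₄ = ℕ-Solver.solve-∀
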